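{- Let $k$ and $m$ be positive integers and let $G$ be a finite simple graph with $c_k(G)=m$. Then $$c_{k+1}(G)\le \max\{\mathrm{LG}_k(m),\ \mathrm{SM}_k(m)\},$$ where, if $\mathrm{SM}_k(m)$ is undefined (i.e. $n_k=k$ in the canonical representation of $m$), the maximum is understood to be $\mathrm{LG}_k(m)$.
   Context: For a graph $G$, $c_i(G)$ is the number of cliques (complete subgraphs) on exactly $i$ vertices. Binomial coefficients are $\binom{n}{j}=0$ when $j>n$ or $j<0$. For integers, write $r_k(n_k,n_{k-1},\dots,n_{k-s})=\binom{n_k}{k}+\binom{n_{k-1}}{k-1}+\dots+\binom{n_{k-s}}{k-s}$. Canonical representation: every positive integer $m$ can be written uniquely as $m=r_k(n_k,\dots,n_{k-s})$ with $s\ge0$ and $n_k>n_{k-1}>\dots>n_{k-s}\ge k-s>0$. Second representation: $m$ can be written uniquely as $m=\binom{n_k}{k}+\binom{n_{k-1}}{k-1}+\sum_{i=1}^{s}\binom{a_{k-i}}{k-i}$ with $s\ge0$, $n_k>n_{k-1}\ge k-2$, $a_{k-1}>\dots>a_{k-s}\ge k-s>0$, and $\binom{n_{k-1}}{k-2}>\sum_{i=1}^s\binom{a_{k-i}}{k-i}$ (here $s=0$ means no $a$-terms, and $n_{k-1}=k-2$ corresponds to $m=\binom{n_k}{k}$). Define $\mathrm{LG}_k(m)=\binom{n_k}{k+1}+\binom{n_{k-1}}{k}+\sum_{i=1}^s\binom{a_{k-i}}{k-i+1}$. Turán numbers: $T_{n,r}$ is the graph on $n$ vertices partitioned into $r$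 parts as evenly as possible, two vertices adjacent iff in different parts; $\binom{n}{k}_r:=c_k(T_{n,r})$. For $r\ge k$, every positive integer $m$ has a unique representation $m=\sum_{i=0}^{s}\binom{b_{k-i}}{k-i}_{r-i}$ with $b_{k-i}-\lfloor b_{k-i}/(r-i)\rfloor>b_{k-i-1}$ for $0\le i<s$ and $b_{k-s}\ge k-s>0$. $\mathrm{SM}_k(m)$: let $n_k$ be the leading term of the canonical representation of $m$. If $n_k>k$, write $m=\sum_{i=0}^s\binom{b_{k-i}}{k-i}_{n_k-1-i}$ (the Turán representation with $r=n_k-1$) and set $\mathrm{SM}_k(m)=\sum_{i=0}^s\binom{b_{k-i}}{k-i+1}_{n_k-1-i}$. If $n_k=k$, $\mathrm{SM}_k(m)$ is undefined. -}

module Defs where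

open import Data.Nat using (ℕ; zero; suc; _+_; _∸_; _≤_; _<_; _/_; _%_; _≡ᵇ_; _⊔_)
open import Data.Nat.Combinatorics using (_C_)
open import Data.Bool using (Bool; true; false; _∧_; _∨_; not; if_then_else_)
open import Data.Fin using (Fin; toℕ)
open import Data.Fin.Subset using (Subset; inside; outside; ∣_∣)
open import Data.Vec using (Vec; []; _∷_)
open import Data.List using (List; []; _∷_; map; _++_; length; filter; allFin)
open import Data.Bool.ListAction using (all)
open import Data.Product using (Σ; _×_)
open import Relation.Binary.PropositionalEquality using (_≡_)
open import Relation.Nullary.Decidable using (⌊_⌋)
open import Relation.Nullary using (Dec)
open import Data.Bool.Properties using (T?)
open import Data.Bool using (T)

record Graph : Set where
  field
    n      : ℕ
    adj    : Fin n → Fin n → Bool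
    sym    : ∀ u v → adj u v ≡ adj v u
    irrefl : ∀ v → adj v v ≡ false

subsets : (n : ℕ) → List (Subset n)
subsets zero    = [] ∷ []
subsets (suc n) = map (inside ∷_) (subsets n) ++ map (outside ∷_) (subsets n)

memb : ∀ {n} → Fin n → Subset n → Bool
memb Fin.zero    (inside ∷ p)  = true
memb Fin.zero    (outside ∷ p) = false
memb (Fin.suc i) (_ ∷ p)       = memb i p

finEq : ∀ {n} → Fin n → Fin n → Bool
finEq u v = toℕ u ≡ᵇ toℕ v

isClique : ∀ {n} → (Fin n → Fin n → Bool) → Subset n → Bool
isClique {n} a S =
  all (λ u → all (λ v → not (memb u S ∧ memb v S ∧ not (finEq u v)) ∨ a u v)
                 (allFin n))
      (allFin n)

cliqueCount : (n : ℕ) → (Fin n → Fin n → Bool) → ℕ → ℕ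
cliqueCount n a i =
  length (filter (λ S → T? (isClique a S ∧ (∣ S ∣ ≡ᵇ i))) (subsets n))

c : Graph → ℕ → ℕ
c G i = cliqueCount (Graph.n G) (Graph.adj G) i

-- Turán graph T_{b,r}: vertex v lies in part (v mod r) (parts as even as
-- possible); adjacent iff in different parts.  (r = 0 never occurs in use.)

part : ℕ → ℕ → ℕ
part zero    v = 0
part (suc r) v = v % suc r

turanAdj : (b r : ℕ) → Fin b → Fin b → Bool
turanAdj b r u v = not (part r (toℕ u) ≡ᵇ part r (toℕ v))

turanC : ℕ → ℕ → ℕ → ℕ
turanC b j r = cliqueCount b (turanAdj b r) j

-- floor division (x / 0 := 0, never used)
fdiv : ℕ → ℕ → ℕ
fdiv x zero    = 0
fdiv x (suc r) = x / suc r

sumTo : ℕ → (ℕ → ℕ) → ℕ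
sumTo zero    f = 0
sumTo (suc n) f = sumTo n f + f n

-- Canonical representation m = Σ_{i=0}^{s} C(n i, k - i)
-- (n i plays the role of n_{k-i}),
-- n_k > n_{k-1} > ... > n_{k-s} ≥ k - s > 0.

record CanonRep (k m : ℕ) : Set where
  field
    s     : ℕ
    nn    : ℕ → ℕ
    decr  : ∀ i → i < s → nn (suc i) < nn i
    low   : k ∸ s ≤ nn s
    pos   : s < k
    value : sumTo (suc s) (λ i → nn i C (k ∸ i)) ≡ m

-- Second representation and LG_k(m).
-- IsLG k m L : L = LG_k(m) computed from a second representation of m.
--  * single : the case n_{k-1} = k - 2, i.e. m = C(n_k, k) (s = 0),
--             LG = C(n_k, k+1).
--  * general: m = C(n_k,k) + C(n_{k-1},k-1) + Σ_{i=1}^s C(a i, k-i),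
--             n_k > n_{k-1} ≥ k-2, a 1 > ... > a s ≥ k-s > 0,
--             C(n_{k-1}, k-2) > Σ_{i=1}^s C(a i, k-i)   (here k ≥ 2).

aSum : ℕ → ℕ → (ℕ → ℕ) → ℕ
aSum k s a = sumTo s (λ j → a (suc j) C (k ∸ suc j))

aSumLG : ℕ → ℕ → (ℕ → ℕ) → ℕ
aSumLG k s a = sumTo s (λ j → a (suc j) C suc (k ∸ suc j))

data IsLG (k m : ℕ) : ℕ → Set where
  single  : (nk : ℕ) → k ≤ suc nk → m ≡ nk C k → IsLG k m (nk C suc k)
  general : (nk n1 s : ℕ) (a : ℕ → ℕ) →
            2 ≤ k →
            n1 < nk →
            k ∸ 2 ≤ n1 →
            (∀ i → 1 ≤ i → i < s → a (suc i) < a i) →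
            (1 ≤ s → k ∸ s ≤ a s × s < k) →
            aSum k s a < n1 C (k ∸ 2) →
            m ≡ nk C k + n1 C (k ∸ 1) + aSum k s a →
            IsLG k m (nk C suc k + n1 C k + aSumLG k s a)

record TuranRep (r k m : ℕ) : Set where
  field
    s     : ℕ
    b     : ℕ → ℕ
    decr  : ∀ i → i < s → b (suc i) < b i ∸ fdiv (b i) (r ∸ i)
    low   : k ∸ s ≤ b s
    pos   : s < k
    value : sumTo (suc s) (λ i → turanC (b i) (k ∸ i) (r ∸ i)) ≡ m

smValue : ∀ {r k m} → TuranRep r k m → ℕ
smValue {r} {k} t =
  sumTo (suc (TuranRep.s t))
        (λ i → turanC (TuranRep.b t i) (suc (k ∸ i)) (r ∸ i))

SMUndefined : ℕ → ℕ → Set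
SMUndefined k m = Σ (CanonRep k m) (λ cr → CanonRep.nn cr 0 ≡ k)

IsSM : ℕ → ℕ → ℕ → Set
IsSM k m S = Σ (CanonRep k m) (λ cr → k < CanonRep.nn cr 0 ×
               Σ (TuranRep (CanonRep.nn cr 0 ∸ 1) k m) (λ t → smValue t ≡ S))

{-# OPTIONS --safe #-}
-- Let n be the leading term of the canonical representation of m = c_k(G), and
-- let ψ(x) denote the Kruskal–Katona bound on the number of (j + 1)-cliques in
-- terms of the number x of j-cliques.
--
-- If G contains a clique K on n vertices, add the remaining vertices to K one by
-- one.  If the i-th of them creates x_i new k-cliques and y_i new (k + 1)-cliques,
-- then y_i ≤ ψ(x_i), and also y_i ≤ C(n_{k-1}, k) + (x_1 + … + x_{i-1}), because a
-- k-clique in its link lies in K or was created earlier.  As ψ is superadditive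
-- and its increments over windows of fixed length are largest at the end of a
-- full block, Σ y_i is largest when the new k-cliques are concentrated in two
-- links, and this is LG_k(m).
--
-- Otherwise every clique of G has at most r = n - 1 vertices.  Remove the colour
-- class of non-neighbours of a vertex v with the most k-cliques in its link; the
-- links obtained have clique number below r, and induction on r leaves an
-- inequality about the colex bound ψ for r-coloured sets (Claim).  It is proved
-- by detaching a vertex that lies in at most as many k-sets as a vertex of minimum
-- degree of the Turán graph of the same size.  If there is none, counting shows
-- that the configuration is the Turán graph with one further vertex, or that the
-- removed class is smaller than the others; in the latter case its role is
-- exchanged with that of colour 0.
module Submission where

-- The inequality behind the coloured case speaks of numbers only: of the link of a removed vertex
-- just two clique counts are kept. Since `ψ` bounds one by the other, such a pair can be pictured
-- as an initial colex segment; this gives meaning to the last vertex of a configuration, its degree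
-- and its splitting by colour 0, although no family of sets is formed. The removed vertices may be
-- adjacent to each other, as a clique is counted at the first removed vertex that it contains.
--
-- Detaching a vertex works when its degree fits into the current block; the obstacle is a
-- configuration all of whose degrees are too large. The count that excludes it needs as many
-- removed vertices as the Turán graph has in the corresponding class, `q + 1`. A smaller class is
-- exchanged with colour 0, and the new class has `q + 1` vertices with nonempty link, so a single
-- exchange suffices.
--
-- Reading `r = 0` as unlimited colours lets one recursion and one bound `ψ` serve binomial
-- coefficients and Turán numbers alike. The price is that `pred 1` would turn exhausted colours
-- into unlimited ones, whence the care about `Feasible` and small `r`.

open import Defs
open import Data.Nat
open import Data.Nat.Properties
open import Data.Nat.DivMod
open import Data.Nat.Divisibility using (n∣m*n)
open import Data.Nat.Induction using (<-wellFounded)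
open import Data.Nat.Combinatorics using (_C_; nCk+nC[k+1]≡[n+1]C[k+1]; nCk≡nC[n∸k]; nCn≡1; k>n⇒nCk≡0)
open import Data.Nat.Tactic.RingSolver using (solve-∀)
open import Induction.WellFounded using (Acc; acc)
open import Data.Bool using (Bool; true; false; T; not; _∧_; _∨_)
open import Data.Bool.Properties using (T?; T-∧; ∧-comm)
open import Data.Fin using (Fin; toℕ; zero; suc)
open import Data.Fin.Properties using (toℕ-injective)
open import Data.Fin.Subset using (Subset; inside; outside; ∣_∣)
open import Data.Vec using (Vec; []; _∷_; lookup) renaming (tabulate to tabulateᵛ)
open import Data.List using (List; []; _∷_; _++_; map; length; filterᵇ; allFin; tabulate; applyUpTo)
open import Data.List.Properties using (++-assoc; filter-all; filter-++; length-++; map-tabulate; applyUpTo-∷ʳ)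
open import Data.List.Membership.Propositional using (_∈_)
open import Data.List.Membership.Propositional.Properties using (∈-∃++)
open import Data.List.Relation.Unary.Any using (here; there)
open import Data.List.Relation.Unary.All using (All; []; _∷_)
import Data.List.Relation.Unary.All as All
import Data.List.Relation.Unary.All.Properties as AllP
open import Data.List.Relation.Unary.AllPairs using (AllPairs; []; _∷_)
import Data.List.Relation.Unary.AllPairs.Properties as AllPairsP
open import Data.List.Relation.Binary.Permutation.Propositional using (_↭_; prep; swap; ↭-refl; ↭-sym; ↭-trans; ↭-reflexive)
import Data.List.Relation.Binary.Permutation.Propositional as Perm
open import Data.List.Relation.Binary.Permutation.Propositional.Properties using (filter-↭; shift; ++-comm; All-resp-↭; ∷↭∷ʳ) renaming (++⁺ˡ to ↭-++⁺ˡ)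
open import Data.List.Relation.Binary.Sublist.Propositional using (_⊆_; []; _∷_; _∷ʳ_; ⊆-refl; ⊆-trans)
open import Data.List.Relation.Binary.Sublist.Propositional.Properties using (filter-⊆; filter⁺) renaming (++⁺ˡ to ⊆-++⁺ˡ)
open import Data.Product using (∃-syntax; _×_; _,_; proj₁; proj₂)
open import Data.Sum using (_⊎_; inj₁; inj₂)
open import Data.Empty using (⊥; ⊥-elim)
open import Data.Unit using (tt)
open import Function using (_∘_; Equivalence)
open import Relation.Binary using (Tri; tri<; tri≈; tri>)
open import Relation.Binary.PropositionalEquality
open import Relation.Nullary using (¬_; Dec; yes; no)
open import Relation.Nullary.Decidable using (_×-dec_)

-- Linear arithmetic by reflection

infixl 7 _:+_
infix 6 _:≤_ _:<_ _:≡_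
infix 3 _⊢_

data Ex (n : ℕ) : Set where
  at   : Fin n → Ex n
  con  : ℕ → Ex n
  _:+_ : Ex n → Ex n → Ex n

data Fm (n : ℕ) : Set where
  _:≤_ _:≡_ : Ex n → Ex n → Fm n

_:<_ : ∀ {n} → Ex n → Ex n → Fm n
a :< b = con 1 :+ a :≤ b

record Seq (n : ℕ) : Set where
  constructor _⊢_
  field
    hyps : List (Fm n)
    goal : Fm n

module _ {n : ℕ} (ρ : Vec ℕ n) where

  ⟦_⟧ : Ex n → ℕ
  ⟦ at i ⟧   = lookup ρ i
  ⟦ con c ⟧  = c
  ⟦ a :+ b ⟧ = ⟦ a ⟧ + ⟦ b ⟧

  Holds : Fm n → Set
  Holds (a :≤ b) = ⟦ a ⟧ ≤ ⟦ b ⟧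
  Holds (a :≡ b) = ⟦ a ⟧ ≡ ⟦ b ⟧

  Entails : List (Fm n) → Fm n → Set
  Entails []       g = Holds g
  Entails (h ∷ hs) g = Holds h → Entails hs g

_⊞_ : ∀ {n} → Vec ℕ n → Vec ℕ n → Vec ℕ n
[]       ⊞ []       = []
(a ∷ as) ⊞ (b ∷ bs) = (a + b) ∷ (as ⊞ bs)

zeros : ∀ n → Vec ℕ n
zeros zero    = []
zeros (suc n) = 0 ∷ zeros n

unit : ∀ {n} → Fin n → Vec ℕ n
unit {suc n} zero    = 1 ∷ zeros n
unit {suc n} (suc i) = 0 ∷ unit i

dot : ∀ {n} → Vec ℕ n → Vec ℕ n → ℕ
dot []       []       = 0
dot (a ∷ as) (x ∷ xs) = a * x + dot as xs

constant : ∀ {n} → Ex n → ℕ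
constant (at i)   = 0
constant (con c)  = c
constant (a :+ b) = constant a + constant b

coeffs : ∀ {n} → Ex n → Vec ℕ n
coeffs (at i)       = unit i
coeffs {n} (con c)  = zeros n
coeffs (a :+ b)     = coeffs a ⊞ coeffs b

dot-zeros : ∀ {n} (ρ : Vec ℕ n) → dot (zeros n) ρ ≡ 0
dot-zeros []      = refl
dot-zeros (x ∷ ρ) = dot-zeros ρ

dot-unit : ∀ {n} (i : Fin n) ρ → dot (unit i) ρ ≡ lookup ρ i
dot-unit zero    (x ∷ ρ) = trans (cong₂ _+_ (+-identityʳ x) (dot-zeros ρ)) (+-identityʳ x)
dot-unit (suc i) (x ∷ ρ) = dot-unit i ρ

+-interchange : ∀ a b c d → (a + b) + (c + d) ≡ (a + c) + (b + d)
+-interchange = solve-∀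

dot-⊞ : ∀ {n} (as bs ρ : Vec ℕ n) → dot (as ⊞ bs) ρ ≡ dot as ρ + dot bs ρ
dot-⊞ []       []       []      = refl
dot-⊞ (a ∷ as) (b ∷ bs) (x ∷ ρ) = trans
  (cong₂ _+_ (*-distribʳ-+ x a b) (dot-⊞ as bs ρ))
  (+-interchange (a * x) (b * x) (dot as ρ) (dot bs ρ))

eval-dot : ∀ {n} (e : Ex n) ρ → ⟦ ρ ⟧ e ≡ constant e + dot (coeffs e) ρ
eval-dot (at i)   ρ = sym (dot-unit i ρ)
eval-dot (con c)  ρ = sym (trans (cong (c +_) (dot-zeros ρ)) (+-identityʳ c))
eval-dot (a :+ b) ρ = trans (cong₂ _+_ (eval-dot a ρ) (eval-dot b ρ))
  (trans (+-interchange (constant a) (dot (coeffs a) ρ) (constant b) (dot (coeffs b) ρ))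
         (cong ((constant a + constant b) +_) (sym (dot-⊞ (coeffs a) (coeffs b) ρ))))

_≤ᵛ_ : ∀ {n} → Vec ℕ n → Vec ℕ n → Bool
[]       ≤ᵛ []       = true
(a ∷ as) ≤ᵛ (b ∷ bs) = (a ≤ᵇ b) ∧ (as ≤ᵛ bs)

∧-true : ∀ a b → a ∧ b ≡ true → a ≡ true
∧-true true _ _ = refl

∧-true′ : ∀ a b → a ∧ b ≡ true → b ≡ true
∧-true′ true _ e = e

≤ᵇ-sound : ∀ a b → (a ≤ᵇ b) ≡ true → a ≤ b
≤ᵇ-sound a b e = ≤ᵇ⇒≤ a b (subst T (sym e) _)

dot-mono : ∀ {n} (as bs ρ : Vec ℕ n) → (as ≤ᵛ bs) ≡ true → dot as ρ ≤ dot bs ρ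
dot-mono []       []       []      _ = z≤n
dot-mono (a ∷ as) (b ∷ bs) (x ∷ ρ) e = +-mono-≤
  (*-monoˡ-≤ x (≤ᵇ-sound a b (∧-true _ _ e)))
  (dot-mono as bs ρ (∧-true′ (a ≤ᵇ b) _ e))

dominated : ∀ {n} → Ex n → Ex n → Bool
dominated a b = (constant a ≤ᵇ constant b) ∧ (coeffs a ≤ᵛ coeffs b)

dominated-sound : ∀ {n} (a b : Ex n) ρ → dominated a b ≡ true → ⟦ ρ ⟧ a ≤ ⟦ ρ ⟧ b
dominated-sound a b ρ e = subst₂ _≤_ (sym (eval-dot a ρ)) (sym (eval-dot b ρ))
  (+-mono-≤ (≤ᵇ-sound (constant a) (constant b) (∧-true _ _ e)) (dot-mono (coeffs a) (coeffs b) ρ (∧-true′ (constant a ≤ᵇ constant b) _ e)))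

-- The hypotheses are summed up to l ≤ r; the goal a ≤ b follows if a + r is
-- dominated coefficientwise by b + l.  Equations are tried in both directions.
derives : ∀ {n} → List (Fm n) → Ex n → Ex n → Ex n → Ex n → Bool
derives []              a b l r = dominated (a :+ r) (b :+ l)
derives ((c :≤ d) ∷ hs) a b l r = derives hs a b (l :+ c) (r :+ d)
derives ((c :≡ d) ∷ hs) a b l r = derives hs a b (l :+ c) (r :+ d) ∨ derives hs a b (l :+ d) (r :+ c)

valid : ∀ {n} → Seq n → Bool
valid (hs ⊢ a :≤ b) = derives hs a b (con 0) (con 0)
valid (hs ⊢ a :≡ b) = derives hs a b (con 0) (con 0) ∧ derives hs b a (con 0) (con 0)

derives-sound : ∀ {n} hs (a b l r : Ex n) ρ → derives hs a b l r ≡ true →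
                ⟦ ρ ⟧ l ≤ ⟦ ρ ⟧ r → Entails ρ hs (a :≤ b)
derives-sound [] a b l r ρ e l≤r =
  +-cancelʳ-≤ (⟦ ρ ⟧ l) _ _ (≤-trans (+-monoʳ-≤ (⟦ ρ ⟧ a) l≤r) (dominated-sound (a :+ r) (b :+ l) ρ e))
derives-sound ((c :≤ d) ∷ hs) a b l r ρ e l≤r h =
  derives-sound hs a b _ _ ρ e (+-mono-≤ l≤r h)
derives-sound ((c :≡ d) ∷ hs) a b l r ρ e l≤r h
  with derives hs a b (l :+ c) (r :+ d) in eq
... | true  = derives-sound hs a b _ _ ρ eq (+-mono-≤ l≤r (≤-reflexive h))
... | false = derives-sound hs a b _ _ ρ e (+-mono-≤ l≤r (≤-reflexive (sym h)))

entails-antisym : ∀ {n} hs (a b : Ex n) ρ →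
                  Entails ρ hs (a :≤ b) → Entails ρ hs (b :≤ a) → Entails ρ hs (a :≡ b)
entails-antisym []       a b ρ p q = ≤-antisym p q
entails-antisym (h ∷ hs) a b ρ p q x = entails-antisym hs a b ρ (p x) (q x)

valid-sound : ∀ {n} (s : Seq n) → valid s ≡ true → ∀ ρ → Entails ρ (Seq.hyps s) (Seq.goal s)
valid-sound (hs ⊢ (a :≤ b)) e ρ = derives-sound hs a b _ _ ρ e z≤n
valid-sound (hs ⊢ (a :≡ b)) e ρ = entails-antisym hs a b ρ
  (derives-sound hs a b _ _ ρ (∧-true _ _ e) z≤n)
  (derives-sound hs b a _ _ ρ (∧-true′ (derives hs a b (con 0) (con 0)) _ e) z≤n)

NAry : ℕ → Set → Set → Set
NAry zero    A B = B
NAry (suc n) A B = A → NAry n A B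

apply : ∀ {A B} n → NAry n A B → Vec A n → B
apply zero    f []       = f
apply (suc n) f (x ∷ xs) = apply n (f x) xs

ForAll : ∀ n → (Vec ℕ n → Set) → Set
ForAll zero    P = P []
ForAll (suc n) P = ∀ x → ForAll n (λ xs → P (x ∷ xs))

forAll : ∀ n {P : Vec ℕ n → Set} → (∀ xs → P xs) → ForAll n P
forAll zero    f = f []
forAll (suc n) f = λ x → forAll n (λ xs → f (x ∷ xs))

-- The sequent is given as a function of `n` variables and reified by applying it to the atoms;
-- `refl` runs the check. The remaining arguments of a call are the numbers and then the proofs of
-- the hypotheses, each used exactly once.
lin : ∀ n (s : NAry n (Ex n) (Seq n)) → let p = apply n s (tabulateᵛ at) in
      valid p ≡ true → ForAll n (λ ρ → Entails ρ (Seq.hyps p) (Seq.goal p))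
lin n s e = forAll n (valid-sound (apply n s (tabulateᵛ at)) e)

-- Clique numbers of Turán graphs

-- Among vertices 0, …, n - 1 coloured mod r, the number of those whose colour
-- differs from that of vertex n.  Throughout, r = 0 means that all vertices
-- have different colours.
others : ℕ → ℕ → ℕ
others r n = n ∸ fdiv n r

-- The earlier vertices whose colour differs from that of vertex `n` are, in their order, again
-- coloured cyclically, with one colour less. For `r = 1` no such vertices exist, so reaching
-- `pred 1 = 0` does no harm.
τ : ℕ → ℕ → ℕ → ℕ
τ zero    n       r = 1
τ (suc k) zero    r = 0
τ (suc k) (suc n) r = τ (suc k) n r + τ k (others r n) (pred r)

fdiv-rem : ∀ R q {s} → s ≤ R → fdiv (s + q * suc R) (suc R) ≡ q
fdiv-rem R q {s} s≤R = begin
  (s + q * suc R) / suc R         ≡⟨ +-distrib-/-∣ʳ s (n∣m*n q) ⟩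
  s / suc R + q * suc R / suc R   ≡⟨ cong₂ _+_ (m<n⇒m/n≡0 (s≤s s≤R)) (m*n/n≡m q (suc R)) ⟩
  q                               ∎
  where open ≡-Reasoning

others-rem : ∀ R q {s} → s ≤ R → others (suc R) (s + q * suc R) ≡ s + q * R
others-rem R q {s} s≤R = begin
  (s + q * suc R) ∸ fdiv (s + q * suc R) (suc R) ≡⟨ cong ((s + q * suc R) ∸_) (fdiv-rem R q s≤R) ⟩
  (s + q * suc R) ∸ q                            ≡⟨ cong (_∸ q) (regroup s q R) ⟩
  (s + q * R + q) ∸ q                            ≡⟨ m+n∸n≡m (s + q * R) q ⟩
  s + q * R                                      ∎
  where
  open ≡-Reasoning
  regroup : ∀ s q R → s + q * suc R ≡ s + q * R + q
  regroup = solve-∀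

data Divided (R : ℕ) : ℕ → Set where
  divided : ∀ q s → s ≤ R → Divided R (s + q * suc R)

divide : ∀ R n → Divided R n
divide R n = subst (Divided R) (sym (m≡m%n+[m/n]*n n (suc R)))
  (divided (n / suc R) (n % suc R) (≤-pred (m%n<n n (suc R))))

others-suc : ∀ r n → others r (suc n) ≡ others r n ⊎ others r (suc n) ≡ suc (others r n)
others-suc zero    n = inj₂ refl
others-suc (suc R) n with divide R n
... | divided q s s≤R with m≤n⇒m<n∨m≡n s≤R
...   | inj₁ s<R  = inj₂ (trans (others-rem R q s<R) (cong suc (sym (others-rem R q s≤R))))
...   | inj₂ refl = inj₁ (trans (others-rem R (suc q) z≤n) (sym (others-rem R q ≤-refl)))

others-suc-≤ : ∀ r n → others r n ≤ others r (suc n)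
others-suc-≤ r n with others-suc r n
... | inj₁ e = ≤-reflexive (sym e)
... | inj₂ e = ≤-trans (n≤1+n _) (≤-reflexive (sym e))

stepwise-mono : (f : ℕ → ℕ) → (∀ n → f n ≤ f (suc n)) → ∀ {m n} → m ≤ n → f m ≤ f n
stepwise-mono f step {m} {n} m≤n with m≤n⇒m<n∨m≡n m≤n
... | inj₂ refl = ≤-refl
stepwise-mono f step {m} {suc n} m≤n | inj₁ (s≤s m≤n′) = ≤-trans (stepwise-mono f step m≤n′) (step n)

others-mono : ∀ r {m n} → m ≤ n → others r m ≤ others r n
others-mono r = stepwise-mono (others r) (others-suc-≤ r)

others-≤ : ∀ r n → others r n ≤ n
others-≤ r n = m∸n≤m n (fdiv n r)

others-small : ∀ r {n} → n < r → others r n ≡ n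
others-small (suc R) {n} (s≤s n≤R) = begin
  others (suc R) n                 ≡⟨ cong (others (suc R)) (sym (+-identityʳ n)) ⟩
  others (suc R) (n + 0 * suc R)   ≡⟨ others-rem R 0 n≤R ⟩
  n + 0                            ≡⟨ +-identityʳ n ⟩
  n                                ∎
  where open ≡-Reasoning

others-low : ∀ r {k n} → k ≤ n → k < r → k ≤ others r n
others-low r {k} {n} k≤n k<r = subst (_≤ others r n) (others-small r k<r) (others-mono r k≤n)

-- Exactly the condition under which properly coloured `k`-sets exist on sufficiently many vertices.
Feasible : ℕ → ℕ → Set
Feasible k r = r ≡ 0 ⊎ k ≤ r

feasible-pred : ∀ {k r} → Feasible (suc k) r → Feasible k (pred r)
feasible-pred (inj₁ refl) = inj₁ refl
feasible-pred {r = suc r} (inj₂ (s≤s k≤r)) = inj₂ k≤r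

feasible-low : ∀ {k r n} → Feasible (suc k) r → k ≤ n → k ≤ others r n
feasible-low (inj₁ refl) k≤n = k≤n
feasible-low {r = r} (inj₂ k<r) k≤n = others-low r k≤n k<r

τ-suc-≤ : ∀ k r n → τ k n r ≤ τ k (suc n) r
τ-suc-≤ zero    r n = ≤-refl
τ-suc-≤ (suc k) r n = m≤m+n _ _

τ-mono : ∀ k r {m n} → m ≤ n → τ k m r ≤ τ k n r
τ-mono k r = stepwise-mono (λ n → τ k n r) (τ-suc-≤ k r)

τ-cancel-< : ∀ k r {m n} → τ k m r < τ k n r → m < n
τ-cancel-< k r {m} {n} lt with m <? n
... | yes m<n = m<n
... | no  m≮n = ⊥-elim (<⇒≱ lt (τ-mono k r (≮⇒≥ m≮n)))

τ-1 : ∀ n r → τ 1 n r ≡ n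
τ-1 zero    r = refl
τ-1 (suc n) r = trans (cong (_+ 1) (τ-1 n r)) (+-comm n 1)

τ-low : ∀ {k n} r → n < k → τ k n r ≡ 0
τ-low {suc k} {zero}  r _ = refl
τ-low {suc k} {suc n} r (s≤s n<k) = cong₂ _+_ (τ-low {suc k} {n} r (m<n⇒m<1+n n<k))
  (τ-low {k} {others r n} (pred r) (≤-<-trans (others-≤ r n) n<k))

τ-pos : ∀ {k n r} → Feasible k r → k ≤ n → 1 ≤ τ k n r
τ-pos {zero}              _ _ = ≤-refl
τ-pos {suc k} {suc n} {r} f (s≤s k≤n) =
  ≤-trans (τ-pos (feasible-pred f) (feasible-low f k≤n)) (m≤n+m _ (τ (suc k) n r))

τ-infeasible : ∀ {k n R} → suc R < k → τ k n (suc R) ≡ 0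
τ-infeasible {suc k} {zero}           _ = refl
τ-infeasible {suc k} {suc n} {zero}   lt@(s≤s 0<k) =
  cong₂ _+_ (τ-infeasible {n = n} lt) (τ-low 0 (subst (_< k) (sym others-1) 0<k))
  where
  others-1 : others 1 n ≡ 0
  others-1 = trans (cong (n ∸_) (n/1≡n n)) (n∸n≡0 n)
τ-infeasible {suc k} {suc n} {suc R}  lt@(s≤s lt′) =
  cong₂ _+_ (τ-infeasible {n = n} lt) (τ-infeasible {n = others (suc (suc R)) n} lt′)

τ-vanish : ∀ k n r → τ k n r ≡ 0 → τ (suc k) n r ≡ 0
τ-vanish zero    n       r ()
τ-vanish (suc k) zero    r _ = refl
τ-vanish (suc k) (suc n) r e = cong₂ _+_
  (τ-vanish (suc k) n r (m+n≡0⇒m≡0 _ e))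
  (τ-vanish k (others r n) (pred r) (m+n≡0⇒n≡0 (τ (suc k) n r) e))

-- Deleting from the Turán graph on s + q (R + 1) vertices one of its smallest
-- colour classes, which has q vertices.
τ-class : ∀ k R q {s} → s ≤ R →
  τ (suc k) (s + q * suc R) (suc R) ≡ τ (suc k) (s + q * R) R + q * τ k (s + q * R) R
τ-class k R zero    {zero}  _ = refl
τ-class k R (suc q) {zero}  _ = begin
  τ (suc k) (R + q * suc R) (suc R) + τ k (others (suc R) (R + q * suc R)) R
    ≡⟨ cong₂ _+_ (τ-class k R q ≤-refl) (cong (λ n → τ k n R) (others-rem R q ≤-refl)) ⟩
  τ (suc k) (R + q * R) R + q * τ k (R + q * R) R + τ k (R + q * R) R
    ≡⟨ regroup (τ (suc k) (R + q * R) R) q (τ k (R + q * R) R) ⟩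
  τ (suc k) (R + q * R) R + (τ k (R + q * R) R + q * τ k (R + q * R) R) ∎
  where
  open ≡-Reasoning
  regroup : ∀ a q t → a + q * t + t ≡ a + (t + q * t)
  regroup = solve-∀
τ-class k (suc R) q {suc s} s<R@(s≤s s≤R) = begin
  τ (suc k) (s + q * suc (suc R)) (suc (suc R)) + τ k (others (suc (suc R)) (s + q * suc (suc R))) (suc R)
    ≡⟨ cong₂ _+_ (τ-class k (suc R) q (<⇒≤ s<R))
                 (cong (λ n → τ k n (suc R)) (others-rem (suc R) q (<⇒≤ s<R))) ⟩
  τ (suc k) n (suc R) + q * τ k n (suc R) + τ k n (suc R)
    ≡⟨ expand k ⟩
  τ (suc k) n (suc R) + τ k (others (suc R) n) R + q * τ k (suc n) (suc R) ∎
  where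
  open ≡-Reasoning
  n = s + q * suc R
  expand : ∀ k → τ (suc k) n (suc R) + q * τ k n (suc R) + τ k n (suc R)
               ≡ τ (suc k) n (suc R) + τ k (others (suc R) n) R + q * τ k (suc n) (suc R)
  expand zero    = regroup (τ 1 n (suc R)) q
    where
    regroup : ∀ a q → a + q * 1 + 1 ≡ a + 1 + q * 1
    regroup = solve-∀
  expand (suc k) = begin
    t + q * u + u                                          ≡⟨ cong (t + q * u +_) u-split ⟩
    t + q * u + (τ (suc k) n′ R + q * τ k n′ R)            ≡⟨ regroup t q u (τ (suc k) n′ R) (τ k n′ R) ⟩
    t + τ (suc k) n′ R + q * (u + τ k n′ R)                ≡⟨ cong (λ x → t + τ (suc k) x R + q * (u + τ k x R)) (sym (others-rem R q s≤R)) ⟩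
    t + τ (suc k) (others (suc R) n) R + q * (u + τ k (others (suc R) n) R) ∎
    where
    n′ = s + q * R
    t = τ (2 + k) n (suc R)
    u = τ (suc k) n (suc R)
    -- One of the `q + 1` copies of `u` is expanded by deleting a second class of `q` vertices, so
    -- that the removed class and the class of the new vertex enter symmetrically.
    u-split : u ≡ τ (suc k) n′ R + q * τ k n′ R
    u-split = τ-class k R q s≤R
    regroup : ∀ t q u a b → t + q * u + (a + q * b) ≡ t + a + q * (u + b)
    regroup = solve-∀

τ-class₊ : ∀ k R q {s} → s ≤ R →
  τ (suc k) (suc s + q * suc R) (suc R) ≡ τ (suc k) (s + q * R) R + suc q * τ k (s + q * R) R
τ-class₊ k R q {s} s≤R = begin
  τ (suc k) (s + q * suc R) (suc R) + τ k (others (suc R) (s + q * suc R)) R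
    ≡⟨ cong₂ _+_ (τ-class k R q s≤R) (cong (λ n → τ k n R) (others-rem R q s≤R)) ⟩
  τ (suc k) (s + q * R) R + q * τ k (s + q * R) R + τ k (s + q * R) R
    ≡⟨ regroup (τ (suc k) (s + q * R) R) q (τ k (s + q * R) R) ⟩
  τ (suc k) (s + q * R) R + (τ k (s + q * R) R + q * τ k (s + q * R) R) ∎
  where
  open ≡-Reasoning
  regroup : ∀ a q t → a + q * t + t ≡ a + (t + q * t)
  regroup = solve-∀

-- Colexicographic segments of coloured sets

largest : (ℕ → ℕ) → ℕ → ℕ → ℕ
largest f m zero    = 0
largest f m (suc n) with f (suc n) ≤? m
... | yes _ = suc n
... | no  _ = largest f m n

largest-≤ : ∀ (f : ℕ → ℕ) m n → f 0 ≤ m → f (largest f m n) ≤ m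
largest-≤ f m zero    f0≤m = f0≤m
largest-≤ f m (suc n) f0≤m with f (suc n) ≤? m
... | yes p = p
... | no  _ = largest-≤ f m n f0≤m

largest-max : ∀ (f : ℕ → ℕ) m n {b} → b ≤ n → f b ≤ m → b ≤ largest f m n
largest-max f m zero    b≤n _ = b≤n
largest-max f m (suc n) b≤n fb≤m with f (suc n) ≤? m
... | yes _ = b≤n
... | no ¬p with m≤n⇒m<n∨m≡n b≤n
...   | inj₁ (s≤s b≤n′) = largest-max f m n b≤n′ fb≤m
...   | inj₂ refl = ⊥-elim (¬p fb≤m)

-- By `τ-growth` the count exceeds `m` at `k + suc m` vertices, whence the bound of the search. If
-- no properly coloured sets exist, the search stops at this bound.
leading : ℕ → ℕ → ℕ → ℕ
leading k r m = largest (λ n → τ (suc k) n r) m (m + suc k)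

leading-≤ : ∀ k r m → τ (suc k) (leading k r m) r ≤ m
leading-≤ k r m = largest-≤ (λ n → τ (suc k) n r) m (m + suc k) z≤n

-- The size of the b-th colex block of (k + 1)-sets: those with largest vertex b.
block : ℕ → ℕ → ℕ → ℕ
block k r b = τ k (others r b) (pred r)

block-mono : ∀ k r {a b} → a ≤ b → block k r a ≤ block k r b
block-mono k r a≤b = τ-mono k (pred r) (others-mono r a≤b)

block-pos : ∀ {k r b} → Feasible (suc k) r → k ≤ b → 1 ≤ block k r b
block-pos f k≤b = τ-pos (feasible-pred f) (feasible-low f k≤b)

τ-growth : ∀ {k r} → Feasible (suc k) r → ∀ j → j ≤ τ (suc k) (k + j) r
τ-growth f zero = z≤n
τ-growth {k} {r} f (suc j) = subst (λ n → suc j ≤ τ (suc k) n r) (sym (+-suc k j))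
  (≤-trans (≤-reflexive (+-comm 1 j)) (+-mono-≤ (τ-growth f j) (block-pos {k} {r} f (m≤m+n k j))))

feasible? : ∀ k r → Feasible k r ⊎ (∃[ R ] r ≡ suc R × suc R < k)
feasible? k zero = inj₁ (inj₁ refl)
feasible? k (suc R) with k ≤? suc R
... | yes p = inj₁ (inj₂ p)
... | no ¬p = inj₂ (R , refl , ≰⇒> ¬p)

-- What is computed from a block `b` and a position `z` in it depends on the rank alone when the end
-- of each block agrees with the start of the next.
Glued : ℕ → ℕ → {A : Set} → (ℕ → ℕ → A) → Set
Glued k r F = ∀ b → F b (block k r b) ≡ F (suc b) 0

glued-constant : ∀ k r {A : Set} {F : ℕ → ℕ → A} → Glued k r F →
  ∀ {m n} → m ≤ n → τ (suc k) m r ≡ τ (suc k) n r → F m 0 ≡ F n 0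
glued-constant k r glued {m} {n} m≤n e with m≤n⇒m<n∨m≡n m≤n
... | inj₂ refl = refl
glued-constant k r {F = F} glued {m} {suc n} m≤n e | inj₁ (s≤s m≤n′) =
  trans (glued-constant k r {F = F} glued m≤n′ e₁) (trans (cong (F n) (sym e₂)) (glued n))
  where
  a = τ (suc k) m r
  b = τ (suc k) n r
  d = block k r n
  e₁ : a ≡ b
  e₁ = ≤-antisym (τ-mono (suc k) r m≤n′)
         (lin 3 (λ a b c → a :≡ b :+ c ∷ [] ⊢ b :≤ a) refl a b d e)
  e₂ : d ≡ 0
  e₂ = lin 3 (λ a b c → a :≡ b :+ c ∷ a :≡ b ∷ [] ⊢ c :≡ con 0) refl a b d e e₁

-- Two representations of one rank differ by a full block read as the start of the next and by empty
-- blocks in between, and `F` respects both. Hence the representation found by `leading` can be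
-- replaced by any other one.
glue : ∀ k r {A : Set} {F : ℕ → ℕ → A} → Glued k r F → ∀ b {z} → z ≤ block k r b →
  let m = τ (suc k) b r + z
      b* = leading k r m in
  F b* (m ∸ τ (suc k) b* r) ≡ F b z
glue k r {F = F} glued b {z} z≤blk = by-order (<-cmp b* b)
  where
  f = λ n → τ (suc k) n r
  m = f b + z
  b* = leading k r m
  fb*≤m : f b* ≤ m
  fb*≤m = leading-≤ k r m
  -- `b` can lie outside the range of the search only if no properly coloured sets exist, and then
  -- all blocks are empty.
  vanish : ¬ (b ≤ m + suc k) → ∀ n → f n ≡ 0
  vanish b≰ with feasible? (suc k) r
  ... | inj₂ (R , refl , lt) = λ n → τ-infeasible {n = n} lt
  ... | inj₁ feas = ⊥-elim (<⇒≱ (τ-growth feas (suc m))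
    (≤-trans (τ-mono (suc k) r
      (lin 3 (λ k m b → con 1 :+ (m :+ (con 1 :+ k)) :≤ b ∷ [] ⊢ k :+ (con 1 :+ m) :≤ b) refl k m b (≰⇒> b≰)))
      (m≤m+n (f b) z)))
  by-order : Tri (b* < b) (b* ≡ b) (b* > b) → F b* (m ∸ f b*) ≡ F b z
  by-order (tri≈ _ e _) = trans (cong (λ x → F x (m ∸ f x)) e) (cong (F b) (m+n∸m≡n (f b) z))
  by-order (tri> _ _ b<b*) = trans (cong (F b*) (m≤n⇒m∸n≡0 m≤fb*))
    (trans (sym (glued-constant k r {F = F} glued b<b* fb≡)) (trans (sym (glued b)) (cong (F b) (sym z≡blk))))
    where
    fsb≤fb* : f (suc b) ≤ f b*
    fsb≤fb* = τ-mono (suc k) r b<b*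
    m≤fsb : m ≤ f (suc b)
    m≤fsb = +-monoʳ-≤ (f b) z≤blk
    m≤fb* : m ≤ f b*
    m≤fb* = ≤-trans m≤fsb fsb≤fb*
    fb≡ : f (suc b) ≡ f b*
    fb≡ = ≤-antisym fsb≤fb* (≤-trans fb*≤m m≤fsb)
    z≡blk : z ≡ block k r b
    z≡blk = ≤-antisym z≤blk (+-cancelˡ-≤ (f b) _ _ (≤-trans (≤-reflexive fb≡) fb*≤m))
  by-order (tri< b*<b _ _) with b ≤? m + suc k
  ... | yes b≤ = ⊥-elim (<⇒≱ b*<b (largest-max f m (m + suc k) b≤ (m≤m+n (f b) z)))
  ... | no b≰ = trans (cong (F b*) (trans (cong (m ∸_) (vanish b≰ b*)) (cong (_+ z) (vanish b≰ b))))
    (trans (cong (F b*) z≡0) (trans (glued-constant k r {F = F} glued (<⇒≤ b*<b) (trans (vanish b≰ b*) (sym (vanish b≰ b)))) (cong (F b) (sym z≡0))))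
    where
    z≡0 : z ≡ 0
    z≡0 = n≤0⇒n≡0 (≤-trans z≤blk (≤-trans (m≤n+m _ (f b)) (≤-reflexive (vanish b≰ (suc b)))))

-- The number of (κ + 2)-sets all of whose (κ + 1)-subsets lie among the first m
-- properly coloured (κ + 1)-sets in colexicographic order.  The clause r = 1
-- keeps ψ zero whenever 1 ≤ r ≤ κ.
ψ : ℕ → ℕ → ℕ → ℕ
ψ zero    r m = τ 2 m r
ψ (suc κ) 1 m = 0
ψ (suc κ) r m = τ (3 + κ) b r + ψ κ (pred r) (m ∸ τ (2 + κ) b r)
  where b = leading (suc κ) r m

ψ-zero : ∀ κ r → ψ κ r 0 ≡ 0
ψ-zero-step : ∀ κ r b → τ (2 + κ) b r ≤ 0 → τ (3 + κ) b r + ψ κ (pred r) (0 ∸ τ (2 + κ) b r) ≡ 0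
ψ-zero-step κ r b τ≤0 = cong₂ _+_ (τ-vanish (2 + κ) b r (n≤0⇒n≡0 τ≤0))
  (trans (cong (ψ κ (pred r)) (0∸n≡0 (τ (2 + κ) b r))) (ψ-zero κ (pred r)))
ψ-zero zero    r = refl
ψ-zero (suc κ) 0 = ψ-zero-step κ 0 (leading (suc κ) 0 0) (leading-≤ (suc κ) 0 0)
ψ-zero (suc κ) 1 = refl
ψ-zero (suc κ) (suc (suc r)) = ψ-zero-step κ (2 + r) (leading (suc κ) (2 + r) 0) (leading-≤ (suc κ) (2 + r) 0)

-- Gluing the blocks at level `κ + 1` uses this at level `κ`, hence the declaration ahead of the
-- proof.
ψ-boundary : ∀ κ r b → ψ κ r (τ (suc κ) b r) ≡ τ (2 + κ) b r

ψ-glued : ∀ κ r → Glued (suc κ) r (λ b z → τ (3 + κ) b r + ψ κ (pred r) z)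
ψ-glued κ r b = trans (cong (τ (3 + κ) b r +_) (ψ-boundary κ (pred r) (others r b)))
  (sym (trans (cong (τ (3 + κ) (suc b) r +_) (ψ-zero κ (pred r))) (+-identityʳ _)))

-- The recursion of `ψ` for every representation of its argument, block ends included; later proofs
-- use it instead of unfolding `leading`.
ψ-block : ∀ κ r b {z} → z ≤ block (suc κ) r b →
  ψ (suc κ) r (τ (2 + κ) b r + z) ≡ τ (3 + κ) b r + ψ κ (pred r) z
ψ-block κ 0 b z≤blk = glue (suc κ) 0 (ψ-glued κ 0) b z≤blk
ψ-block κ 1 b {z} z≤blk = sym (cong₂ _+_ (τ-infeasible {n = b} (s≤s (s≤s z≤n)))
  (trans (cong (ψ κ 0) (n≤0⇒n≡0 (≤-trans z≤blk (≤-reflexive empty)))) (ψ-zero κ 0)))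
  where
  empty : block (suc κ) 1 b ≡ 0
  empty = m+n≡0⇒n≡0 (τ (2 + κ) b 1) (τ-infeasible {n = suc b} {R = 0} (s≤s (s≤s z≤n)))
ψ-block κ (suc (suc r)) b z≤blk = glue (suc κ) (2 + r) (ψ-glued κ (2 + r)) b z≤blk

ψ-boundary zero    r b = cong (λ n → τ 2 n r) (τ-1 b r)
ψ-boundary (suc κ) r b = begin
  ψ (suc κ) r (τ (2 + κ) b r)           ≡⟨ cong (ψ (suc κ) r) (sym (+-identityʳ _)) ⟩
  ψ (suc κ) r (τ (2 + κ) b r + 0)       ≡⟨ ψ-block κ r b z≤n ⟩
  τ (3 + κ) b r + ψ κ (pred r) 0        ≡⟨ cong (τ (3 + κ) b r +_) (ψ-zero κ (pred r)) ⟩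
  τ (3 + κ) b r + 0                     ≡⟨ +-identityʳ _ ⟩
  τ (3 + κ) b r                         ∎
  where open ≡-Reasoning

data Located (k r : ℕ) : ℕ → Set where
  located : ∀ b z → z < block k r b → Located k r (τ (suc k) b r + z)

locate : ∀ {k r} → Feasible (suc k) r → ∀ m → Located k r m
locate {k} {r} f zero = subst (Located k r) (trans (+-identityʳ _) (τ-low {suc k} {k} r ≤-refl))
  (located k 0 (block-pos {k} {r} f ≤-refl))
locate {k} {r} f (suc m) with locate f m
... | located b z z<blk with m≤n⇒m<n∨m≡n z<blk
...   | inj₁ sz<blk = subst (Located k r) (+-suc _ z) (located b (suc z) sz<blk)
...   | inj₂ sz≡blk = subst (Located k r)
  (trans (+-identityʳ _) (trans (cong (τ (suc k) b r +_) (sym sz≡blk)) (+-suc _ z)))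
  (located (suc b) 0 (≤-trans (≤-trans (s≤s z≤n) z<blk) (block-mono k r (n≤1+n b))))

-- At a block boundary this ends block `b` where `Located` begins a new block. The remainder is
-- never empty, so splitting it off makes the number strictly smaller.
data Located₊ (k r : ℕ) : ℕ → Set where
  located₊ : ∀ b z → suc z ≤ block k r b → Located₊ k r (τ (suc k) b r + suc z)

locate₊ : ∀ {k r} → Feasible (suc k) r → ∀ m → Located₊ k r (suc m)
locate₊ {k} {r} f m with locate f m
... | located b z z<blk = subst (Located₊ k r) (+-suc _ z) (located₊ b z z<blk)

ψ-suc-≤ : ∀ κ r → Feasible (suc κ) r → ∀ m → ψ κ r m ≤ ψ κ r (suc m)
ψ-suc-≤ zero    r f m = τ-suc-≤ 2 r m
ψ-suc-≤ (suc κ) r f m with locate {suc κ} f m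
... | located b z z<blk = subst₂ _≤_ (sym (ψ-block κ r b (<⇒≤ z<blk)))
  (sym (trans (cong (ψ (suc κ) r) (sym (+-suc _ z))) (ψ-block κ r b z<blk)))
  (+-monoʳ-≤ _ (ψ-suc-≤ κ (pred r) (feasible-pred f) z))

ψ-mono : ∀ κ {r m n} → Feasible (suc κ) r → m ≤ n → ψ κ r m ≤ ψ κ r n
ψ-mono κ {r} f = stepwise-mono (ψ κ r) (ψ-suc-≤ κ r f)

ψ-infeasible : ∀ {κ R} m → suc R ≤ κ → ψ κ (suc R) m ≡ 0
ψ-infeasible {suc κ} {zero}  m _ = refl
ψ-infeasible {suc κ} {suc R} m (s≤s R<κ) =
  cong₂ _+_ (τ-infeasible {n = leading (suc κ) (2 + R) m} (s≤s (s≤s (m≤n⇒m≤1+n R<κ))))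
            (ψ-infeasible _ R<κ)

ψ-top : ∀ κ m → ψ κ (suc κ) m ≡ 0
ψ-top zero    m = τ-infeasible {n = m} ≤-refl
ψ-top (suc κ) m = cong₂ _+_ (τ-infeasible {n = leading (suc κ) (2 + κ) m} ≤-refl) (ψ-top κ _)

-- Superadditivity and window increments of the colex bound

Superadditive Windowed : ℕ → ℕ → Set
Superadditive κ r = ∀ a b → ψ κ r a + ψ κ r b ≤ ψ κ r (a + b)
-- Among all windows of a given length inside an initial segment of whole blocks,
-- the last one has the largest increment of ψ.
Windowed κ r = ∀ β {u v w} → u ≤ τ (suc κ) β r → v ≤ τ (suc κ) β r → u + v ≡ τ (suc κ) β r + w →
  ψ κ r u + ψ κ r v ≤ ψ κ r (τ (suc κ) β r) + ψ κ r w

module Step (κ r : ℕ) (feas : Feasible (2 + κ) r)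
            (superadd : Superadditive κ (pred r)) (windowed : Windowed κ (pred r)) where

  private
    f = λ n → τ (2 + κ) n r
    f′ = λ n → τ (3 + κ) n r
    Ψ = ψ (suc κ) r
    Ψ′ = ψ κ (pred r)
    blk = block (suc κ) r

  -- If `z + x` fits into block `b`, superadditivity one level lower suffices. Otherwise the window
  -- property for this block moves one part to the end of the block, and the excess opens the next
  -- block, which is at least as wide.
  ψ-append : ∀ b {z x} → z ≤ blk b → x ≤ blk b → Ψ (f b + z) + Ψ′ x ≤ Ψ (f b + z + x)
  ψ-append b {z} {x} z≤ x≤ with z + x ≤? blk b
  ... | yes p = begin
    Ψ (f b + z) + Ψ′ x       ≡⟨ cong (_+ Ψ′ x) (ψ-block κ r b z≤) ⟩
    f′ b + Ψ′ z + Ψ′ x       ≡⟨ +-assoc (f′ b) _ _ ⟩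
    f′ b + (Ψ′ z + Ψ′ x)     ≤⟨ +-monoʳ-≤ (f′ b) (superadd z x) ⟩
    f′ b + Ψ′ (z + x)        ≡⟨ sym (ψ-block κ r b p) ⟩
    Ψ (f b + (z + x))        ≡⟨ cong Ψ (sym (+-assoc (f b) z x)) ⟩
    Ψ (f b + z + x)          ∎
    where open ≤-Reasoning
  ... | no ¬p = begin
    Ψ (f b + z) + Ψ′ x             ≡⟨ cong (_+ Ψ′ x) (ψ-block κ r b z≤) ⟩
    f′ b + Ψ′ z + Ψ′ x             ≡⟨ +-assoc (f′ b) _ _ ⟩
    f′ b + (Ψ′ z + Ψ′ x)           ≤⟨ +-monoʳ-≤ (f′ b) (windowed (others r b) z≤ x≤ (sym zx)) ⟩
    f′ b + (Ψ′ (blk b) + Ψ′ w)     ≡⟨ sym (+-assoc (f′ b) _ _) ⟩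
    f′ b + Ψ′ (blk b) + Ψ′ w       ≡⟨ cong (λ t → f′ b + t + Ψ′ w) (ψ-boundary κ (pred r) (others r b)) ⟩
    f′ (suc b) + Ψ′ w              ≡⟨ sym (ψ-block κ r (suc b) w≤) ⟩
    Ψ (f b + blk b + w)            ≡⟨ cong Ψ (trans (+-assoc (f b) _ _) (trans (cong (f b +_) zx) (sym (+-assoc (f b) z x)))) ⟩
    Ψ (f b + z + x)                ∎
    where
    open ≤-Reasoning
    w = z + x ∸ blk b
    zx : blk b + w ≡ z + x
    zx = m+[n∸m]≡n (<⇒≤ (≰⇒> ¬p))
    w≤ : w ≤ blk (suc b)
    w≤ = ≤-trans (lin 4 (λ z x w B → z :≤ B ∷ x :≤ B ∷ B :+ w :≡ z :+ x ∷ [] ⊢ w :≤ B) refl z x w (blk b) z≤ x≤ zx)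
                 (block-mono (suc κ) r (n≤1+n b))

  private
    smaller-block : ∀ {g h w z} → f g + suc w ≤ f h + z → z < blk h → g ≤ h
    smaller-block {g} {h} {w} {z} le z< = ≤-pred (τ-cancel-< (2 + κ) r
      (lin 5 (λ G H w z B → G :+ (con 1 :+ w) :≤ H :+ z ∷ z :< B ∷ [] ⊢ G :< H :+ B) refl (f g) (f h) w z (blk h) le z<))

  -- The smaller number is dismantled from the top: its last, possibly incomplete block is appended
  -- to the larger number, whose current block is at least as wide, and `f g` is left over for the
  -- recursion.
  superadd-ordered : ∀ t a → Acc _<_ t → t ≤ a → Ψ a + Ψ t ≤ Ψ (a + t)
  superadd-ordered zero    a _ _ = ≤-reflexive (trans (cong (Ψ a +_) (ψ-zero (suc κ) r))
    (trans (+-identityʳ _) (cong Ψ (sym (+-identityʳ a)))))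
  superadd-ordered (suc t) a (acc rec) t≤a = go (locate₊ {suc κ} feas t) (locate {suc κ} feas a) rec t≤a
    where
    go : ∀ {t a} → Located₊ (suc κ) r t → Located (suc κ) r a → (∀ {y} → y < t → Acc _<_ y) →
         t ≤ a → Ψ a + Ψ t ≤ Ψ (a + t)
    go (located₊ g w w≤) (located h z z<) rec t≤a = begin
      Ψ a₀ + Ψ (f g + suc w)            ≡⟨ cong (Ψ a₀ +_) (ψ-block κ r g w≤) ⟩
      Ψ a₀ + (f′ g + Ψ′ (suc w))        ≡⟨ lin 3 (λ a b c → [] ⊢ a :+ (b :+ c) :≡ a :+ c :+ b) refl (Ψ a₀) (f′ g) (Ψ′ (suc w)) ⟩
      Ψ a₀ + Ψ′ (suc w) + f′ g          ≤⟨ +-monoˡ-≤ (f′ g) (ψ-append h (<⇒≤ z<) (≤-trans w≤ (block-mono (suc κ) r (smaller-block {g} {h} t≤a z<)))) ⟩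
      Ψ (a₀ + suc w) + f′ g             ≡⟨ cong (Ψ (a₀ + suc w) +_) (sym (ψ-boundary (suc κ) r g)) ⟩
      Ψ (a₀ + suc w) + Ψ (f g)          ≤⟨ superadd-ordered (f g) (a₀ + suc w) (rec (m<m+n (f g) (s≤s z≤n))) (≤-trans (≤-trans (m≤m+n (f g) _) t≤a) (m≤m+n a₀ _)) ⟩
      Ψ (a₀ + suc w + f g)              ≡⟨ cong Ψ (lin 3 (λ a b c → [] ⊢ a :+ b :+ c :≡ a :+ (c :+ b)) refl a₀ (suc w) (f g)) ⟩
      Ψ (a₀ + (f g + suc w))            ∎
      where
      open ≤-Reasoning
      a₀ = f h + z

  superadditive-suc : Superadditive (suc κ) r
  superadditive-suc a b with ≤-total a b
  ... | inj₁ a≤b = subst₂ _≤_ (+-comm (Ψ b) (Ψ a)) (cong Ψ (+-comm b a)) (superadd-ordered a b (<-wellFounded a) a≤b)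
  ... | inj₂ b≤a = superadd-ordered b a (<-wellFounded b) b≤a

  -- Pieces of `v` move over to `u`, as for superadditivity, while `u` stays within `f β`. When the
  -- next piece would pass `f β`, the block of `u` is the last one, `β = suc h`, and the window
  -- property one level lower settles that block.
  windowed-ordered : ∀ β v u {w} → Acc _<_ v → v ≤ u → u ≤ f β → u + v ≡ f β + w →
    Ψ u + Ψ v ≤ Ψ (f β) + Ψ w
  windowed-ordered β v u {w₀} ac v≤u u≤N eq with m≤n⇒m<n∨m≡n u≤N
  ... | inj₂ refl = ≤-reflexive (cong (λ x → Ψ (f β) + Ψ x) (+-cancelˡ-≡ (f β) v w₀ eq))
  windowed-ordered β zero u {w₀} ac v≤u u≤N eq | inj₁ u<N =
    ⊥-elim (<⇒≱ u<N (lin 3 (λ u N w → u :+ con 0 :≡ N :+ w ∷ [] ⊢ N :≤ u) refl u (f β) w₀ eq))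
  windowed-ordered β (suc v) u {w₀} (acc rec) v≤u u≤N eq | inj₁ u<N =
    go (locate₊ {suc κ} feas v) (locate {suc κ} feas u) rec v≤u u<N eq
    where
    go : ∀ {v u} → Located₊ (suc κ) r v → Located (suc κ) r u → (∀ {y} → y < v → Acc _<_ y) →
         v ≤ u → u < f β → u + v ≡ f β + w₀ → Ψ u + Ψ v ≤ Ψ (f β) + Ψ w₀
    go (located₊ g w w≤) (located h z z<) rec v≤u u<N eq with f h + z + suc w ≤? f β
    ... | yes p = begin
      Ψ u₀ + Ψ (f g + suc w)            ≡⟨ cong (Ψ u₀ +_) (ψ-block κ r g w≤) ⟩
      Ψ u₀ + (f′ g + Ψ′ (suc w))        ≡⟨ lin 3 (λ a b c → [] ⊢ a :+ (b :+ c) :≡ a :+ c :+ b) refl (Ψ u₀) (f′ g) (Ψ′ (suc w)) ⟩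
      Ψ u₀ + Ψ′ (suc w) + f′ g          ≤⟨ +-monoˡ-≤ (f′ g) (ψ-append h (<⇒≤ z<) (≤-trans w≤ (block-mono (suc κ) r (smaller-block {g} {h} v≤u z<)))) ⟩
      Ψ (u₀ + suc w) + f′ g             ≡⟨ cong (Ψ (u₀ + suc w) +_) (sym (ψ-boundary (suc κ) r g)) ⟩
      Ψ (u₀ + suc w) + Ψ (f g)          ≤⟨ windowed-ordered β (f g) (u₀ + suc w) (rec (m<m+n (f g) (s≤s z≤n)))
                                            (≤-trans (≤-trans (m≤m+n (f g) _) v≤u) (m≤m+n u₀ _)) p
                                            (trans (lin 3 (λ a b c → [] ⊢ a :+ b :+ c :≡ a :+ (c :+ b)) refl u₀ (suc w) (f g)) eq) ⟩
      Ψ (f β) + Ψ w₀                   ∎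
      where
      open ≤-Reasoning
      u₀ = f h + z
    ... | no ¬p = begin
      Ψ u₀ + Ψ (f g + suc w)                        ≡⟨ cong₂ _+_ (ψ-block κ r h (<⇒≤ z<)) (ψ-block κ r g w≤) ⟩
      f′ h + Ψ′ z + (f′ g + Ψ′ (suc w))            ≡⟨ lin 4 (λ a b c d → [] ⊢ a :+ b :+ (c :+ d) :≡ a :+ c :+ (b :+ d)) refl (f′ h) (Ψ′ z) (f′ g) (Ψ′ (suc w)) ⟩
      f′ h + f′ g + (Ψ′ z + Ψ′ (suc w))            ≤⟨ +-monoʳ-≤ (f′ h + f′ g) (windowed (others r h) (<⇒≤ z<) w≤h (sym zw)) ⟩
      f′ h + f′ g + (Ψ′ (blk h) + Ψ′ w₂)           ≡⟨ lin 4 (λ a b c d → [] ⊢ a :+ b :+ (c :+ d) :≡ a :+ c :+ (b :+ d)) refl (f′ h) (f′ g) (Ψ′ (blk h)) (Ψ′ w₂) ⟩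
      f′ h + Ψ′ (blk h) + (f′ g + Ψ′ w₂)           ≡⟨ cong₂ _+_ (sym (ψ-block κ r h ≤-refl)) (sym (ψ-block κ r g w₂≤)) ⟩
      Ψ (f (suc h)) + Ψ (f g + w₂)                 ≡⟨ cong₂ (λ x y → Ψ (f x) + Ψ y) (sym β≡) (sym w₀≡) ⟩
      Ψ (f β) + Ψ w₀                               ∎
      where
      open ≤-Reasoning
      u₀ = f h + z
      w≤h : suc w ≤ blk h
      w≤h = ≤-trans w≤ (block-mono (suc κ) r (smaller-block {g} {h} v≤u z<))
      h<β : h < β
      h<β = τ-cancel-< (2 + κ) r (≤-<-trans (m≤m+n (f h) z) u<N)
      β≤ : β ≤ suc h
      β≤ = ≤-pred (τ-cancel-< (2 + κ) r (<-≤-trans (≰⇒> ¬p)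
        (lin 5 (λ H z w B B₊ → z :≤ B ∷ w :≤ B ∷ B :≤ B₊ ∷ [] ⊢ H :+ z :+ w :≤ H :+ B :+ B₊) refl
          (f h) z (suc w) (blk h) (blk (suc h)) (<⇒≤ z<) w≤h (block-mono (suc κ) r (n≤1+n h)))))
      β≡ : β ≡ suc h
      β≡ = ≤-antisym β≤ h<β
      blk≤ : blk h ≤ z + suc w
      blk≤ = +-cancelˡ-≤ (f h) _ _ (≤-trans (≤-reflexive (cong f (sym β≡)))
        (≤-trans (<⇒≤ (≰⇒> ¬p)) (≤-reflexive (+-assoc (f h) z (suc w)))))
      w₂ = z + suc w ∸ blk h
      zw : blk h + w₂ ≡ z + suc w
      zw = m+[n∸m]≡n blk≤
      w₂≤ : w₂ ≤ blk g
      w₂≤ = ≤-trans (lin 4 (λ z w x B → z :≤ B ∷ B :+ x :≡ z :+ w ∷ [] ⊢ x :≤ w) refl z (suc w) w₂ (blk h) (<⇒≤ z<) zw) w≤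
      w₀≡ : w₀ ≡ f g + w₂
      w₀≡ = lin 8 (λ N w₀ H z G w B w₂ → H :+ z :+ (G :+ w) :≡ N :+ w₀ ∷ N :≡ H :+ B ∷ B :+ w₂ :≡ z :+ w ∷ [] ⊢ w₀ :≡ G :+ w₂)
        refl (f β) w₀ (f h) z (f g) (suc w) (blk h) w₂ eq (cong f β≡) zw

  windowed-suc : Windowed (suc κ) r
  windowed-suc β {u} {v} {w} u≤ v≤ eq with ≤-total u v
  ... | inj₁ u≤v = subst (_≤ Ψ (f β) + Ψ w) (+-comm (Ψ v) (Ψ u))
    (windowed-ordered β u v (<-wellFounded u) u≤v v≤ (trans (+-comm v u) eq))
  ... | inj₂ v≤u = windowed-ordered β v u (<-wellFounded v) v≤u u≤ eq

-- Convexity, because a later vertex has at least as many earlier neighbours. It is the base case of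
-- both properties.
τ2-convex : ∀ r {a b} d → a ≤ b → τ 2 (a + d) r + τ 2 b r ≤ τ 2 (b + d) r + τ 2 a r
τ2-convex r {a} {b} zero a≤b = ≤-reflexive (trans (cong₂ (λ x y → τ 2 x r + τ 2 y r) (+-identityʳ a) (sym (+-identityʳ b)))
  (+-comm (τ 2 a r) _))
τ2-convex r {a} {b} (suc d) a≤b = subst₂ (λ x y → τ 2 x r + τ 2 b r ≤ τ 2 y r + τ 2 a r) (sym (+-suc a d)) (sym (+-suc b d))
  (lin 6 (λ A B A₀ B₀ i j → A :+ B₀ :≤ B :+ A₀ ∷ i :≤ j ∷ [] ⊢ A :+ i :+ B₀ :≤ B :+ j :+ A₀) refl
    (τ 2 (a + d) r) (τ 2 (b + d) r) (τ 2 a r) (τ 2 b r) (block 1 r (a + d)) (block 1 r (b + d))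
    (τ2-convex r d a≤b) (block-mono 1 r (+-monoˡ-≤ d a≤b)))

superadditive : ∀ κ {r} → Feasible (suc κ) r → Superadditive κ r
windowed : ∀ κ {r} → Feasible (suc κ) r → Windowed κ r

superadditive zero {r} f a b = subst₂ _≤_ (+-comm (τ 2 b r) (τ 2 a r)) (+-identityʳ _) (τ2-convex r {0} {a} b z≤n)
superadditive (suc κ) {r} f = Step.superadditive-suc κ r f (superadditive κ (feasible-pred f)) (windowed κ (feasible-pred f))

windowed zero {r} f β {u} {v} {w} u≤ v≤ eq = subst₂ _≤_
  (trans (cong (_+ τ 2 u r) (cong (λ x → τ 2 x r) v≡)) (+-comm (τ 2 v r) (τ 2 u r)))
  (cong (λ x → τ 2 x r + τ 2 w r) (m+[n∸m]≡n u≤))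
  (τ2-convex r d w≤u)
  where
  N = τ 1 β r
  d = N ∸ u
  ud : u + d ≡ N
  ud = m+[n∸m]≡n u≤
  v≡ : w + d ≡ v
  v≡ = lin 5 (λ u v w d N → u :+ d :≡ N ∷ u :+ v :≡ N :+ w ∷ [] ⊢ w :+ d :≡ v) refl u v w d N ud eq
  w≤u : w ≤ u
  w≤u = lin 4 (λ u v w N → u :+ v :≡ N :+ w ∷ v :≤ N ∷ [] ⊢ w :≤ u) refl u v w N eq v≤
windowed (suc κ) {r} f = Step.windowed-suc κ r f (superadditive κ (feasible-pred f)) (windowed κ (feasible-pred f))

ψ-append : ∀ κ {r} → Feasible (2 + κ) r → ∀ b {z x} → z ≤ block (suc κ) r b → x ≤ block (suc κ) r b →
  ψ (suc κ) r (τ (2 + κ) b r + z) + ψ κ (pred r) x ≤ ψ (suc κ) r (τ (2 + κ) b r + z + x)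
ψ-append κ {r} f = Step.ψ-append κ r f (superadditive κ (feasible-pred f)) (windowed κ (feasible-pred f))

-- Uncoloured sets

-- y sets of size k + 1 can be supported by x sets of size k; a single empty set
-- supports any number of vertices.
Supports : ℕ → ℕ → ℕ → ℕ → Set
Supports zero    r x y = x ≡ 0 → y ≡ 0
Supports (suc κ) r x y = y ≤ ψ κ r x

-- What exceeds the sets on the first `h` vertices has `h` as its largest vertex and is therefore
-- bounded one level lower, in the link of `h`.
supports-link : ∀ κ r h {a y} → a ≤ block κ r h → y ≤ ψ κ r (τ (suc κ) h r + a) →
  Supports κ (pred r) a (y ∸ τ (2 + κ) h r)
supports-link zero    r h {y = y} a≤ y≤ refl = m≤n⇒m∸n≡0 (≤-trans y≤ (≤-reflexive
  (trans (cong (ψ 0 r) (+-identityʳ (τ 1 h r))) (ψ-boundary 0 r h))))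
supports-link (suc κ) r h a≤ y≤ = ≤-trans (∸-monoˡ-≤ (τ (3 + κ) h r) (≤-trans y≤ (≤-reflexive (ψ-block κ r h a≤))))
  (≤-reflexive (m+n∸m≡n (τ (3 + κ) h r) _))

-- The numerical step of the Kruskal-Katona theorem for a new vertex; `y ≤ X` because the sets in
-- its link that it extends are old ones. If `x` fits into the current block, it is appended.
-- Otherwise a whole block is completed, and the rest is the same problem one level lower with `z`
-- in place of `X`.
cone : ∀ κ {X x y} → y ≤ X → Supports κ 0 x y → ψ κ 0 X + y ≤ ψ κ 0 (X + x)
cone zero {X} {zero} {y} y≤X s = ≤-reflexive
  (trans (cong₂ _+_ (cong (ψ 0 0) (sym (+-identityʳ X))) (s refl)) (+-identityʳ _))
cone zero {X} {suc x} {y} y≤X s = ≤-trans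
  (+-monoʳ-≤ (τ 2 X 0) (≤-trans y≤X (≤-reflexive (sym (τ-1 X 0)))))
  (ψ-mono 0 {0} {suc X} {X + suc x} (inj₁ refl) (≤-trans (s≤s (m≤m+n X x)) (≤-reflexive (sym (+-suc X x)))))
cone (suc κ) {X} {x} {y} y≤X y≤ψ = go (locate {suc κ} {0} (inj₁ refl) X) y≤X
  where
  f = λ n → τ (2 + κ) n 0
  blk = λ n → τ (suc κ) n 0
  go : ∀ {X} → Located (suc κ) 0 X → y ≤ X → ψ (suc κ) 0 X + y ≤ ψ (suc κ) 0 (X + x)
  go (located h z z<) y≤X = split (≤-total x (blk (suc h)))
    where
    open ≤-Reasoning
    X₀ = f h + z
    bounded : ∀ x → x ≤ blk (suc h) → y ≤ ψ κ 0 x → ψ (suc κ) 0 X₀ + y ≤ ψ (suc κ) 0 (X₀ + x)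
    bounded x x≤ y≤ψ with ≤-total x (blk h)
    ... | inj₁ x≤blk = ≤-trans (+-monoʳ-≤ _ y≤ψ) (ψ-append κ {0} (inj₁ refl) h (<⇒≤ z<) x≤blk)
    ... | inj₂ blk≤x = begin
      ψ (suc κ) 0 X₀ + y                                 ≡⟨ cong (_+ y) (ψ-block κ 0 h (<⇒≤ z<)) ⟩
      τ (3 + κ) h 0 + ψ κ 0 z + y                        ≤⟨ lin 5 (λ t p y w F → y :≤ F :+ w ∷ [] ⊢ t :+ p :+ y :≤ t :+ F :+ (p :+ w)) refl
                                                              (τ (3 + κ) h 0) (ψ κ 0 z) y w (f h) (m≤n+m∸n y (f h)) ⟩
      τ (3 + κ) (suc h) 0 + (ψ κ 0 z + w)                ≤⟨ +-monoʳ-≤ (τ (3 + κ) (suc h) 0) (cone κ w≤z (supports-link κ 0 h α≤ (subst (λ t → y ≤ ψ κ 0 t) (sym xα) y≤ψ))) ⟩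
      τ (3 + κ) (suc h) 0 + ψ κ 0 (z + α)                ≡⟨ sym (ψ-block κ 0 (suc h) zα≤) ⟩
      ψ (suc κ) 0 (f (suc h) + (z + α))                  ≡⟨ cong (ψ (suc κ) 0) (lin 5 (λ F B z α x → B :+ α :≡ x ∷ [] ⊢ F :+ B :+ (z :+ α) :≡ F :+ z :+ x) refl (f h) (blk h) z α x xα) ⟩
      ψ (suc κ) 0 (X₀ + x)                               ∎
      where
      α = x ∸ blk h
      w = y ∸ f h
      xα : blk h + α ≡ x
      xα = m+[n∸m]≡n blk≤x
      α≤ : α ≤ τ κ h 0
      α≤ = lin 4 (λ B α x t → B :+ α :≡ x ∷ x :≤ B :+ t ∷ [] ⊢ α :≤ t) refl (blk h) α x (τ κ h 0) xα x≤
      w≤z : w ≤ z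
      w≤z = ≤-trans (∸-monoˡ-≤ (f h) y≤X) (≤-reflexive (m+n∸m≡n (f h) z))
      zα≤ : z + α ≤ blk (suc h)
      zα≤ = +-mono-≤ (<⇒≤ z<) α≤
    split : x ≤ blk (suc h) ⊎ blk (suc h) ≤ x → ψ (suc κ) 0 X₀ + y ≤ ψ (suc κ) 0 (X₀ + x)
    split (inj₁ x≤) = bounded x x≤ y≤ψ
    -- Here `y ≤ X` alone makes `blk (suc h)` sets enough to support `y`, so the excess of `x` is
    -- given up by monotonicity.
    split (inj₂ ≤x) = ≤-trans
      (bounded (blk (suc h)) ≤-refl (≤-trans y≤X (≤-trans (+-monoʳ-≤ (f h) (<⇒≤ z<)) (≤-reflexive (sym (ψ-boundary κ 0 (suc h)))))))
      (ψ-mono (suc κ) {0} (inj₁ refl) (+-monoʳ-≤ X₀ ≤x))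

τ-link-≤ : ∀ k n r → τ k (others r n) (pred r) ≤ τ k n r
τ-link-≤ zero    n r = ≤-refl
τ-link-≤ (suc k) n zero = ≤-refl
τ-link-≤ (suc k) n (suc R) with divide R n
... | divided q s s≤R = ≤-trans (≤-reflexive (cong (λ t → τ (suc k) t R) (others-rem R q s≤R)))
  (≤-trans (m≤m+n _ (q * τ k (s + q * R) R)) (≤-reflexive (sym (τ-class k R q s≤R))))

-- The coloured segment is built up vertex by vertex. Each link obeys the uncoloured bound by
-- induction, and its sets inject into the sets already present, so `cone` applies.
ψ-uncolour : ∀ κ {r} → Feasible (suc κ) r → ∀ m → ψ κ r m ≤ ψ κ 0 m
ψ-uncolour zero {r} f zero    = ≤-refl
ψ-uncolour zero {r} f (suc m) = +-mono-≤ (ψ-uncolour zero f m) (subst₂ _≤_ (sym (τ-1 (others r m) (pred r))) (sym (τ-1 m 0)) (others-≤ r m))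
ψ-uncolour (suc κ) {r} f m = go (locate {suc κ} f m)
  where
  open ≤-Reasoning
  τ-≤ψ : ∀ h → τ (3 + κ) h r ≤ ψ (suc κ) 0 (τ (2 + κ) h r)
  τ-≤ψ zero    = z≤n
  τ-≤ψ (suc h) = ≤-trans (+-monoˡ-≤ _ (τ-≤ψ h)) (cone (suc κ) (τ-link-≤ (2 + κ) h r)
    (≤-trans (≤-reflexive (sym (ψ-boundary κ (pred r) (others r h)))) (ψ-uncolour κ (feasible-pred f) _)))
  go : ∀ {m} → Located (suc κ) r m → ψ (suc κ) r m ≤ ψ (suc κ) 0 m
  go (located h z z<) = begin
    ψ (suc κ) r (τ (2 + κ) h r + z)                    ≡⟨ ψ-block κ r h (<⇒≤ z<) ⟩
    τ (3 + κ) h r + ψ κ (pred r) z                     ≤⟨ +-monoˡ-≤ _ (τ-≤ψ h) ⟩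
    ψ (suc κ) 0 (τ (2 + κ) h r) + ψ κ (pred r) z       ≤⟨ cone (suc κ)
        (≤-trans (ψ-mono κ (feasible-pred f) (<⇒≤ z<)) (≤-trans (≤-reflexive (ψ-boundary κ (pred r) (others r h))) (τ-link-≤ (2 + κ) h r)))
        (ψ-uncolour κ (feasible-pred f) z) ⟩
    ψ (suc κ) 0 (τ (2 + κ) h r + z)                    ∎

τ-clique : ∀ k {n r} → n ≤ r → τ k n r ≡ τ k n 0
τ-clique zero    _ = refl
τ-clique (suc k) {zero}  _ = refl
τ-clique (suc k) {suc n} {suc R} n<r@(s≤s n≤R) = cong₂ _+_ (τ-clique (suc k) (<⇒≤ n<r))
  (trans (cong (λ t → τ k t R) (others-small (suc R) n<r)) (τ-clique k n≤R))

-- The first `n ≤ r` vertices have distinct colours, so on them the colouring forbids nothing.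
ψ-clique : ∀ κ {n r m} → n ≤ r → m ≤ τ (suc κ) n r → ψ κ r m ≡ ψ κ 0 m
ψ-clique zero {n} {r} n≤r m≤ = τ-clique 2 (≤-trans m≤ (≤-trans (≤-reflexive (τ-1 n r)) n≤r))
ψ-clique (suc κ) {n} {r} {zero} n≤r m≤ = trans (ψ-zero (suc κ) r) (sym (ψ-zero (suc κ) 0))
ψ-clique (suc κ) {n} {zero} {suc m} n≤r m≤ = refl
ψ-clique (suc κ) {n} {suc R} {suc m} n≤r m≤ = go (locate₊ {suc κ} feas m) m≤
  where
  open ≡-Reasoning
  r = suc R
  feas : Feasible (2 + κ) (suc R)
  feas with n <? 2 + κ
  ... | yes n< = ⊥-elim (<⇒≱ (s≤s z≤n) (≤-trans m≤ (≤-reflexive (τ-low (suc R) n<))))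
  ... | no ¬n< = inj₂ (≤-trans (≮⇒≥ ¬n<) n≤r)
  go : ∀ {m} → Located₊ (suc κ) (suc R) m → m ≤ τ (2 + κ) n (suc R) → ψ (suc κ) (suc R) m ≡ ψ (suc κ) 0 m
  go (located₊ b z z≤) m≤ = begin
    ψ (suc κ) r (τ (2 + κ) b r + suc z)     ≡⟨ ψ-block κ r b z≤ ⟩
    τ (3 + κ) b r + ψ κ R (suc z)           ≡⟨ cong₂ _+_ (τ-clique (3 + κ) (<⇒≤ b<r)) (ψ-clique κ b≤R z≤′) ⟩
    τ (3 + κ) b 0 + ψ κ 0 (suc z)           ≡⟨ sym (ψ-block κ 0 b (≤-trans z≤′ (≤-reflexive (τ-clique (suc κ) b≤R)))) ⟩
    ψ (suc κ) 0 (τ (2 + κ) b 0 + suc z)     ≡⟨ cong (λ t → ψ (suc κ) 0 (t + suc z)) (sym (τ-clique (2 + κ) (<⇒≤ b<r))) ⟩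
    ψ (suc κ) 0 (τ (2 + κ) b r + suc z)     ∎
    where
    b<r : b < r
    b<r = <-≤-trans (τ-cancel-< (2 + κ) r (<-≤-trans (m<m+n _ (s≤s z≤n)) m≤)) n≤r
    b≤R : b ≤ R
    b≤R = ≤-pred b<r
    z≤′ : suc z ≤ τ (suc κ) b R
    z≤′ = ≤-trans z≤ (≤-reflexive (cong (λ t → τ (suc κ) t R) (others-small (suc R) b<r)))

-- Splitting segments by the vertex of colour 0

ifz : ℕ → ℕ → ℕ → ℕ
ifz zero    x y = x
ifz (suc _) x y = y

ifz-same : ∀ n {x} → ifz n x x ≡ x
ifz-same zero    = refl
ifz-same (suc n) = refl

ifz-mono : ∀ n {x x′ y y′} → x ≤ x′ → y ≤ y′ → ifz n x y ≤ ifz n x′ y′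
ifz-mono zero    p q = p
ifz-mono (suc n) p q = q

-- `x` times the Iverson bracket of `l < u`, coded by truncated subtraction; `exactly` is its
-- analogue for `l = u`.
before : ℕ → ℕ → ℕ → ℕ
before l u x = ifz (suc l ∸ u) x 0

exactly : ℕ → ℕ → ℕ → ℕ
exactly l u x = ifz ∣ l - u ∣ x 0

before-< : ∀ {l u} x → l < u → before l u x ≡ x
before-< {l} {u} x l<u = cong (λ n → ifz n x 0) (m≤n⇒m∸n≡0 l<u)

before-≥ : ∀ {l u} x → u ≤ l → before l u x ≡ 0
before-≥ {l} {u} x u≤l = cong (λ n → ifz n x 0) (+-∸-assoc 1 u≤l)

exactly-≡ : ∀ l x → exactly l l x ≡ x
exactly-≡ l x = cong (λ n → ifz n x 0) (∣n-n∣≡0 l)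

exactly-≢ : ∀ {l u} x → l ≢ u → exactly l u x ≡ 0
exactly-≢ {l} {u} x l≢u with ∣ l - u ∣ in eq
... | zero  = ⊥-elim (l≢u (∣m-n∣≡0⇒m≡n eq))
... | suc _ = refl

before-suc : ∀ l u x → before l u x + exactly l u x ≡ before l (suc u) x
before-suc l u x with <-cmp l u
... | tri< l<u l≢u _ = trans (cong₂ _+_ (before-< x l<u) (exactly-≢ x l≢u))
                         (trans (+-identityʳ x) (sym (before-< x (m<n⇒m<1+n l<u))))
... | tri≈ _ refl _ = trans (cong₂ _+_ (before-≥ x (≤-refl {l})) (exactly-≡ l x)) (sym (before-< x (n<1+n l)))
... | tri> _ l≢u u<l = trans (cong₂ _+_ (before-≥ x (<⇒≤ u<l)) (exactly-≢ x l≢u)) (sym (before-≥ x u<l))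

before-+ : ∀ l u x y → before l u x + before l u y ≡ before l u (x + y)
before-+ l u x y with suc l ∸ u
... | zero  = refl
... | suc _ = refl

sumTo-cong : ∀ n {f g : ℕ → ℕ} → (∀ i → f i ≡ g i) → sumTo n f ≡ sumTo n g
sumTo-cong zero    e = refl
sumTo-cong (suc n) e = cong₂ _+_ (sumTo-cong n e) (e n)

sumTo-+ : ∀ n (f g : ℕ → ℕ) → sumTo n (λ i → f i + g i) ≡ sumTo n f + sumTo n g
sumTo-+ zero    f g = refl
sumTo-+ (suc n) f g = trans (cong (_+ (f n + g n)) (sumTo-+ n f g)) (+-interchange (sumTo n f) (sumTo n g) (f n) (g n))

sumTo-zero : ∀ n → sumTo n (λ _ → 0) ≡ 0
sumTo-zero zero    = refl
sumTo-zero (suc n) = trans (+-identityʳ _) (sumTo-zero n)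

sumTo-before-≥ : ∀ n u x → n ≤ u → sumTo n (λ l → before l u x) ≡ n * x
sumTo-before-≥ zero    u x _ = refl
sumTo-before-≥ (suc n) u x n<u = trans (cong₂ _+_ (sumTo-before-≥ n u x (<⇒≤ n<u)) (before-< x n<u)) (+-comm (n * x) x)

sumTo-before : ∀ n u x → u ≤ n → sumTo n (λ l → before l u x) ≡ u * x
sumTo-before n u x u≤n with m≤n⇒m<n∨m≡n u≤n
... | inj₂ refl = sumTo-before-≥ n n x ≤-refl
sumTo-before (suc n) u x u≤n | inj₁ (s≤s u≤n′) =
  trans (cong₂ _+_ (sumTo-before n u x u≤n′) (before-≥ x u≤n′)) (+-identityʳ _)

sumTo-exactly : ∀ n u x → u < n → sumTo n (λ l → exactly l u x) ≡ x
sumTo-exactly n u x u<n = +-cancelˡ-≡ (u * x) _ _ (begin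
  u * x + sumTo n (λ l → exactly l u x)
    ≡⟨ cong (_+ sumTo n (λ l → exactly l u x)) (sym (sumTo-before n u x (<⇒≤ u<n))) ⟩
  sumTo n (λ l → before l u x) + sumTo n (λ l → exactly l u x)
    ≡⟨ sym (sumTo-+ n _ _) ⟩
  sumTo n (λ l → before l u x + exactly l u x)
    ≡⟨ sumTo-cong n (λ l → before-suc l u x) ⟩
  sumTo n (λ l → before l (suc u) x)
    ≡⟨ sumTo-before n (suc u) x u<n ⟩
  x + u * x
    ≡⟨ +-comm x (u * x) ⟩
  u * x + x ∎)
  where open ≡-Reasoning

rem : ℕ → ℕ → ℕ
rem zero    n = 0
rem (suc R) n = n % suc R

rem-rem : ∀ R q {s} → s ≤ R → rem (suc R) (s + q * suc R) ≡ s
rem-rem R q {s} s≤R = trans ([m+kn]%n≡m%n s q (suc R)) (m<n⇒m%n≡m (s≤s s≤R))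

-- Of the vertices 0, …, n - 1 coloured mod r, up r n have colour 0 and
-- away r n have another colour.
up away : ℕ → ℕ → ℕ
up r zero    = 0
up r (suc n) = suc (fdiv n r)
away r zero    = 0
away r (suc n) = others r n

up-first : ∀ R q → up (suc R) (q * suc R) ≡ q
up-first R zero    = refl
up-first R (suc q) = cong suc (fdiv-rem R q ≤-refl)

away-first : ∀ R q → away (suc R) (q * suc R) ≡ q * R
away-first R zero    = refl
away-first R (suc q) = others-rem R q ≤-refl

-- Splitting the first X properly coloured j-sets by their vertex of colour 0:
-- star j r X of them have none and slice j r X l have the l-th one.
star : ℕ → ℕ → ℕ → ℕ
star zero    r X = X
star (suc j) zero    X = 0
star (suc j) (suc R) X = τ (suc j) (away (suc R) b) R + ifz (rem (suc R) b) 0 (star j R (X ∸ τ (suc j) b (suc R)))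
  where b = leading j (suc R) X

slice : ℕ → ℕ → ℕ → ℕ → ℕ
slice zero    r X l = 0
slice (suc j) zero    X l = 0
slice (suc j) (suc R) X l = before l (up (suc R) b) (τ j (away (suc R) b) R)
  -- If `b` has colour 0, it is number `up (suc R) b` of that colour and lies in all remaining sets.
  -- Otherwise these are split in the link of `b`, where colour 0 is still the first colour.
  + ifz (rem (suc R) b) (exactly l (up (suc R) b) (X ∸ τ (suc j) b (suc R))) (slice j R (X ∸ τ (suc j) b (suc R)) l)
  where b = leading j (suc R) X

-- `star` and `slice` as functions of a block and a position in it, the form to which `glue`
-- applies.
starAt : ℕ → ℕ → ℕ → ℕ → ℕ
starAt j r b z = τ (suc j) (away r b) (pred r) + ifz (rem r b) 0 (star j (pred r) z)

sliceAt : ℕ → ℕ → ℕ → ℕ → ℕ → ℕ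
sliceAt j r l b z = before l (up r b) (τ j (away r b) (pred r))
  + ifz (rem r b) (exactly l (up r b) z) (slice j (pred r) z l)

starAt-first : ∀ j R q z → starAt j (suc R) (q * suc R) z ≡ τ (suc j) (q * R) R
starAt-first j R q z = trans (cong₂ _+_ (cong (λ n → τ (suc j) n R) (away-first R q))
  (cong (λ s → ifz s 0 (star j R z)) (rem-rem R q z≤n))) (+-identityʳ _)

starAt-later : ∀ j R q {s} z → s < R →
  starAt j (suc R) (suc s + q * suc R) z ≡ τ (suc j) (s + q * R) R + star j R z
starAt-later j R q {s} z s<R = cong₂ _+_ (cong (λ n → τ (suc j) n R) (others-rem R q (<⇒≤ s<R)))
  (cong (λ s → ifz s 0 (star j R z)) (rem-rem R q s<R))

sliceAt-first : ∀ j R l q z →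
  sliceAt j (suc R) l (q * suc R) z ≡ before l q (τ j (q * R) R) + exactly l q z
sliceAt-first j R l q z = cong₂ _+_
  (cong₂ (λ u n → before l u (τ j n R)) (up-first R q) (away-first R q))
  (trans (cong (λ s → ifz s (exactly l (up (suc R) (q * suc R)) z) (slice j R z l)) (rem-rem R q z≤n))
         (cong (λ u → exactly l u z) (up-first R q)))

sliceAt-later : ∀ j R l q {s} z → s < R →
  sliceAt j (suc R) l (suc s + q * suc R) z ≡ before l (suc q) (τ j (s + q * R) R) + slice j R z l
sliceAt-later j R l q {s} z s<R = cong₂ _+_
  (cong₂ (λ u n → before l (suc u) (τ j n R)) (fdiv-rem R q (<⇒≤ s<R)) (others-rem R q (<⇒≤ s<R)))
  (cong (λ s′ → ifz s′ (exactly l (up (suc R) (suc s + q * suc R)) z) (slice j R z l)) (rem-rem R q s<R))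

star-boundary : ∀ j R n → star j (suc R) (τ j n (suc R)) ≡ τ j (away (suc R) n) R
star-zero : ∀ j r → star j r 0 ≡ 0
slice-boundary : ∀ j R n l → slice (suc j) (suc R) (τ (suc j) n (suc R)) l ≡
  before l (up (suc R) n) (τ j (away (suc R) n) R)
slice-zero : ∀ j r l → slice j r 0 l ≡ 0

starAt-zero : ∀ j r b → starAt j r b 0 ≡ τ (suc j) (away r b) (pred r)
starAt-zero j r b = trans (cong (λ x → t + ifz (rem r b) 0 x) (star-zero j (pred r)))
  (trans (cong (t +_) (ifz-same (rem r b))) (+-identityʳ t))
  where t = τ (suc j) (away r b) (pred r)

sliceAt-zero : ∀ j r l b → sliceAt j r l b 0 ≡ before l (up r b) (τ j (away r b) (pred r))
sliceAt-zero j r l b = trans (cong₂ (λ x y → t + ifz (rem r b) x y) (ifz-same ∣ l - up r b ∣) (slice-zero j (pred r) l))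
  (trans (cong (t +_) (ifz-same (rem r b))) (+-identityʳ t))
  where t = before l (up r b) (τ j (away r b) (pred r))

star-glued : ∀ j R → Glued j (suc R) (starAt j (suc R))
star-glued j R b with divide R b
... | divided q zero _ = trans (starAt-first j R q _) (sym (trans (starAt-zero j (suc R) (suc (q * suc R)))
        (cong (λ n → τ (suc j) n R) (others-rem R q z≤n))))
star-glued j (suc R) b | divided q (suc s) s<R = begin
  starAt j (2 + R) (suc s + q * (2 + R)) (block j (2 + R) (suc s + q * (2 + R)))
    ≡⟨ starAt-later j (suc R) q _ s<R ⟩
  τ (suc j) n (suc R) + star j (suc R) (block j (2 + R) (suc s + q * (2 + R)))
    ≡⟨ cong (λ m → τ (suc j) n (suc R) + star j (suc R) (τ j m (suc R))) (others-rem (suc R) q s<R) ⟩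
  τ (suc j) n (suc R) + star j (suc R) (τ j (suc n) (suc R))
    ≡⟨ cong (τ (suc j) n (suc R) +_) (star-boundary j R (suc n)) ⟩
  τ (suc j) (suc n) (suc R)
    ≡⟨ cong (λ m → τ (suc j) m (suc R)) (sym (others-rem (suc R) q s<R)) ⟩
  τ (suc j) (others (2 + R) (suc s + q * (2 + R))) (suc R)
    ≡⟨ sym (starAt-zero j (2 + R) (suc (suc s + q * (2 + R)))) ⟩
  starAt j (2 + R) (suc (suc s + q * (2 + R))) 0 ∎
  where
  open ≡-Reasoning
  n = s + q * suc R

slice-glued : ∀ j R l → Glued j (suc R) (sliceAt j (suc R) l)
slice-glued j R l b with divide R b
... | divided q zero _ = begin
  sliceAt j (suc R) l (q * suc R) (block j (suc R) (q * suc R))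
    ≡⟨ sliceAt-first j R l q _ ⟩
  before l q (τ j (q * R) R) + exactly l q (block j (suc R) (q * suc R))
    ≡⟨ cong (λ n → before l q (τ j (q * R) R) + exactly l q (τ j n R)) (others-rem R q z≤n) ⟩
  before l q (τ j (q * R) R) + exactly l q (τ j (q * R) R)
    ≡⟨ before-suc l q _ ⟩
  before l (suc q) (τ j (q * R) R)
    ≡⟨ sym (cong₂ (λ u n → before l (suc u) (τ j n R)) (fdiv-rem R q z≤n) (others-rem R q z≤n)) ⟩
  before l (up (suc R) (suc (q * suc R))) (τ j (away (suc R) (suc (q * suc R))) R)
    ≡⟨ sym (sliceAt-zero j (suc R) l (suc (q * suc R))) ⟩
  sliceAt j (suc R) l (suc (q * suc R)) 0 ∎
  where open ≡-Reasoning
slice-glued j (suc R) l b | divided q (suc s) s<R@(s≤s s≤R) = begin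
  sliceAt j (2 + R) l b₀ (block j (2 + R) b₀)
    ≡⟨ sliceAt-later j (suc R) l q _ s<R ⟩
  before l (suc q) (τ j n (suc R)) + slice j (suc R) (block j (2 + R) b₀) l
    ≡⟨ cong (λ m → before l (suc q) (τ j n (suc R)) + slice j (suc R) (τ j m (suc R)) l) (others-rem (suc R) q s<R) ⟩
  before l (suc q) (τ j n (suc R)) + slice j (suc R) (τ j (suc n) (suc R)) l
    ≡⟨ join j ⟩
  before l (suc q) (τ j (suc n) (suc R))
    ≡⟨ sym (cong₂ (λ u m → before l (suc u) (τ j m (suc R))) (fdiv-rem (suc R) q s<R) (others-rem (suc R) q s<R)) ⟩
  before l (up (2 + R) (suc b₀)) (τ j (away (2 + R) (suc b₀)) (suc R))
    ≡⟨ sym (sliceAt-zero j (2 + R) l (suc b₀)) ⟩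
  sliceAt j (2 + R) l (suc b₀) 0 ∎
  where
  open ≡-Reasoning
  n = s + q * suc R
  b₀ = suc s + q * (2 + R)
  join : ∀ j → before l (suc q) (τ j n (suc R)) + slice j (suc R) (τ j (suc n) (suc R)) l
             ≡ before l (suc q) (τ j (suc n) (suc R))
  join zero    = +-identityʳ _
  join (suc j) = trans (cong (before l (suc q) (τ (suc j) n (suc R)) +_)
    (trans (slice-boundary j R (suc n) l)
           (cong (λ u → before l (suc u) (τ j (others (suc R) n) R)) (fdiv-rem R q s≤R))))
    (before-+ l (suc q) _ _)

star-block : ∀ j R b {z} → z ≤ block j (suc R) b →
  star (suc j) (suc R) (τ (suc j) b (suc R) + z) ≡ starAt j (suc R) b z
star-block j R b z≤ = glue j (suc R) {F = starAt j (suc R)} (star-glued j R) b z≤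

slice-block : ∀ j R l b {z} → z ≤ block j (suc R) b →
  slice (suc j) (suc R) (τ (suc j) b (suc R) + z) l ≡ sliceAt j (suc R) l b z
slice-block j R l b z≤ = glue j (suc R) {F = sliceAt j (suc R) l} (slice-glued j R l) b z≤

star-boundary zero    R n = refl
star-boundary (suc j) R n = trans (cong (star (suc j) (suc R)) (sym (+-identityʳ (τ (suc j) n (suc R)))))
  (trans (star-block j R n z≤n) (starAt-zero j (suc R) n))

slice-boundary j R n l = trans (cong (λ x → slice (suc j) (suc R) x l) (sym (+-identityʳ (τ (suc j) n (suc R)))))
  (trans (slice-block j R l n z≤n) (sliceAt-zero j (suc R) l n))

star-zero zero    r = refl
star-zero (suc j) zero    = refl
star-zero (suc j) (suc R) = star-boundary (suc j) R 0

slice-zero zero    r l = refl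
slice-zero (suc j) zero    l = refl
slice-zero (suc j) (suc R) l = trans (slice-boundary j R 0 l) (before-≥ {l} {0} (τ j 0 R) z≤n)

star-suc-≤ : ∀ j {R} → j ≤ R → ∀ X → star j R X ≤ star j R (suc X)
star-suc-≤ zero    _ X = n≤1+n X
star-suc-≤ (suc j) {suc R} j<R@(s≤s j≤R) X with locate {j} {suc R} (inj₂ j<R) X
... | located b z z< = subst₂ _≤_ (sym (star-block j R b (<⇒≤ z<)))
  (sym (trans (cong (star (suc j) (suc R)) (sym (+-suc (τ (suc j) b (suc R)) z))) (star-block j R b z<)))
  (+-monoʳ-≤ (τ (suc j) (away (suc R) b) R) (ifz-mono (rem (suc R) b) z≤n (star-suc-≤ j j≤R z)))

slice-suc-≤ : ∀ j {R} → j ≤ R → ∀ l X → slice j R X l ≤ slice j R (suc X) l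
slice-suc-≤ zero    _ l X = z≤n
slice-suc-≤ (suc j) {suc R} j<R@(s≤s j≤R) l X with locate {j} {suc R} (inj₂ j<R) X
... | located b z z< = subst₂ _≤_ (sym (slice-block j R l b (<⇒≤ z<)))
  (sym (trans (cong (λ x → slice (suc j) (suc R) x l) (sym (+-suc (τ (suc j) b (suc R)) z))) (slice-block j R l b z<)))
  (+-monoʳ-≤ (before l (up (suc R) b) (τ j (away (suc R) b) R))
    (ifz-mono (rem (suc R) b) (ifz-mono ∣ l - up (suc R) b ∣ (n≤1+n z) z≤n) (slice-suc-≤ j j≤R l z)))

star-mono : ∀ j {R X Y} → j ≤ R → X ≤ Y → star j R X ≤ star j R Y
star-mono j {R} j≤R = stepwise-mono (star j R) (star-suc-≤ j j≤R)

slice-mono : ∀ j {R X Y} → j ≤ R → ∀ l → X ≤ Y → slice j R X l ≤ slice j R Y l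
slice-mono j {R} j≤R l = stepwise-mono (λ X → slice j R X l) (slice-suc-≤ j j≤R l)

-- A properly coloured set has at most one vertex of colour 0, and on `N` vertices its number within
-- that colour is below `N`, so `n ≥ N` slices exhaust the rest.
split-sum : ∀ j {R N n X} → j ≤ R → N ≤ n → X ≤ τ j N R → star j R X + sumTo n (slice j R X) ≡ X
split-sum zero    {n = n} {X} _ _ _ = trans (cong (X +_) (sumTo-zero n)) (+-identityʳ X)
split-sum (suc j) {suc R} {N} {n} {X} j<R@(s≤s j≤R) N≤n X≤ = go X X≤
  where
  open ≡-Reasoning
  at-block : ∀ b {z} → z ≤ block j (suc R) b → b < n →
    starAt j (suc R) b z + sumTo n (λ l → sliceAt j (suc R) l b z) ≡ τ (suc j) b (suc R) + z
  at-block b {z} z≤ b<n with divide R b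
  ... | divided q zero _ = begin
    starAt j (suc R) (q * suc R) z + sumTo n (λ l → sliceAt j (suc R) l (q * suc R) z)
      ≡⟨ cong₂ _+_ (starAt-first j R q z) (sumTo-cong n (λ l → sliceAt-first j R l q z)) ⟩
    t₁ + sumTo n (λ l → before l q t₀ + exactly l q z)
      ≡⟨ cong (t₁ +_) (trans (sumTo-+ n _ _) (cong₂ _+_ (sumTo-before n q t₀ (<⇒≤ q<n)) (sumTo-exactly n q z q<n))) ⟩
    t₁ + (q * t₀ + z)
      ≡⟨ sym (+-assoc t₁ (q * t₀) z) ⟩
    t₁ + q * t₀ + z
      ≡⟨ cong (_+ z) (sym (τ-class j R q z≤n)) ⟩
    τ (suc j) (q * suc R) (suc R) + z ∎
    where
    t₀ = τ j (q * R) R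
    t₁ = τ (suc j) (q * R) R
    q<n : q < n
    q<n = ≤-<-trans (m≤m*n q (suc R)) b<n
  ... | divided q (suc s) s<R = begin
    starAt j (suc R) b₀ z + sumTo n (λ l → sliceAt j (suc R) l b₀ z)
      ≡⟨ cong₂ _+_ (starAt-later j R q z s<R) (sumTo-cong n (λ l → sliceAt-later j R l q z s<R)) ⟩
    t₁ + star j R z + sumTo n (λ l → before l (suc q) t₀ + slice j R z l)
      ≡⟨ cong (t₁ + star j R z +_) (trans (sumTo-+ n _ _) (cong (_+ sumTo n (slice j R z)) (sumTo-before n (suc q) t₀ q<n))) ⟩
    t₁ + star j R z + (suc q * t₀ + sumTo n (slice j R z))
      ≡⟨ +-interchange t₁ (star j R z) (suc q * t₀) _ ⟩
    t₁ + suc q * t₀ + (star j R z + sumTo n (slice j R z))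
      ≡⟨ cong₂ _+_ (sym (τ-class₊ j R q (<⇒≤ s<R))) (split-sum j j≤R (<⇒≤ (≤-<-trans (others-≤ (suc R) b₀) b<n)) z≤) ⟩
    τ (suc j) b₀ (suc R) + z ∎
    where
    b₀ = suc s + q * suc R
    t₀ = τ j (s + q * R) R
    t₁ = τ (suc j) (s + q * R) R
    q<n : q < n
    q<n = ≤-trans (s≤s (≤-trans (m≤m*n q (suc R)) (m≤n+m _ s))) (<⇒≤ b<n)
  go : ∀ X → X ≤ τ (suc j) N (suc R) → star (suc j) (suc R) X + sumTo n (slice (suc j) (suc R) X) ≡ X
  go zero _ = cong₂ _+_ (star-zero (suc j) (suc R)) (trans (sumTo-cong n (slice-zero (suc j) (suc R))) (sumTo-zero n))
  go (suc X) X≤ = go₊ (locate₊ {j} {suc R} (inj₂ j<R) X) X≤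
    where
    go₊ : ∀ {X} → Located₊ j (suc R) X → X ≤ τ (suc j) N (suc R) →
      star (suc j) (suc R) X + sumTo n (slice (suc j) (suc R) X) ≡ X
    go₊ (located₊ b z z≤) X≤ = trans
      (cong₂ _+_ (star-block j R b z≤) (sumTo-cong n (λ l → slice-block j R l b z≤)))
      (at-block b z≤ (<-≤-trans (τ-cancel-< (suc j) (suc R) (<-≤-trans (m<m+n _ (s≤s z≤n)) X≤)) N≤n))

-- Converse to `supports-link`. At `κ = 0` the hypothesis `Supports` says nothing when `a = 1`, and
-- the bound on `b` takes over.
supports-unlink : ∀ κ r h {a b} → a ≤ block κ r h → b ≤ block (suc κ) r h → Supports κ (pred r) a b →
  τ (2 + κ) h r + b ≤ ψ κ r (τ (suc κ) h r + a)
supports-unlink zero r h {zero} {b} _ _ s = ≤-reflexive (trans (cong (τ 2 h r +_) (s refl))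
  (trans (+-identityʳ _) (sym (trans (cong (ψ 0 r) (+-identityʳ (τ 1 h r))) (ψ-boundary 0 r h)))))
supports-unlink zero r h {suc zero} {b} _ b≤ s = ≤-trans (+-monoʳ-≤ (τ 2 h r) b≤)
  (≤-reflexive (sym (ψ-boundary 0 r (suc h))))
supports-unlink zero r h {suc (suc a)} (s≤s ()) _ _
supports-unlink (suc κ) r h {a} a≤ _ b≤ = ≤-trans (+-monoʳ-≤ (τ (3 + κ) h r) b≤) (≤-reflexive (sym (ψ-block κ r h a≤)))

-- Split by colour 0, a segment and the sets supported by it satisfy what `Claim` asks of a removed
-- class: the star is the rest and slice `l` the link of the `l`-th vertex of colour 0. For the last
-- field, a supported set without its vertex of colour 0 lies in the star.
record SplitsOver (κ R l X : ℕ) : Set where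
  constructor splitsOver
  field
    star-supports : star (2 + κ) (suc R) (ψ κ (suc R) X) ≤ ψ κ R (star (suc κ) (suc R) X)
    slice-supports : Supports κ R (slice (suc κ) (suc R) X l) (slice (2 + κ) (suc R) (ψ κ (suc R) X) l)
    slice-≤-star   : slice (2 + κ) (suc R) (ψ κ (suc R) X) l ≤ star (suc κ) (suc R) X

splits-over-block : ∀ κ R l b {z} → z ≤ block (suc κ) (suc R) b → ψ κ R z ≤ block (2 + κ) (suc R) b →
  starAt (2 + κ) (suc R) b (ψ κ R z) ≤ ψ (suc κ) R (starAt (suc κ) (suc R) b z) →
  sliceAt (2 + κ) (suc R) l b (ψ κ R z) ≤ ψ κ R (sliceAt (suc κ) (suc R) l b z) →
  sliceAt (2 + κ) (suc R) l b (ψ κ R z) ≤ starAt (suc κ) (suc R) b z →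
  SplitsOver (suc κ) R l (τ (2 + κ) b (suc R) + z)
splits-over-block κ R l b {z} z≤ z′≤ p₁ p₂ p₃ = splitsOver
  (subst₂ (λ x y → x ≤ ψ (suc κ) R y) (sym star₂) (sym (star-block (suc κ) R b z≤)) p₁)
  (subst₂ (λ x y → x ≤ ψ κ R y) (sym part₂) (sym (slice-block (suc κ) R l b z≤)) p₂)
  (subst₂ _≤_ (sym part₂) (sym (star-block (suc κ) R b z≤)) p₃)
  where
  star₂ = trans (cong (star (3 + κ) (suc R)) (ψ-block κ (suc R) b z≤)) (star-block (2 + κ) R b z′≤)
  part₂ = trans (cong (λ x → slice (3 + κ) (suc R) x l) (ψ-block κ (suc R) b z≤)) (slice-block (2 + κ) R l b z′≤)

-- If the vertex of the current block has colour 0, star and slices are full Turán counts except for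
-- one partial slice. Otherwise the induction hypothesis for its link is combined with the full
-- counts of the earlier vertices.
splits-over : ∀ κ R l X → 2 + κ ≤ suc R → SplitsOver κ R l X
splits-over zero R l X _ = subst (SplitsOver 0 R l) (τ-1 X (suc R)) (splitsOver
  (≤-trans (≤-reflexive (trans (cong (star 2 (suc R)) (ψ-boundary 0 (suc R) X)) (star-boundary 2 R X)))
           (≤-reflexive (sym (trans (cong (ψ 0 R) (star-boundary 1 R X)) (ψ-boundary 0 R (away (suc R) X))))))
  (λ none → trans p₂ (vanish (trans (sym (slice-boundary 0 R X l)) none)))
  (≤-trans (≤-reflexive p₂) (≤-trans (before-≤ (suc l ∸ up (suc R) X)) (≤-reflexive (sym (star-boundary 1 R X))))))
  where
  t = τ 1 (away (suc R) X) R
  p₂ : slice 2 (suc R) (ψ 0 (suc R) (τ 1 X (suc R))) l ≡ before l (up (suc R) X) t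
  p₂ = trans (cong (λ x → slice 2 (suc R) x l) (ψ-boundary 0 (suc R) X)) (slice-boundary 1 R X l)
  before-≤ : ∀ n → ifz n t 0 ≤ t
  before-≤ zero    = ≤-refl
  before-≤ (suc _) = z≤n
  vanish : before l (up (suc R) X) 1 ≡ 0 → before l (up (suc R) X) t ≡ 0
  vanish e with suc l ∸ up (suc R) X
  vanish () | zero
  vanish e  | suc _ = refl
splits-over (suc κ) R l X κ<R@(s≤s κ≤R) = go (locate {suc κ} {suc R} (inj₂ (≤-trans (n≤1+n _) κ<R)) X)
  where
  feasR : Feasible (suc κ) R
  feasR = inj₂ (≤-trans (n≤1+n _) κ≤R)
  at-block : ∀ b z → z ≤ block (suc κ) (suc R) b → ψ κ R z ≤ block (2 + κ) (suc R) b →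
    SplitsOver (suc κ) R l (τ (2 + κ) b (suc R) + z)
  at-block b z z≤ z′≤ with divide R b
  ... | divided q zero _ = splits-over-block κ R l (q * suc R) z≤ z′≤
    (≤-reflexive (trans (starAt-first (2 + κ) R q (ψ κ R z)) (trans (sym (ψ-boundary (suc κ) R (q * R)))
      (cong (ψ (suc κ) R) (sym (starAt-first (suc κ) R q z))))))
    (subst₂ (λ x y → x ≤ ψ κ R y) (sym (sliceAt-first (2 + κ) R l q (ψ κ R z))) (sym (sliceAt-first (suc κ) R l q z)) parts)
    (subst₂ _≤_ (sym (sliceAt-first (2 + κ) R l q (ψ κ R z))) (sym (starAt-first (suc κ) R q z)) under)
    where
    t₁ = τ (suc κ) (q * R) R
    t₂ = τ (2 + κ) (q * R) R
    z′ = ψ κ R z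
    z′≤t₂ : z′ ≤ t₂
    z′≤t₂ = ≤-trans z′≤ (≤-reflexive (cong (λ n → τ (2 + κ) n R) (others-rem R q z≤n)))
    parts : before l q t₂ + exactly l q z′ ≤ ψ κ R (before l q t₁ + exactly l q z)
    parts with <-cmp l q
    ... | tri< l<q l≢q _ rewrite before-< t₂ l<q | before-< t₁ l<q | exactly-≢ z′ l≢q | exactly-≢ z l≢q
          | +-identityʳ t₁ | +-identityʳ t₂ = ≤-reflexive (sym (ψ-boundary κ R (q * R)))
    ... | tri≈ _ refl _ rewrite before-≥ t₂ (≤-refl {l}) | before-≥ t₁ (≤-refl {l}) | exactly-≡ l z′ | exactly-≡ l z = ≤-refl
    ... | tri> _ l≢q q<l rewrite before-≥ t₂ (<⇒≤ q<l) | exactly-≢ z′ l≢q = z≤n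
    under : before l q t₂ + exactly l q z′ ≤ t₂
    under with <-cmp l q
    ... | tri< l<q l≢q _ rewrite before-< t₂ l<q | exactly-≢ z′ l≢q | +-identityʳ t₂ = ≤-refl
    ... | tri≈ _ refl _ rewrite before-≥ t₂ (≤-refl {l}) | exactly-≡ l z′ = z′≤t₂
    ... | tri> _ l≢q q<l rewrite before-≥ t₂ (<⇒≤ q<l) | exactly-≢ z′ l≢q = z≤n
  at-block b z z≤ z′≤ | divided q (suc s) s<R = later R s<R κ≤R z≤ z′≤
    where
    later : ∀ R → s < R → 2 + κ ≤ R → z ≤ block (suc κ) (suc R) (suc s + q * suc R) → 
      ψ κ R z ≤ block (2 + κ) (suc R) (suc s + q * suc R) →
      SplitsOver (suc κ) R l (τ (2 + κ) (suc s + q * suc R) (suc R) + z)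
    later (suc R) s<R@(s≤s s≤R) κ≤R z≤ z′≤ = splits-over-block κ (suc R) l (suc s + q * (2 + R)) z≤ z′≤
      (subst₂ (λ x y → x ≤ ψ (suc κ) (suc R) y) (sym (starAt-later (2 + κ) (suc R) q z′ s<R)) (sym (starAt-later (suc κ) (suc R) q z s<R))
        (≤-trans (+-monoʳ-≤ (τ (3 + κ) a (suc R)) star-supports) (≤-reflexive (sym (ψ-block κ (suc R) a star≤)))))
      (subst₂ (λ x y → x ≤ ψ κ (suc R) y) (sym (sliceAt-later (2 + κ) (suc R) l q z′ s<R)) (sym (sliceAt-later (suc κ) (suc R) l q z s<R)) parts)
      (subst₂ _≤_ (sym (sliceAt-later (2 + κ) (suc R) l q z′ s<R)) (sym (starAt-later (suc κ) (suc R) q z s<R)) under)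
      where
      open SplitsOver (splits-over κ R l z κ≤R)
      a = s + q * suc R
      z′ = ψ κ (suc R) z
      t₁ = τ (suc κ) a (suc R)
      t₂ = τ (2 + κ) a (suc R)
      z≤a : z ≤ τ (suc κ) (suc a) (suc R)
      z≤a = ≤-trans z≤ (≤-reflexive (cong (λ n → τ (suc κ) n (suc R)) (others-rem (suc R) q s<R)))
      z′≤a : z′ ≤ τ (2 + κ) (suc a) (suc R)
      z′≤a = ≤-trans z′≤ (≤-reflexive (cong (λ n → τ (2 + κ) n (suc R)) (others-rem (suc R) q s<R)))
      star≤ : star (suc κ) (suc R) z ≤ block (suc κ) (suc R) a
      star≤ = ≤-trans (star-mono (suc κ) (<⇒≤ κ≤R) z≤a) (≤-reflexive (star-boundary (suc κ) R (suc a)))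
      slice-bound : ∀ j {Y} → suc j ≤ suc R → Y ≤ τ (suc j) (suc a) (suc R) →
        slice (suc j) (suc R) Y l ≤ before l (suc q) (block j (suc R) a)
      slice-bound j j≤ Y≤ = ≤-trans (slice-mono (suc j) j≤ l Y≤) (≤-reflexive (trans (slice-boundary j R (suc a) l)
        (cong (λ u → before l (suc u) (block j (suc R) a)) (fdiv-rem R q s≤R))))
      parts : before l (suc q) t₂ + slice (2 + κ) (suc R) z′ l ≤ ψ κ (suc R) (before l (suc q) t₁ + slice (suc κ) (suc R) z l)
      parts with l <? suc q
      ... | yes l<q = subst₂ (λ x y → x + slice (2 + κ) (suc R) z′ l ≤ ψ κ (suc R) (y + slice (suc κ) (suc R) z l))
          (sym (before-< t₂ l<q)) (sym (before-< t₁ l<q))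
          (supports-unlink κ (suc R) a
            (≤-trans (slice-bound κ (<⇒≤ κ≤R) z≤a) (≤-reflexive (before-< _ l<q)))
            (≤-trans (slice-bound (suc κ) κ≤R z′≤a) (≤-reflexive (before-< _ l<q)))
            slice-supports)
      ... | no l≮q = ≤-trans (≤-reflexive (cong₂ _+_ (before-≥ t₂ (≮⇒≥ l≮q))
          (n≤0⇒n≡0 (≤-trans (slice-bound (suc κ) κ≤R z′≤a) (≤-reflexive (before-≥ _ (≮⇒≥ l≮q))))))) z≤n
      under : before l (suc q) t₂ + slice (2 + κ) (suc R) z′ l ≤ t₂ + star (suc κ) (suc R) z
      under with l <? suc q
      ... | yes l<q = +-mono-≤ (≤-reflexive (before-< t₂ l<q)) slice-≤-star
      ... | no l≮q = +-mono-≤ {before l (suc q) t₂} {t₂} (≤-trans (≤-reflexive (before-≥ t₂ (≮⇒≥ l≮q))) z≤n) slice-≤-star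
  go : ∀ {X} → Located (suc κ) (suc R) X → SplitsOver (suc κ) R l X
  go (located b z z<) = at-block b z (<⇒≤ z<)
    (≤-trans (ψ-mono κ feasR (<⇒≤ z<)) (≤-reflexive (ψ-boundary κ R (others (suc R) b))))

-- Removing a colour class

total : {A : Set} → (A → ℕ) → List A → ℕ
total f []      = 0
total f (a ∷ l) = f a + total f l

total-map : {A B : Set} (f : B → ℕ) (g : A → B) (l : List A) → total f (map g l) ≡ total (f ∘ g) l
total-map f g []      = refl
total-map f g (a ∷ l) = cong (f (g a) +_) (total-map f g l)

total-+ : {A : Set} (f g : A → ℕ) (l : List A) → total (λ a → f a + g a) l ≡ total f l + total g l
total-+ f g []      = refl
total-+ f g (a ∷ l) = trans (cong ((f a + g a) +_) (total-+ f g l)) (+-interchange (f a) (g a) _ _)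

total-≤ : {A : Set} {f g : A → ℕ} {l : List A} → All (λ a → f a ≤ g a) l → total f l ≤ total g l
total-≤ []       = z≤n
total-≤ (p ∷ ps) = +-mono-≤ p (total-≤ ps)

total-cong : {A : Set} {f g : A → ℕ} {l : List A} → All (λ a → f a ≡ g a) l → total f l ≡ total g l
total-cong []       = refl
total-cong (p ∷ ps) = cong₂ _+_ p (total-cong ps)

total-const-≤ : {A : Set} {f : A → ℕ} {c : ℕ} {l : List A} → All (λ a → f a ≤ c) l → total f l ≤ length l * c
total-const-≤ []       = z≤n
total-const-≤ (p ∷ ps) = +-mono-≤ p (total-const-≤ ps)

total-const-≥ : {A : Set} {f : A → ℕ} {c : ℕ} {l : List A} → All (λ a → c ≤ f a) l → length l * c ≤ total f l
total-const-≥ []       = z≤n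
total-const-≥ (p ∷ ps) = +-mono-≤ p (total-const-≥ ps)

total-sumTo : {A : Set} (n : ℕ) (f : A → ℕ → ℕ) (l : List A) →
  total (λ a → sumTo n (f a)) l ≡ sumTo n (λ i → total (λ a → f a i) l)
total-sumTo zero    f []      = refl
total-sumTo zero    f (a ∷ l) = total-sumTo zero f l
total-sumTo (suc n) f l = trans (total-+ (λ a → sumTo n (f a)) (λ a → f a n) l)
  (cong (_+ total (λ a → f a n) l) (total-sumTo n f l))

-- A vertex of the removed colour class, as the pair of the numbers of (k - 1)-
-- and k-cliques in its link.
Vertex : Set
Vertex = ℕ × ℕ

Σx Σy : List Vertex → ℕ
Σx = total proj₁
Σy = total proj₂

-- The bound by `M` records the choice of the class: what remains is a neighbourhood with the
-- largest number `M` of cliques, so no removed vertex has more in its link.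
Fits : ℕ → ℕ → ℕ → List Vertex → Set
Fits κ R M = All (λ v → proj₂ v ≤ M × Supports κ R (proj₁ v) (proj₂ v))

-- `M` and `Z` count the cliques of the two sizes that survive the removal; `l` describes the
-- removed vertices, which bring in one more colour.
Claim : ℕ → ℕ → Set
Claim κ R = ∀ M Z l → Z ≤ ψ κ R M → Fits κ R M l → Z + Σy l ≤ ψ κ (suc R) (M + Σx l)

fdiv-≥ : ∀ R {c n} → c * suc R ≤ n → c ≤ fdiv n (suc R)
fdiv-≥ R {c} {n} le = ≤-trans (≤-reflexive (sym (m*n/n≡m c (suc R)))) (/-monoˡ-≤ (suc R) le)

τ-class-≥ : ∀ k R {c n} → c * suc R ≤ n →
  τ (suc k) (others (suc R) n) R + c * τ k (others (suc R) n) R ≤ τ (suc k) n (suc R)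
τ-class-≥ k R {c} {n} le with divide R n
... | divided q s s≤R rewrite others-rem R q s≤R = ≤-trans
  (+-monoʳ-≤ _ (*-monoˡ-≤ (τ k (s + q * R) R) (≤-trans (fdiv-≥ R {c} le) (≤-reflexive (fdiv-rem R q s≤R)))))
  (≤-reflexive (sym (τ-class k R q s≤R)))

others-+-≤ : ∀ R {c n} → c * suc R ≤ n → others (suc R) n + c ≤ n
others-+-≤ R {c} {n} le with divide R n
... | divided q s s≤R rewrite others-rem R q s≤R = ≤-trans
  (+-monoʳ-≤ (s + q * R) (≤-trans (fdiv-≥ R le) (≤-reflexive (fdiv-rem R q s≤R)))) (≤-reflexive (regroup s q R))
  where
  regroup : ∀ s q R → s + q * R + q ≡ s + q * suc R
  regroup = solve-∀

τ2-suc : ∀ n r → τ 2 (suc n) r ≡ τ 2 n r + others r n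
τ2-suc n r = cong (τ 2 n r +_) (τ-1 (others r n) (pred r))

-- Turán's theorem for a class of `p` vertices joined to a Turán graph on `M` vertices. A vertex of
-- the class is deleted if the class has more than `Q` vertices, and otherwise a vertex of smallest
-- degree outside it; either has at most the degree of the last vertex of the balanced graph.
turán-step : ∀ R n M p → M + p ≡ n → τ 2 M (suc R) + p * M ≤ τ 2 n (2 + R)
turán-step R zero    zero    zero    refl = z≤n
turán-step R (suc n) M p eq = choose M p eq refl (divide (suc R) n)
  where
  open ≤-Reasoning
  expand : ∀ s Q R → s + Q * (2 + R) ≡ s + Q * suc R + Q
  expand = solve-∀
  drop-class-vertex : ∀ Q s → s ≤ suc R → ∀ M p → M + suc p ≡ suc n → n ≡ s + Q * (2 + R) → Q < suc p →
    τ 2 M (suc R) + suc p * M ≤ τ 2 (suc n) (2 + R)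
  drop-class-vertex Q s s≤R M p eq refl Q<p = begin
    τ 2 M (suc R) + (M + p * M)       ≡⟨ lin 3 (λ a b c → [] ⊢ a :+ (b :+ c) :≡ a :+ c :+ b) refl (τ 2 M (suc R)) M (p * M) ⟩
    τ 2 M (suc R) + p * M + M         ≤⟨ +-mono-≤ (turán-step R m M p (suc-injective (trans (sym (+-suc M p)) eq))) M≤ ⟩
    τ 2 m (2 + R) + (s + Q * suc R)   ≡⟨ cong (τ 2 m (2 + R) +_) (sym (others-rem (suc R) Q s≤R)) ⟩
    τ 2 m (2 + R) + others (2 + R) m  ≡⟨ sym (τ2-suc m (2 + R)) ⟩
    τ 2 (suc m) (2 + R)               ∎
    where
    m = s + Q * (2 + R)
    M≤ : M ≤ s + Q * suc R
    M≤ = lin 5 (λ M p m a Q → M :+ (con 1 :+ p) :≡ con 1 :+ m ∷ m :≡ a :+ Q ∷ Q :< con 1 :+ p ∷ [] ⊢ M :≤ a) refl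
      M p m (s + Q * suc R) Q eq (expand s Q R) Q<p
  drop-other-vertex : ∀ Q s → s ≤ suc R → ∀ M p → suc M + p ≡ suc n → n ≡ s + Q * (2 + R) → p ≤ Q →
    τ 2 (suc M) (suc R) + p * suc M ≤ τ 2 (suc n) (2 + R)
  drop-other-vertex Q s s≤R M p eq refl p≤Q = begin
    τ 2 (suc M) (suc R) + p * suc M                     ≡⟨ cong₂ _+_ (τ2-suc M (suc R)) (*-suc p M) ⟩
    τ 2 M (suc R) + others (suc R) M + (p + p * M)      ≡⟨ lin 4 (λ a b c d → [] ⊢ a :+ b :+ (c :+ d) :≡ a :+ d :+ (b :+ c)) refl
                                                            (τ 2 M (suc R)) (others (suc R) M) p (p * M) ⟩
    τ 2 M (suc R) + p * M + (others (suc R) M + p)      ≤⟨ +-mono-≤ (turán-step R m M p (suc-injective eq)) others≤ ⟩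
    τ 2 m (2 + R) + (s + Q * suc R)                     ≡⟨ cong (τ 2 m (2 + R) +_) (sym (others-rem (suc R) Q s≤R)) ⟩
    τ 2 m (2 + R) + others (2 + R) m                    ≡⟨ sym (τ2-suc m (2 + R)) ⟩
    τ 2 (suc m) (2 + R)                                 ∎
    where
    m = s + Q * (2 + R)
    QR≤M : Q * suc R ≤ M
    QR≤M = lin 6 (λ M p m s a Q → con 1 :+ M :+ p :≡ con 1 :+ m ∷ m :≡ s :+ a :+ Q ∷ p :≤ Q ∷ [] ⊢ a :≤ M) refl
      M p m s (Q * suc R) Q eq (expand s Q R) p≤Q
    others≤ : others (suc R) M + p ≤ s + Q * suc R
    others≤ = lin 6 (λ o p M m a Q → o :+ Q :≤ M ∷ con 1 :+ M :+ p :≡ con 1 :+ m ∷ m :≡ a :+ Q ∷ [] ⊢ o :+ p :≤ a) refl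
      (others (suc R) M) p M m (s + Q * suc R) Q (others-+-≤ R QR≤M) eq (expand s Q R)
  choose : ∀ M p → M + p ≡ suc n → ∀ {n′} → n ≡ n′ → Divided (suc R) n′ → τ 2 M (suc R) + p * M ≤ τ 2 (suc n) (2 + R)
  choose zero    p       eq _ _ = ≤-trans (≤-reflexive (*-zeroʳ p)) z≤n
  choose (suc M) p       eq e (divided Q s s≤R) with p ≤? Q
  choose (suc M) p       eq e (divided Q s s≤R) | yes p≤Q = drop-other-vertex Q s s≤R M p eq e p≤Q
  choose (suc M) zero    eq e (divided Q s s≤R) | no p≰Q = ⊥-elim (p≰Q z≤n)
  choose (suc M) (suc p) eq e (divided Q s s≤R) | no p≰Q = drop-class-vertex Q s s≤R (suc M) p eq e (≰⇒> p≰Q)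

claim-zero : ∀ R → Claim 0 (suc R)
claim-zero R M Z l Z≤ fits = begin
  Z + Σy l                              ≤⟨ +-mono-≤ Z≤ (Σy≤ fits) ⟩
  τ 2 M (suc R) + Σx l * M              ≤⟨ turán-step R (M + Σx l) M (Σx l) refl ⟩
  τ 2 (M + Σx l) (2 + R)                ∎
  where
  open ≤-Reasoning
  y≤ : ∀ x {y} → y ≤ M → (x ≡ 0 → y ≡ 0) → y ≤ x * M
  y≤ zero    _   s = ≤-reflexive (s refl)
  y≤ (suc x) y≤M _ = ≤-trans y≤M (m≤m+n M _)
  Σy≤ : ∀ {l} → Fits 0 (suc R) M l → Σy l ≤ Σx l * M
  Σy≤ []                           = z≤n
  Σy≤ {(x , y) ∷ l} ((y≤M , s) ∷ fs) = ≤-trans (+-mono-≤ (y≤ x y≤M s) (Σy≤ fs)) (≤-reflexive (sym (*-distribʳ-+ M x (Σx l))))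

supports-degenerate : ∀ {κ R x y} → suc R ≤ κ → Supports κ (suc R) x y → y ≡ 0
supports-degenerate {suc κ} {R} {x} R<κ y≤ with m≤n⇒m<n∨m≡n R<κ
... | inj₁ (s≤s R<κ′) = n≤0⇒n≡0 (≤-trans y≤ (≤-reflexive (ψ-infeasible x R<κ′)))
... | inj₂ refl = n≤0⇒n≡0 (≤-trans y≤ (≤-reflexive (ψ-top κ x)))

-- So few colours admit no properly coloured sets of size `κ + 1`, hence all counts on the left are
-- zero.
claim-degenerate : ∀ {κ R} → suc R ≤ κ → Claim κ (suc R)
claim-degenerate {κ} {R} R<κ M Z l Z≤ fits = ≤-trans (≤-reflexive (cong₂ _+_
  (n≤0⇒n≡0 (≤-trans Z≤ (≤-reflexive (ψ-infeasible M R<κ)))) (none fits))) z≤n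
  where
  none : ∀ {l} → Fits κ (suc R) M l → Σy l ≡ 0
  none []             = refl
  none ((_ , s) ∷ fs) = cong₂ _+_ (supports-degenerate R<κ s) (none fs)

cone-all : ∀ κ {M Z} l → Z ≤ ψ κ 0 M → Fits κ 0 M l → Z + Σy l ≤ ψ κ 0 (M + Σx l)
cone-all κ {M} {Z} [] Z≤ [] = subst₂ _≤_ (sym (+-identityʳ Z)) (cong (ψ κ 0) (sym (+-identityʳ M))) Z≤
cone-all κ {M} {Z} ((x , y) ∷ l) Z≤ ((y≤M , s) ∷ fs) = begin
  Z + (y + Σy l)              ≡⟨ lin 3 (λ a b c → [] ⊢ a :+ (b :+ c) :≡ a :+ c :+ b) refl Z y (Σy l) ⟩
  Z + Σy l + y                ≤⟨ +-monoˡ-≤ y (cone-all κ l Z≤ fs) ⟩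
  ψ κ 0 (M + Σx l) + y        ≤⟨ cone κ (≤-trans y≤M (m≤m+n M _)) s ⟩
  ψ κ 0 (M + Σx l + x)        ≡⟨ cong (ψ κ 0) (lin 3 (λ a b c → [] ⊢ a :+ c :+ b :≡ a :+ (b :+ c)) refl M x (Σx l)) ⟩
  ψ κ 0 (M + (x + Σx l))      ∎
  where open ≤-Reasoning

record Extracted (P Q : Vertex → Set) (l : List Vertex) : Set where
  constructor extracted
  field
    vertex : Vertex
    rest   : List Vertex
    holds  : P vertex
    keeps  : Q vertex
    keep   : All Q rest
    sum-of : ∀ f → total f l ≡ f vertex + total f rest
    len    : length l ≡ suc (length rest)

extract : {P Q : Vertex → Set} → (∀ v → Dec (P v)) → ∀ {l} → All Q l →
  Extracted P Q l ⊎ All (λ v → ¬ P v) l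
extract P? []                 = inj₂ []
extract P? {v ∷ l} (q ∷ qs) with P? v | extract P? qs
... | yes p | _        = inj₁ (extracted v l p q qs (λ _ → refl) refl)
... | no ¬p | inj₂ nps = inj₂ (¬p ∷ nps)
... | no ¬p | inj₁ (extracted w rest p q′ qs′ ef el) = inj₁ (extracted w (v ∷ rest) p q′ (q ∷ qs′)
  (λ f → trans (cong (f v +_) (ef f)) (exchange (f v) (f w) (total f rest)))
  (cong suc el))
  where
  exchange : ∀ a b c → a + (b + c) ≡ b + (a + c)
  exchange = solve-∀

-- The effective size of a class: `tab` produces a list of prescribed length, in which some vertices
-- may lie in no set.
positives : List Vertex → ℕ
positives []                = 0
positives ((zero  , _) ∷ l) = positives l
positives ((suc _ , _) ∷ l) = suc (positives l)

tab : ℕ → (ℕ → Vertex) → List Vertex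
tab zero    F = []
tab (suc n) F = F n ∷ tab n F

tab-all : {P : Vertex → Set} (n : ℕ) {F : ℕ → Vertex} → (∀ i → P (F i)) → All P (tab n F)
tab-all zero    p = []
tab-all (suc n) p = p n ∷ tab-all n p

total-tab : ∀ f n F → total f (tab n F) ≡ sumTo n (f ∘ F)
total-tab f zero    F = refl
total-tab f (suc n) F = trans (+-comm (f (F n)) _) (cong (_+ f (F n)) (total-tab f n F))

positives-tab-≤ : ∀ n F → positives (tab n F) ≤ positives (tab (suc n) F)
positives-tab-≤ n F with F n
... | zero  , _ = ≤-refl
... | suc _ , _ = n≤1+n _

positives-tab : ∀ n {m F} → m ≤ n → (∀ i → i < m → 1 ≤ proj₁ (F i)) → m ≤ positives (tab n F)
positives-tab n       {zero}  _ _ = z≤n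
positives-tab (suc n) {suc m} {F} (s≤s m≤n) pos with m≤n⇒m<n∨m≡n m≤n
... | inj₁ m<n = ≤-trans (positives-tab n m<n pos) (positives-tab-≤ n F)
... | inj₂ refl with F n | pos n ≤-refl
...   | suc _ , _ | _ = s≤s (positives-tab n ≤-refl (λ i i<n → pos i (m<n⇒m<1+n i<n)))

supports-≤ : ∀ κ {r x y y′} → y′ ≤ y → Supports κ r x y → Supports κ r x y′
supports-≤ zero    y′≤y s = λ e → n≤0⇒n≡0 (≤-trans y′≤y (≤-reflexive (s e)))
supports-≤ (suc κ) y′≤y s = ≤-trans y′≤y s

-- The induction step of the claim

module Compression
  (κ R₁ : ℕ) (κ<R₁ : κ < R₁)
  (claim-low : Claim κ R₁) (claim-same : Claim (suc κ) R₁) where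

  R r : ℕ
  R = suc R₁
  r = suc R

  -- `f` is the scale for the whole configuration, `g` and `g′` those for the sets avoiding the
  -- removed class, and `e` that for the link of a removed vertex; `width` and `extent` are the
  -- block sizes of `g` and `e`.
  f g g′ e width extent : ℕ → ℕ
  f n = τ (2 + κ) n r
  g n = τ (2 + κ) n R
  g′ n = τ (3 + κ) n R
  e n = τ (suc κ) n R
  width = block (suc κ) R
  extent = block κ R

  Ψ Ψʳ Ψ′ Ψ″ : ℕ → ℕ
  Ψ  = ψ (suc κ) r
  Ψʳ = ψ (suc κ) R
  Ψ′ = ψ κ R
  Ψ″ = ψ κ R₁

  feasʳ : Feasible (2 + κ) R
  feasʳ = inj₂ (s≤s κ<R₁)

  feas : Feasible (2 + κ) r
  feas = inj₂ (s≤s (m≤n⇒m≤1+n κ<R₁))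

  feas′ : Feasible (suc κ) R
  feas′ = inj₂ (m≤n⇒m≤1+n κ<R₁)

  -- The increment of `width` counts sets that avoid some colour class of the link. This class is
  -- nonempty by `R ≤ h`, and a vertex of it extends them to distinct sets counted by `width h`.
  width-double : ∀ {h} → R ≤ h → width (suc h) ≤ width h + width h
  width-double {h} R≤h with others-suc R h
  ... | inj₁ eq = ≤-trans (≤-reflexive (cong (λ n → τ (suc κ) n R₁) eq)) (m≤m+n _ _)
  ... | inj₂ eq = ≤-trans (≤-reflexive (cong (λ n → τ (suc κ) n R₁) eq)) (+-monoʳ-≤ (width h) (last-class R₁ κ<R₁ refl))
    where
    R₁≤ : R₁ ≤ others R h
    R₁≤ = others-low R (≤-trans (n≤1+n R₁) R≤h) ≤-refl
    last-class : ∀ R₀ → κ < R₀ → R₀ ≡ R₁ → τ κ (others R₀ (others R h)) (pred R₀) ≤ τ (suc κ) (others R h) R₀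
    last-class (suc R₀) _ refl = ≤-trans (≤-trans (≤-reflexive (sym (*-identityˡ _))) (m≤n+m _ (τ (suc κ) (others (suc R₀) (others R h)) R₀)))
      (τ-class-≥ κ R₀ {1} {others R h} (≤-trans (≤-reflexive (*-identityˡ _)) R₁≤))

  -- `width-double` telescoped: one step raises `width` by at most `width h`, which is just the
  -- increment of `g`.
  width-growth : ∀ {β} d → R ≤ β → width (β + d) + g β ≤ g (β + d) + width β
  width-growth {β} zero R≤β = ≤-reflexive (trans (cong (λ n → width n + g β) (+-identityʳ β))
    (trans (+-comm (width β) (g β)) (cong (λ n → g n + width β) (sym (+-identityʳ β)))))
  width-growth {β} (suc d) R≤β = subst (λ n → width n + g β ≤ g n + width β) (sym (+-suc β d))
    (lin 5 (λ w₊ w gβ gh wβ → w₊ :≤ w :+ w ∷ w :+ gβ :≤ gh :+ wβ ∷ [] ⊢ w₊ :+ gβ :≤ gh :+ w :+ wβ) refl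
      (width (suc (β + d))) (width (β + d)) (g β) (g (β + d)) (width β)
      (width-double (≤-trans R≤β (m≤m+n β d))) (width-growth d R≤β))

  module At (Λ b₁ : ℕ) (low : f (suc b₁) ≤ Λ) (high : Λ < f (2 + b₁))
            (rec : ∀ M Z l → M + Σx l < Λ → Z ≤ Ψʳ M → Fits (suc κ) R M l → Z + Σy l ≤ Ψ (M + Σx l)) where

    -- The minimum vertex degree of the Turán graph on 1 + b₁ vertices.
    B : ℕ
    B = block (suc κ) r b₁

    -- `low` forces `a` to be at least `f b₁`, so the block of `a` is no narrower than `B`, and
    -- `ψ-append` applies.
    detach : ∀ a x → a + x ≡ Λ → x ≤ B → Ψ a + Ψ′ x ≤ Ψ Λ
    detach a x a+x≡Λ x≤B = go (locate {suc κ} feas a) a+x≡Λ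
      where
      go : ∀ {a} → Located (suc κ) r a → a + x ≡ Λ → Ψ a + Ψ′ x ≤ Ψ Λ
      go (located c z z<) eq = subst (λ t → Ψ (f c + z) + Ψ′ x ≤ Ψ t) eq
        (ψ-append κ feas c (<⇒≤ z<) (≤-trans x≤B (block-mono (suc κ) r b₁≤c)))
        where
        b₁≤c : b₁ ≤ c
        b₁≤c = ≤-pred (τ-cancel-< (2 + κ) r
          (lin 7 (λ F B Λ G z x w → F :+ B :≤ Λ ∷ G :+ z :+ x :≡ Λ ∷ x :≤ B ∷ z :< w ∷ [] ⊢ F :< G :+ w) refl
            (f b₁) B Λ (f c) z x (block (suc κ) r c) low eq x≤B z<))

    record State (M Z : ℕ) (l : List Vertex) : Set where
      constructor state
      field
        sums : M + Σx l ≡ Λ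
        cap  : Z ≤ Ψʳ M
        fits : Fits (suc κ) R M l

    Bounded : ℕ → List Vertex → Set
    Bounded Z l = Z + Σy l ≤ Ψ Λ

    drop-small : ∀ {M Z l} → State M Z l →
      Extracted (λ v → 1 ≤ proj₁ v × proj₁ v ≤ B) (λ v → proj₂ v ≤ M × proj₂ v ≤ Ψ′ (proj₁ v)) l → Bounded Z l
    drop-small {M} {Z} {l} (state sums cap fits) (extracted (x , y) rest (1≤x , x≤B) (y≤M , y≤) keep sum-of _) = begin
      Z + Σy l                           ≡⟨ cong (Z +_) (sum-of proj₂) ⟩
      Z + (y + Σy rest)                  ≡⟨ lin 3 (λ a b c → [] ⊢ a :+ (b :+ c) :≡ a :+ c :+ b) refl Z y (Σy rest) ⟩
      Z + Σy rest + y                    ≤⟨ +-mono-≤ (rec M Z rest smaller cap keep) y≤ ⟩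
      Ψ (M + Σx rest) + Ψ′ x             ≤⟨ detach (M + Σx rest) x eq x≤B ⟩
      Ψ Λ                                ∎
      where
      open ≤-Reasoning
      eq : M + Σx rest + x ≡ Λ
      eq = trans (lin 3 (λ a b c → [] ⊢ a :+ c :+ b :≡ a :+ (b :+ c)) refl M x (Σx rest)) (trans (cong (M +_) (sym (sum-of proj₁))) sums)
      smaller : M + Σx rest < Λ
      smaller = lin 3 (λ a x Λ → a :+ x :≡ Λ ∷ con 1 :≤ x ∷ [] ⊢ a :< Λ) refl (M + Σx rest) x Λ eq 1≤x

    record Purged (M : ℕ) (l : List Vertex) : Set where
      constructor purged
      field
        list  : List Vertex
        keep  : Fits (suc κ) R M list
        large : All (λ v → B < proj₁ v) list
        x-sum : Σx list ≡ Σx l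
        y-sum : Σy list ≡ Σy l
        len   : length list ≡ positives l

    purge : ∀ {M l} → Fits (suc κ) R M l → All (λ v → ¬ (1 ≤ proj₁ v × proj₁ v ≤ B)) l → Purged M l
    purge [] [] = purged [] [] [] refl refl refl
    purge {l = (zero , y) ∷ l} ((_ , y≤) ∷ fs) (_ ∷ ns) with purge fs ns
    ... | purged l′ fs′ large ex ey el = purged l′ fs′ large ex
      (trans ey (cong (_+ Σy l) (sym (n≤0⇒n≡0 (≤-trans y≤ (≤-reflexive (ψ-zero κ R))))))) el
    purge {l = (suc x , y) ∷ l} (f′ ∷ fs) (n ∷ ns) with purge fs ns
    ... | purged l′ fs′ large ex ey el = purged ((suc x , y) ∷ l′) (f′ ∷ fs′) (≰⇒> (λ x≤B → n (s≤s z≤n , x≤B)) ∷ large)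
      (cong (suc x +_) ex) (cong (y +_) ey) (cong suc el)

    -- As `y ≤ M ≤ g (suc h)`, a link of `e (suc h)` sets already supports `y`. Giving up the excess
    -- of `x` lowers the total, so the induction hypothesis applies.
    truncate : ∀ {M Z l} h → M ≤ g (suc h) → State M Z l →
      Extracted (λ v → e (suc h) < proj₁ v) (λ v → proj₂ v ≤ M × proj₂ v ≤ Ψ′ (proj₁ v)) l → Bounded Z l
    truncate {M} {Z} {l} h M≤ (state sums cap fits) (extracted (x , y) rest lt (y≤M , y≤) keep sum-of _) = begin
      Z + Σy l                                  ≡⟨ cong (Z +_) (sum-of proj₂) ⟩
      Z + (y + Σy rest)                         ≤⟨ rec M Z ((e (suc h) , y) ∷ rest) smaller cap
                                                     ((y≤M , ≤-trans y≤M (≤-trans M≤ (≤-reflexive (sym (ψ-boundary κ R (suc h)))))) ∷ keep) ⟩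
      Ψ (M + (e (suc h) + Σx rest))             ≤⟨ ψ-mono (suc κ) feas (<⇒≤ smaller) ⟩
      Ψ Λ                                       ∎
      where
      open ≤-Reasoning
      smaller : M + (e (suc h) + Σx rest) < Λ
      smaller = lin 6 (λ M E x c s Λ → E :< x ∷ s :≡ x :+ c ∷ M :+ s :≡ Λ ∷ [] ⊢ M :+ (E :+ c) :< Λ) refl
        M (e (suc h)) x (Σx rest) (Σx l) Λ lt (sum-of proj₁) sums

    module InBlock (h z : ℕ) (1≤z : 1 ≤ z) (z≤ : z ≤ width h) {Z : ℕ} {l : List Vertex}
                   (st : State (g h + z) Z l) (large : All (λ v → B < proj₁ v) l)
                   (small : All (λ v → proj₁ v ≤ e (suc h)) l) where

      open State st

      -- With links pictured as colex segments, `h` is the last vertex used outside the class;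
      -- `outer` is the part of a link through `h` and `inner` the part on the earlier vertices.
      -- Thus `D` is the degree of `h`.
      inner outer : Vertex → Vertex
      inner (x , y) = e h ⊓ x , g h ⊓ y
      outer (x , y) = x ∸ e h , y ∸ g h

      D : ℕ
      D = z + Σx (map outer l)

      outer-fits : Fits κ R₁ z (map outer l)
      outer-fits = AllP.map⁺ (All.zipWith go (small , fits))
        where
        go : ∀ {v} → proj₁ v ≤ e (suc h) × (proj₂ v ≤ g h + z × proj₂ v ≤ Ψ′ (proj₁ v)) →
             proj₂ (outer v) ≤ z × Supports κ R₁ (proj₁ (outer v)) (proj₂ (outer v))
        go {x , y} (x≤ , y≤ , y≤ψ) =
          ≤-trans (∸-monoˡ-≤ (g h) y≤) (≤-reflexive (m+n∸m≡n (g h) z)) ,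
          supports-link κ R h (≤-trans (∸-monoˡ-≤ (e h) x≤) (≤-reflexive (m+n∸m≡n (e h) (extent h))))
            (≤-trans y≤ψ (ψ-mono κ feas′ (m≤n+m∸n x (e h))))

      inner-fits : Fits (suc κ) R (g h) (map inner l)
      inner-fits = AllP.map⁺ (All.map go fits)
        where
        go : ∀ {v} → proj₂ v ≤ g h + z × proj₂ v ≤ Ψ′ (proj₁ v) →
             proj₂ (inner v) ≤ g h × proj₂ (inner v) ≤ Ψ′ (proj₁ (inner v))
        go {x , y} (_ , y≤ψ) = m⊓n≤m (g h) y , le
          where
          le : g h ⊓ y ≤ Ψ′ (e h ⊓ x)
          le with ≤-total (e h) x
          ... | inj₁ e≤x = ≤-trans (m⊓n≤m (g h) y) (≤-reflexive (trans (sym (ψ-boundary κ R h)) (cong Ψ′ (sym (m≤n⇒m⊓n≡m e≤x)))))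
          ... | inj₂ x≤e = ≤-trans (m⊓n≤n (g h) y) (≤-trans y≤ψ (≤-reflexive (cong Ψ′ (sym (m≥n⇒m⊓n≡n x≤e)))))

      x-split : Σx l ≡ Σx (map inner l) + Σx (map outer l)
      x-split = begin
        total proj₁ l                                                            ≡⟨ total-cong (All.universal (λ v → sym (m⊓n+n∸m≡n (e h) (proj₁ v))) l) ⟩
        total (λ v → proj₁ (inner v) + proj₁ (outer v)) l                        ≡⟨ total-+ (proj₁ ∘ inner) (proj₁ ∘ outer) l ⟩
        total (proj₁ ∘ inner) l + total (proj₁ ∘ outer) l                        ≡⟨ sym (cong₂ _+_ (total-map proj₁ inner l) (total-map proj₁ outer l)) ⟩
        Σx (map inner l) + Σx (map outer l)                                      ∎
        where open ≡-Reasoning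

      y-split : Σy l ≡ Σy (map inner l) + Σy (map outer l)
      y-split = begin
        total proj₂ l                                                            ≡⟨ total-cong (All.universal (λ v → sym (m⊓n+n∸m≡n (g h) (proj₂ v))) l) ⟩
        total (λ v → proj₂ (inner v) + proj₂ (outer v)) l                        ≡⟨ total-+ (proj₂ ∘ inner) (proj₂ ∘ outer) l ⟩
        total (proj₂ ∘ inner) l + total (proj₂ ∘ outer) l                        ≡⟨ sym (cong₂ _+_ (total-map proj₂ inner l) (total-map proj₂ outer l)) ⟩
        Σy (map inner l) + Σy (map outer l)                                      ∎
        where open ≡-Reasoning

      Λ-split : g h + Σx (map inner l) + D ≡ Λ
      Λ-split = lin 6 (λ G z s a b Λ → G :+ z :+ s :≡ Λ ∷ s :≡ a :+ b ∷ [] ⊢ G :+ a :+ (z :+ b) :≡ Λ) refl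
        (g h) z (Σx l) (Σx (map inner l)) (Σx (map outer l)) Λ sums x-split

      -- The sets through `h` form a configuration one level lower, with `z` sets avoiding the
      -- class, and `claim-low` bounds what they support.
      value-split : Z + Σy l ≤ g′ h + Σy (map inner l) + Ψ′ D
      value-split = lin 7 (λ Z s G p a b d → Z :≤ G :+ p ∷ s :≡ a :+ b ∷ p :+ b :≤ d ∷ [] ⊢ Z :+ s :≤ G :+ a :+ d) refl
        Z (Σy l) (g′ h) (Ψ″ z) (Σy (map inner l)) (Σy (map outer l)) (Ψ′ D)
        (≤-trans cap (≤-reflexive (ψ-block κ R h z≤))) y-split
        (claim-low z (Ψ″ z) (map outer l) ≤-refl outer-fits)

      drop-last : D ≤ B → Bounded Z l
      drop-last D≤B = ≤-trans value-split (≤-trans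
        (+-monoˡ-≤ (Ψ′ D) (rec (g h) (g′ h) (map inner l) smaller (≤-reflexive (sym (ψ-boundary (suc κ) R h))) inner-fits))
        (detach (g h + Σx (map inner l)) D Λ-split D≤B))
        where
        smaller : g h + Σx (map inner l) < Λ
        smaller = lin 4 (λ a z o Λ → a :+ (z :+ o) :≡ Λ ∷ con 1 :≤ z ∷ [] ⊢ a :< Λ) refl
          (g h + Σx (map inner l)) z (Σx (map outer l)) Λ Λ-split 1≤z

  multiple-≤ : ∀ n a c → n * Ψ′ a + Ψ′ c ≤ Ψ′ (n * a + c)
  multiple-≤ zero    a c = ≤-refl
  multiple-≤ (suc n) a c = begin
    Ψ′ a + n * Ψ′ a + Ψ′ c        ≡⟨ +-assoc (Ψ′ a) _ _ ⟩
    Ψ′ a + (n * Ψ′ a + Ψ′ c)      ≤⟨ +-monoʳ-≤ (Ψ′ a) (multiple-≤ n a c) ⟩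
    Ψ′ a + Ψ′ (n * a + c)         ≤⟨ superadditive κ feas′ a (n * a + c) ⟩
    Ψ′ (a + (n * a + c))          ≡⟨ cong Ψ′ (sym (+-assoc a (n * a) c)) ⟩
    Ψ′ (a + n * a + c)            ∎
    where open ≤-Reasoning

  module Big (Λ q s : ℕ) (s≤R : s ≤ R) (R≤b₁ : R ≤ s + q * r)
             (low : f (suc (s + q * r)) ≤ Λ) (high : Λ < f (2 + (s + q * r)))
             (rec : ∀ M Z l → M + Σx l < Λ → Z ≤ Ψʳ M → Fits (suc κ) R M l → Z + Σy l ≤ Ψ (M + Σx l)) where

    -- The Turán graph on `suc b₁` vertices, against which everything is compared, consists of a
    -- class of `suc q` vertices, each lying in `B` sets, and of the Turán graph on the other `β`
    -- vertices with `R` colours.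
    b₁ β : ℕ
    b₁ = s + q * r
    β = s + q * R

    open At Λ b₁ low high rec

    others-b₁ : others r b₁ ≡ β
    others-b₁ = others-rem R q s≤R

    B≡ : B ≡ e β
    B≡ = cong e others-b₁

    R≤β : R ≤ β
    R≤β = subst (R ≤_) others-b₁ (others-low r R≤b₁ ≤-refl)

    f≡ : f (suc b₁) ≡ g β + suc q * B
    f≡ = trans (τ-class₊ (suc κ) R q s≤R) (cong (λ t → g β + suc q * t) (sym B≡))

    -- The link of the next vertex of the Turán graph has at most `suc β` vertices, so this vertex
    -- adds at most `B + extent β` sets.
    high′ : Λ < g β + suc q * B + (B + extent β)
    high′ = <-≤-trans high (+-mono-≤ (≤-reflexive f≡)
      (≤-trans (τ-mono (suc κ) R (others-b₁+1 (others-suc r b₁))) (≤-reflexive (cong (_+ extent β) (sym B≡)))))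
      where
      others-b₁+1 : others r (suc b₁) ≡ others r b₁ ⊎ others r (suc b₁) ≡ suc (others r b₁) → others r (suc b₁) ≤ suc β
      others-b₁+1 (inj₁ eq) = ≤-trans (≤-reflexive (trans eq others-b₁)) (n≤1+n β)
      others-b₁+1 (inj₂ eq) = ≤-reflexive (trans eq (cong suc others-b₁))

    -- A colour class of the Turán graph on `β` vertices is deleted. It is nonempty by `R ≤ β`; that
    -- it has at least `q` vertices gives `B≥q`.
    B≥ : width β + extent β ≤ B
    B≥ = ≤-trans (≤-reflexive (cong (width β +_) (sym (*-identityˡ (extent β)))))
      (≤-trans (τ-class-≥ κ R₁ {1} {β} (≤-trans (≤-reflexive (*-identityˡ R)) R≤β)) (≤-reflexive (sym B≡)))

    B≥q : width β + q * extent β ≤ B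
    B≥q = ≤-trans (τ-class-≥ κ R₁ {q} {β} (m≤n+m (q * R) s)) (≤-reflexive (sym B≡))

    module InBlock′ (h z : ℕ) (1≤z : 1 ≤ z) (z≤ : z ≤ width h) {Z : ℕ} {l : List Vertex}
                   (st : State (g h + z) Z l) (large : All (λ v → B < proj₁ v) l)
                   (small : All (λ v → proj₁ v ≤ e (suc h)) l) (B<D : B < InBlock.D h z 1≤z z≤ st large small) where

      open InBlock h z 1≤z z≤ st large small

      -- If `h ≤ β`, then `h` lies in at most `width β + q * extent β` sets, and `B≥q` contradicts
      -- `B < D`.
      few-beyond : length l ≤ q → β < h
      few-beyond len≤q = ≰⇒> λ h≤β → <⇒≱ B<D (begin
        z + Σx (map outer l)            ≡⟨ cong (z +_) (total-map proj₁ outer l) ⟩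
        z + total (proj₁ ∘ outer) l     ≤⟨ +-mono-≤ z≤ (total-const-≤ (All.map (λ {v} x≤ → ≤-trans (∸-monoˡ-≤ (e h) x≤) (≤-reflexive (m+n∸m≡n (e h) (extent h)))) small)) ⟩
        width h + length l * extent h   ≤⟨ +-mono-≤ (block-mono (suc κ) R h≤β) (*-mono-≤ len≤q (block-mono κ R h≤β)) ⟩
        width β + q * extent β          ≤⟨ B≥q ⟩
        B                               ∎)
        where open ≤-Reasoning

      -- All links exceed `B = e β`, so their inner parts are full, and `suc q` of them complete the
      -- Turán graph on `suc b₁` vertices. Superadditivity merges the other `p` inner parts and the
      -- sets through `h` into the link of one further vertex; `high` ensures that they fit there.
      exact : suc q ≤ length l → h ≡ β → Bounded Z l
      exact q<len refl = begin
        Z + Σy l                                        ≤⟨ value-split ⟩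
        g′ β + Σy (map inner l) + Ψ′ D                  ≤⟨ +-monoˡ-≤ (Ψ′ D) (+-monoʳ-≤ (g′ β) y≤) ⟩
        g′ β + (suc q + p) * g β + Ψ′ D                 ≡⟨ regroup (g′ β) (suc q) p (g β) (Ψ′ D) ⟩
        g′ β + suc q * g β + (p * g β + Ψ′ D)           ≡⟨ cong₂ (λ a b → a + (p * b + Ψ′ D)) (sym (τ-class₊ (2 + κ) R q s≤R)) (trans (sym (ψ-boundary κ R β)) (cong Ψ′ (sym B≡))) ⟩
        τ (3 + κ) (suc b₁) r + (p * Ψ′ B + Ψ′ D)        ≤⟨ +-monoʳ-≤ (τ (3 + κ) (suc b₁) r) (multiple-≤ p B D) ⟩
        τ (3 + κ) (suc b₁) r + Ψ′ (p * B + D)           ≡⟨ sym (ψ-block κ r (suc b₁) ζ≤) ⟩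
        Ψ (f (suc b₁) + (p * B + D))                    ≡⟨ cong Ψ Λ≡ ⟩
        Ψ Λ                                             ∎
        where
        open ≤-Reasoning
        p = length l ∸ suc q
        len : suc q + p ≡ length l
        len = m+[n∸m]≡n q<len
        regroup : ∀ a c p t d → a + (c + p) * t + d ≡ a + c * t + (p * t + d)
        regroup = solve-∀
        regroup′ : ∀ a c p t d → a + c * t + (p * t + d) ≡ a + (c + p) * t + d
        regroup′ = solve-∀
        y≤ : Σy (map inner l) ≤ (suc q + p) * g β
        y≤ = ≤-trans (≤-reflexive (total-map proj₂ inner l)) (≤-trans
          (total-const-≤ (All.universal (λ v → m⊓n≤m (g β) (proj₂ v)) l)) (≤-reflexive (cong (_* g β) (sym len))))
        x≡ : Σx (map inner l) ≡ (suc q + p) * B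
        x≡ = trans (total-map proj₁ inner l) (trans
          (≤-antisym (total-const-≤ (All.universal (λ v → ≤-trans (m⊓n≤m (e β) (proj₁ v)) (≤-reflexive (sym B≡))) l))
                     (total-const-≥ (All.map (λ B<x → ⊓-glb (≤-reflexive B≡) (<⇒≤ B<x)) large)))
          (cong (_* B) (sym len)))
        Λ≡ : f (suc b₁) + (p * B + D) ≡ Λ
        Λ≡ = trans (cong (_+ (p * B + D)) f≡) (trans (regroup′ (g β) (suc q) p B D)
          (trans (cong (λ t → g β + t + D) (sym x≡)) Λ-split))
        ζ≤ : p * B + D ≤ block (suc κ) r (suc b₁)
        ζ≤ = +-cancelˡ-≤ (f (suc b₁)) _ _ (≤-trans (≤-reflexive Λ≡) (<⇒≤ high))

      -- All vertices then have degree above B, so that there are at least as many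
      -- sets as in the Turán graph on 2 + b₁ vertices.
      beyond : suc q ≤ length l → β < h → ⊥
      beyond q<len β<h = by-cases (extract (λ v → e h ≤? proj₁ v) large)
        where
        open ≤-Reasoning
        inner≥ : ∀ {l′} → All (λ v → B < proj₁ v) l′ → length l′ * B ≤ Σx (map inner l′)
        inner≥ {l′} large′ = ≤-trans (total-const-≥ (All.map (λ B<x → ⊓-glb (≤-trans (≤-reflexive B≡) (τ-mono (suc κ) R (<⇒≤ β<h))) (<⇒≤ B<x)) large′))
          (≤-reflexive (sym (total-map proj₁ inner l′)))
        -- The count needs an extra `extent β`. A link with at least `e h` sets provides it; if
        -- there is none, no link reaches `h`, so `D = z`, and `width-growth` together with `B≥`
        -- provides it.
        by-cases : Extracted (λ v → e h ≤ proj₁ v) (λ v → B < proj₁ v) l ⊎ All (λ v → ¬ (e h ≤ proj₁ v)) l → ⊥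
        by-cases (inj₁ (extracted v rest e≤x _ keep sum-of len)) = <⇒≱ high′
          (lin 8 (λ G gβ X D Λ B E qB → G :+ X :+ D :≡ Λ ∷ gβ :≤ G ∷ B :+ E :+ qB :≤ X ∷ B :< D ∷ [] ⊢ gβ :+ (B :+ qB) :+ (B :+ E) :≤ Λ) refl
            (g h) (g β) (Σx (map inner l)) D Λ B (extent β) (q * B) Λ-split (τ-mono (2 + κ) R (<⇒≤ β<h)) X≥ B<D)
          where
          e≥ : B + extent β ≤ e h
          e≥ = ≤-trans (≤-reflexive (cong (_+ extent β) B≡)) (τ-mono (suc κ) R β<h)
          X≥ : B + extent β + q * B ≤ Σx (map inner l)
          X≥ = begin
            B + extent β + q * B                                  ≤⟨ +-mono-≤ (⊓-glb e≥ (≤-trans e≥ e≤x)) (*-monoˡ-≤ B (≤-pred (≤-trans q<len (≤-reflexive len)))) ⟩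
            proj₁ (inner v) + length rest * B                     ≤⟨ +-monoʳ-≤ (proj₁ (inner v)) (inner≥ keep) ⟩
            proj₁ (inner v) + Σx (map inner rest)                 ≡⟨ cong (proj₁ (inner v) +_) (total-map proj₁ inner rest) ⟩
            proj₁ (inner v) + total (proj₁ ∘ inner) rest          ≡⟨ sym (sum-of (proj₁ ∘ inner)) ⟩
            total (proj₁ ∘ inner) l                               ≡⟨ sym (total-map proj₁ inner l) ⟩
            Σx (map inner l)                                      ∎
        by-cases (inj₂ none) = <⇒≱ high′
          (lin 11 (λ G gβ X D Λ B E z w wβ qB → G :+ X :+ D :≡ Λ ∷ z :≤ w ∷ w :+ gβ :≤ G :+ wβ ∷ wβ :+ E :≤ B ∷ B :+ qB :≤ X ∷ B :< D ∷ B :< z ∷ []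
                    ⊢ gβ :+ (B :+ qB) :+ (B :+ E) :≤ Λ) refl
            (g h) (g β) (Σx (map inner l)) D Λ B (extent β) z (width h) (width β) (q * B)
            Λ-split z≤ growth B≥ (≤-trans (*-monoˡ-≤ B q<len) (inner≥ large)) B<D (≤-trans B<D (≤-reflexive D≡z)))
          where
          D≡z : D ≡ z
          D≡z = trans (cong (z +_) (trans (total-map proj₁ outer l) (vanish none))) (+-identityʳ z)
            where
            vanish : ∀ {l} → All (λ v → ¬ (e h ≤ proj₁ v)) l → total (proj₁ ∘ outer) l ≡ 0
            vanish []       = refl
            vanish (n ∷ ns) = cong₂ _+_ (m≤n⇒m∸n≡0 (<⇒≤ (≰⇒> n))) (vanish ns)
          growth : width h + g β ≤ g h + width β
          growth = subst (λ t → width t + g β ≤ g t + width β) (m+[n∸m]≡n (<⇒≤ β<h)) (width-growth (h ∸ β) R≤β)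

      many : suc q ≤ length l → Bounded Z l
      many q<len with <-cmp h β
      ... | tri≈ _ h≡β _ = exact q<len h≡β
      ... | tri> _ _ β<h = ⊥-elim (beyond q<len β<h)
      ... | tri< h<β _ _ = ⊥-elim (none q<len large small)
        where
        none : ∀ {l} → suc q ≤ length l → All (λ v → B < proj₁ v) l → All (λ v → proj₁ v ≤ e (suc h)) l → ⊥
        none () [] []
        none _ (B<x ∷ _) (x≤ ∷ _) = <⇒≱ B<x (≤-trans x≤ (≤-trans (τ-mono (suc κ) R h<β) (≤-reflexive (sym B≡))))

    Transposable : Set
    Transposable = ∀ {h z Z l} → 1 ≤ z → z ≤ width h → State (g h + z) Z l →
      All (λ v → proj₁ v ≤ e (suc h)) l → β < h → Bounded Z l

    -- The exchange of classes is a hypothesis here because `transpose` itself calls `analyse`. It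
    -- does so with the first alternative, in which a short class cannot occur, and so the exchange
    -- is not repeated.
    analyse : ∀ {M Z l} → State M Z l → suc q ≤ positives l ⊎ Transposable → Bounded Z l
    analyse {M} {Z} {l} st@(state sums cap fits) alternative
      with extract (λ v → (1 ≤? proj₁ v) ×-dec (proj₁ v ≤? B)) fits
    ... | inj₁ ex = drop-small st ex
    ... | inj₂ ns with purge fits ns
    ...   | purged l′ keep large ex ey el = subst (λ t → Z + t ≤ Ψ Λ) ey
            (by-size M (state (trans (cong (M +_) ex) sums) cap keep))
      where
      in-block : ∀ {M} → Located₊ (suc κ) R M → State M Z l′ → Bounded Z l′
      in-block (located₊ h z z≤) st′ with extract (λ v → e (suc h) <? proj₁ v) (State.fits st′)
      ... | inj₁ ex′ = truncate h (+-monoʳ-≤ (g h) z≤) st′ ex′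
      ... | inj₂ ns′ with InBlock.D h (suc z) (s≤s z≤n) z≤ st′ large (All.map ≮⇒≥ ns′) ≤? B
      ...   | yes D≤B = InBlock.drop-last h (suc z) (s≤s z≤n) z≤ st′ large (All.map ≮⇒≥ ns′) D≤B
      ...   | no D≰B = decide alternative (suc q ≤? length l′)
        where
        open InBlock′ h (suc z) (s≤s z≤n) z≤ st′ large (All.map ≮⇒≥ ns′) (≰⇒> D≰B)
        decide : suc q ≤ positives l ⊎ Transposable → Dec (suc q ≤ length l′) → Bounded Z l′
        decide _          (yes q<len) = many q<len
        decide (inj₁ pos) (no ¬q<len) = ⊥-elim (¬q<len (≤-trans pos (≤-reflexive (sym el))))
        decide (inj₂ tr)  (no ¬q<len) = tr (s≤s z≤n) z≤ st′ (All.map ≮⇒≥ ns′) (few-beyond (≤-pred (≰⇒> ¬q<len)))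
      by-size : ∀ M → State M Z l′ → Bounded Z l′
      by-size zero    (state _ cap′ fits′) = ≤-trans (≤-reflexive (cong₂ _+_
        (n≤0⇒n≡0 (≤-trans cap′ (≤-reflexive (ψ-zero (suc κ) R)))) (none fits′))) z≤n
        where
        none : ∀ {l} → Fits (suc κ) R 0 l → Σy l ≡ 0
        none []              = refl
        none ((y≤ , _) ∷ fs) = cong₂ _+_ (n≤0⇒n≡0 y≤) (none fs)
      by-size (suc M) st′ = in-block (locate₊ feasʳ M) st′

    record TopSplit (M Z n : ℕ) : Set where
      constructor topSplit
      field
        Z* : ℕ
        Zₗ : ℕ → ℕ
        covers      : Z ≤ Z* + sumTo n Zₗ
        star-bound  : Z* ≤ ψ (suc κ) R₁ (star (2 + κ) R M)
        slice-bound  : ∀ i → Zₗ i ≤ Ψ″ (slice (2 + κ) R M i)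
        slice-≤-star : ∀ i → Zₗ i ≤ star (2 + κ) R M

    -- As `Z` is known only through its bound `Ψʳ M`, that many sets are split instead. If
    -- `R = 2 + κ`, there are too few colours for them, `Z` is zero, and so are all its parts.
    top-split : ∀ {M Z N} → M ≤ g N → Z ≤ Ψʳ M → TopSplit M Z N
    top-split {M} {Z} {N} M≤ Z≤ with m≤n⇒m<n∨m≡n (s≤s κ<R₁)
    ... | inj₁ k<R = topSplit (star (3 + κ) R (Ψʳ M)) (slice (3 + κ) R (Ψʳ M))
      (≤-trans Z≤ (≤-reflexive (sym (split-sum (3 + κ) {N = N} k<R ≤-refl
        (≤-trans (ψ-mono (suc κ) feasʳ M≤) (≤-reflexive (ψ-boundary (suc κ) R N)))))))
      (SplitsOver.star-supports (splits-over (suc κ) R₁ 0 M k<R))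
      (λ i → SplitsOver.slice-supports (splits-over (suc κ) R₁ i M k<R))
      (λ i → SplitsOver.slice-≤-star (splits-over (suc κ) R₁ i M k<R))
    ... | inj₂ refl = topSplit 0 (λ _ → 0) (≤-trans Z≤ (≤-trans (≤-reflexive (ψ-top (suc κ) M)) z≤n))
      z≤n (λ _ → z≤n) (λ _ → z≤n)

    -- Sorting all sets by their vertex of colour 0 instead makes colour 0 the removed
    -- class; it has at least q + 1 vertices as β < h.
    transpose : Transposable
    transpose {h} {z} {Z} {l} 1≤z z≤ (state sums cap fits) small β<h =
      ≤-trans value≤ (analyse (state sums′ cap′ fits′) (inj₁ (positives-tab (suc h) q<h positive)))
      where
      M = g h + z
      M≤ : M ≤ g (suc h)
      M≤ = +-monoʳ-≤ (g h) z≤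
      open TopSplit (top-split {M} {Z} {suc h} M≤ cap)
      k≤R : 2 + κ ≤ R
      k≤R = s≤s κ<R₁
      stars : Vertex → Vertex
      stars (x , y) = star (suc κ) R x , star (2 + κ) R y
      parts : ℕ → Vertex → Vertex
      parts i (x , y) = slice (suc κ) R x i , slice (2 + κ) R y i
      M* = star (2 + κ) R M
      Mₗ = slice (2 + κ) R M
      M′ = M* + Σx (map stars l)
      Z′ = Z* + Σy (map stars l)
      -- The new link of the `i`-th vertex of colour 0 is its slice outside the old class together
      -- with its slices in the old links. It is itself a configuration one level lower, and
      -- `claim-low` shows that it fits.
      l′ : ℕ → Vertex
      l′ i = Mₗ i + Σx (map (parts i) l) , Zₗ i + Σy (map (parts i) l)
      stars-fits : Fits (suc κ) R₁ M* (map stars l)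
      stars-fits = AllP.map⁺ (All.map go fits)
        where
        go : ∀ {v} → proj₂ v ≤ M × proj₂ v ≤ Ψ′ (proj₁ v) →
             proj₂ (stars v) ≤ M* × proj₂ (stars v) ≤ Ψ″ (proj₁ (stars v))
        go {x , y} (y≤M , y≤) = star-mono (2 + κ) k≤R y≤M ,
          ≤-trans (star-mono (2 + κ) k≤R y≤) (SplitsOver.star-supports (splits-over κ R₁ 0 x k≤R))
      parts-fits : ∀ i → Fits κ R₁ (Mₗ i) (map (parts i) l)
      parts-fits i = AllP.map⁺ (All.map go fits)
        where
        go : ∀ {v} → proj₂ v ≤ M × proj₂ v ≤ Ψ′ (proj₁ v) →
             proj₂ (parts i v) ≤ Mₗ i × Supports κ R₁ (proj₁ (parts i v)) (proj₂ (parts i v))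
        go {x , y} (y≤M , y≤) = slice-mono (2 + κ) k≤R i y≤M ,
          supports-≤ κ (slice-mono (2 + κ) k≤R i y≤) (SplitsOver.slice-supports (splits-over κ R₁ i x k≤R))
      cap′ : Z′ ≤ Ψʳ M′
      cap′ = claim-same M* Z* (map stars l) star-bound stars-fits
      fits′ : Fits (suc κ) R M′ (tab (suc h) l′)
      fits′ = tab-all (suc h) λ i →
        +-mono-≤ (slice-≤-star i) (subst₂ _≤_ (sym (total-map proj₂ (parts i) l)) (sym (total-map proj₁ stars l))
          (total-≤ (All.map (λ {v} p → ≤-trans (slice-mono (2 + κ) k≤R i (proj₂ p)) (SplitsOver.slice-≤-star (splits-over κ R₁ i (proj₁ v) k≤R))) fits))) ,
        claim-low (Mₗ i) (Zₗ i) (map (parts i) l) (slice-bound i) (parts-fits i)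
      regroup : ∀ (c : Vertex → ℕ) (a : ℕ) (p : ℕ → ℕ) →
        All (λ v → c (stars v) + sumTo (suc h) (λ i → c (parts i v)) ≡ c v) l →
        a + total c (map stars l) + sumTo (suc h) (λ i → p i + total c (map (parts i) l)) ≡ a + sumTo (suc h) p + total c l
      regroup c a p eqs = begin
        a + total c (map stars l) + sumTo n (λ i → p i + total c (map (parts i) l))
          ≡⟨ cong₂ (λ s t → a + s + t) (total-map c stars l) (trans (sumTo-+ n p _) (cong (sumTo n p +_) (sumTo-cong n (λ i → total-map c (parts i) l)))) ⟩
        a + total (c ∘ stars) l + (sumTo n p + sumTo n (λ i → total (c ∘ parts i) l))
          ≡⟨ cong (λ t → a + total (c ∘ stars) l + (sumTo n p + t)) (sym (total-sumTo n (λ v i → c (parts i v)) l)) ⟩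
        a + total (c ∘ stars) l + (sumTo n p + total (λ v → sumTo n (λ i → c (parts i v))) l)
          ≡⟨ +-interchange a _ _ _ ⟩
        a + sumTo n p + (total (c ∘ stars) l + total (λ v → sumTo n (λ i → c (parts i v))) l)
          ≡⟨ cong (a + sumTo n p +_) (sym (total-+ (c ∘ stars) (λ v → sumTo n (λ i → c (parts i v))) l)) ⟩
        a + sumTo n p + total (λ v → c (stars v) + sumTo n (λ i → c (parts i v))) l
          ≡⟨ cong (a + sumTo n p +_) (total-cong eqs) ⟩
        a + sumTo n p + total c l ∎
        where
        open ≡-Reasoning
        n = suc h
      sums′ : M′ + Σx (tab (suc h) l′) ≡ Λ
      sums′ = trans (cong (M′ +_) (total-tab proj₁ (suc h) l′)) (trans
        (regroup proj₁ M* Mₗ (All.map (λ x≤ → split-sum (suc κ) {N = suc h} (<⇒≤ k≤R) ≤-refl x≤) small))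
        (trans (cong (_+ Σx l) (split-sum (2 + κ) {N = suc h} k≤R ≤-refl M≤)) sums))
      value≤ : Z + Σy l ≤ Z′ + Σy (tab (suc h) l′)
      value≤ = ≤-trans (+-monoˡ-≤ (Σy l) covers) (≤-reflexive (sym (trans (cong (Z′ +_) (total-tab proj₂ (suc h) l′))
        (regroup proj₂ Z* Zₗ (All.map (λ p → split-sum (2 + κ) {N = suc h} k≤R ≤-refl (≤-trans (proj₁ p) M≤)) fits)))))
      q<h : suc q ≤ suc h
      q<h = s≤s (≤-trans (≤-trans (m≤m*n q R) (m≤n+m (q * R) s)) (<⇒≤ β<h))
      -- The full segment on `h` vertices is contained in `M`. As `h` exceeds `β`, which is at least
      -- `q * R`, it involves at least `suc q` vertices of colour 0.
      positive : ∀ i → i < suc q → 1 ≤ proj₁ (l′ i)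
      positive i i≤q = ≤-trans (positive-part h β<h) (≤-trans (slice-mono (2 + κ) k≤R i (m≤m+n (g h) z)) (m≤m+n (Mₗ i) _))
        where
        positive-part : ∀ h → β < h → 1 ≤ slice (2 + κ) R (g h) i
        positive-part (suc h₁) (s≤s β≤h₁) = ≤-trans
          (τ-pos (inj₂ κ<R₁) (others-low R (≤-trans (<⇒≤ k≤R) (≤-trans R≤β β≤h₁)) k≤R))
          (≤-reflexive (sym (trans (slice-boundary (suc κ) R₁ (suc h₁) i)
            (before-< _ (≤-trans i≤q (s≤s (fdiv-≥ R₁ (≤-trans (m≤n+m (q * R) s) β≤h₁))))))))

    conclude : ∀ {M Z l} → State M Z l → Bounded Z l
    conclude st = analyse st (inj₂ transpose)

  claim-acc : ∀ M Z l → Acc _<_ (M + Σx l) → Z ≤ Ψʳ M → Fits (suc κ) R M l → Z + Σy l ≤ Ψ (M + Σx l)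
  claim-acc M Z l (acc recurse) cap fits = go (locate {suc κ} feas (M + Σx l)) refl
    where
    rec : ∀ {Λ} → M + Σx l ≡ Λ → ∀ M Z l → M + Σx l < Λ → Z ≤ Ψʳ M → Fits (suc κ) R M l → Z + Σy l ≤ Ψ (M + Σx l)
    rec refl M′ Z′ l′ lt = claim-acc M′ Z′ l′ (recurse lt)
    go : ∀ {Λ} → Located (suc κ) r Λ → M + Σx l ≡ Λ → Z + Σy l ≤ Ψ (M + Σx l)
    go (located zero z z<) eq with () ← z<
    go (located (suc b₁) z z<) eq = subst (λ t → Z + Σy l ≤ Ψ t) (sym eq) (by-size (2 + b₁ ≤? r) (divide R b₁) refl)
      where
      Λ = f (suc b₁) + z
      high : Λ < f (2 + b₁)
      high = +-monoʳ-< (f (suc b₁)) z<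
      by-size : Dec (2 + b₁ ≤ r) → ∀ {b} → Divided R b → b ≡ b₁ → Z + Σy l ≤ Ψ Λ
      -- A segment of length `Λ` uses at most `r` vertices, so the coloured bound agrees there with
      -- the uncoloured one, for which the removed vertices are added by `cone`.
      by-size (yes b≤r) _ _ = begin
        Z + Σy l                        ≤⟨ cone-all (suc κ) l (≤-trans cap (ψ-uncolour (suc κ) feasʳ M))
                                             (All.map (λ p → proj₁ p , ≤-trans (proj₂ p) (ψ-uncolour κ feas′ _)) fits) ⟩
        ψ (suc κ) 0 (M + Σx l)          ≡⟨ cong (ψ (suc κ) 0) eq ⟩
        ψ (suc κ) 0 Λ                   ≡⟨ sym (ψ-clique (suc κ) b≤r (<⇒≤ high)) ⟩
        Ψ Λ                             ∎
        where open ≤-Reasoning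
      by-size (no b≰r) (divided q s s≤R) refl = Big.conclude Λ q s s≤R (≤-pred (≤-pred (≰⇒> b≰r))) (m≤m+n _ z) high (rec eq)
        (At.state eq cap fits)

  claim-suc : Claim (suc κ) R
  claim-suc M Z l = claim-acc M Z l (<-wellFounded _)

-- Induction on the number of colours. The step uses both set sizes with one colour less: the
-- smaller in links, the same size for the rest after an exchange of classes.
claim : ∀ κ R → Claim κ (suc R)
claim zero    R = claim-zero R
claim (suc κ) zero = claim-degenerate (s≤s z≤n)
claim (suc κ) (suc R₀) with κ <? suc R₀
... | yes κ<R = Compression.claim-suc κ (suc R₀) κ<R (claim κ R₀) (claim (suc κ) R₀)
... | no κ≮R = claim-degenerate (s≤s (≮⇒≥ κ≮R))

-- Cliques in graphs

filterᵇ-comm : {A : Set} (p q : A → Bool) (l : List A) → filterᵇ p (filterᵇ q l) ≡ filterᵇ q (filterᵇ p l)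
filterᵇ-comm p q [] = refl
filterᵇ-comm p q (x ∷ l) with p x in ep | q x in eq
... | true  | true  rewrite ep | eq = cong (x ∷_) (filterᵇ-comm p q l)
... | true  | false rewrite eq = filterᵇ-comm p q l
... | false | true  rewrite ep = filterᵇ-comm p q l
... | false | false = filterᵇ-comm p q l

separate : {A : Set} (p : A → Bool) (l : List A) → l ↭ filterᵇ (not ∘ p) l ++ filterᵇ p l
separate p [] = ↭-refl
separate p (x ∷ l) with p x
... | true  = ↭-trans (prep x (separate p l)) (↭-sym (shift x _ _))
... | false = prep x (separate p l)

argmax : {A : Set} (φ : A → ℕ) (v : A) (l : List A) → ∃[ w ] w ∈ v ∷ l × All (λ u → φ u ≤ φ w) (v ∷ l)
argmax φ v [] = v , here refl , ≤-refl ∷ []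
argmax φ v (u ∷ l) with argmax φ u l
... | w , w∈ , top with ≤-total (φ v) (φ w)
...   | inj₁ v≤w = w , there w∈ , v≤w ∷ top
...   | inj₂ w≤v = v , here refl , ≤-refl ∷ All.map (λ u≤w → ≤-trans u≤w w≤v) top

module Graphs {A : Set} (adj : A → A → Bool) (adj-sym : ∀ u v → adj u v ≡ adj v u) where

  nbrs : A → List A → List A
  nbrs v = filterᵇ (adj v)

  -- A clique is counted at its first vertex in the list, within the neighbours that follow.
  cl : ℕ → List A → ℕ
  cl zero    l       = 1
  cl (suc j) []      = 0
  cl (suc j) (v ∷ l) = cl (suc j) l + cl j (nbrs v l)

  cl-↭ : ∀ j {l l′} → l ↭ l′ → cl j l ≡ cl j l′
  cl-↭ zero    _ = refl
  cl-↭ (suc j) Perm.refl = refl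
  cl-↭ (suc j) (prep v p) = cong₂ _+_ (cl-↭ (suc j) p) (cl-↭ j (filter-↭ (T? ∘ adj v) p))
  cl-↭ (suc j) (Perm.trans p q) = trans (cl-↭ (suc j) p) (cl-↭ (suc j) q)
  cl-↭ (suc j) (swap {l} {l′} u v p) = begin
    cl (suc j) l + cl j (nbrs v l) + cl j (nbrs u (v ∷ l))
      ≡⟨ exchange j l ⟩
    cl (suc j) l + cl j (nbrs u l) + cl j (nbrs v (u ∷ l))
      ≡⟨ cong₂ _+_ (cong₂ _+_ (cl-↭ (suc j) p) (cl-↭ j (filter-↭ (T? ∘ adj u) p))) (cl-↭ j (filter-↭ (T? ∘ adj v) (prep u p))) ⟩
    cl (suc j) l′ + cl j (nbrs u l′) + cl j (nbrs v (u ∷ l′)) ∎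
    where
    open ≡-Reasoning
    exchange : ∀ j l → cl (suc j) l + cl j (nbrs v l) + cl j (nbrs u (v ∷ l)) ≡
                       cl (suc j) l + cl j (nbrs u l) + cl j (nbrs v (u ∷ l))
    exchange zero l = refl
    exchange (suc j) l rewrite adj-sym v u with adj u v
    ... | false = lin 3 (λ a b c → [] ⊢ a :+ b :+ c :≡ a :+ c :+ b) refl (cl (2 + j) l) (cl (suc j) (nbrs v l)) (cl (suc j) (nbrs u l))
    ... | true rewrite filterᵇ-comm (adj v) (adj u) l =
      lin 4 (λ a b c d → [] ⊢ a :+ b :+ (c :+ d) :≡ a :+ c :+ (b :+ d)) refl
        (cl (2 + j) l) (cl (suc j) (nbrs v l)) (cl (suc j) (nbrs u l)) (cl j (nbrs u (nbrs v l)))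

  nbrs-⊆ : ∀ v {l l′} → l ⊆ l′ → nbrs v l ⊆ nbrs v l′
  nbrs-⊆ v s = filter⁺ (T? ∘ adj v) (T? ∘ adj v) (λ { refl t → t }) s

  cl-⊆ : ∀ j {l l′} → l ⊆ l′ → cl j l ≤ cl j l′
  cl-⊆ zero    _          = ≤-refl
  cl-⊆ (suc j) []         = ≤-refl
  cl-⊆ (suc j) (v ∷ʳ s)   = ≤-trans (cl-⊆ (suc j) s) (m≤m+n _ _)
  cl-⊆ (suc j) (_∷_ {x = v} refl s) = +-mono-≤ (cl-⊆ (suc j) s) (cl-⊆ j (nbrs-⊆ v s))

  cl-vanish : ∀ j l → cl j l ≡ 0 → cl (suc j) l ≡ 0
  cl-vanish zero    l       ()
  cl-vanish (suc j) []      _ = refl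
  cl-vanish (suc j) (v ∷ l) e = cong₂ _+_ (cl-vanish (suc j) l (m+n≡0⇒m≡0 _ e))
    (cl-vanish j (nbrs v l) (m+n≡0⇒n≡0 (cl (suc j) l) e))

  cl-vanish-≥ : ∀ {i j} l → i ≤ j → cl i l ≡ 0 → cl j l ≡ 0
  cl-vanish-≥ {i} {j} l i≤j e with m≤n⇒m<n∨m≡n i≤j
  ... | inj₂ refl = e
  cl-vanish-≥ {i} {suc j} l i≤j e | inj₁ (s≤s i≤j′) = cl-vanish j l (cl-vanish-≥ l i≤j′ e)

  -- Each vertex of `W` sees only what follows it, which is why the totals are exact even if `W`
  -- contains edges.
  links : ℕ → List A → List A → List Vertex
  links κ []      K = []
  links κ (u ∷ W) K = (cl κ (nbrs u (W ++ K)) , cl (suc κ) (nbrs u (W ++ K))) ∷ links κ W K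

  cl-links : ∀ κ W K → cl (suc κ) (W ++ K) ≡ cl (suc κ) K + Σx (links κ W K)
  cl-links κ []      K = sym (+-identityʳ _)
  cl-links κ (u ∷ W) K = trans (cong (_+ cl κ (nbrs u (W ++ K))) (cl-links κ W K))
    (lin 3 (λ a b c → [] ⊢ a :+ b :+ c :≡ a :+ (c :+ b)) refl (cl (suc κ) K) (Σx (links κ W K)) (cl κ (nbrs u (W ++ K))))

  cl-links₊ : ∀ κ W K → cl (2 + κ) (W ++ K) ≡ cl (2 + κ) K + Σy (links κ W K)
  cl-links₊ κ []      K = sym (+-identityʳ _)
  cl-links₊ κ (u ∷ W) K = trans (cong (_+ cl (suc κ) (nbrs u (W ++ K))) (cl-links₊ κ W K))
    (lin 3 (λ a b c → [] ⊢ a :+ b :+ c :≡ a :+ (c :+ b)) refl (cl (2 + κ) K) (Σy (links κ W K)) (cl (suc κ) (nbrs u (W ++ K))))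

  -- The cliques in the link of the new vertex are cliques of the old graph, which is the hypothesis
  -- `y ≤ X` of `cone`.
  kruskal-katona : ∀ κ l → cl (2 + κ) l ≤ ψ κ 0 (cl (suc κ) l)
  kruskal-katona κ [] = z≤n
  kruskal-katona κ (v ∷ l) = ≤-trans (+-monoˡ-≤ _ (kruskal-katona κ l))
    (cone κ (cl-⊆ (suc κ) (filter-⊆ (T? ∘ adj v) l)) (supported κ))
    where
    supported : ∀ κ → Supports κ 0 (cl κ (nbrs v l)) (cl (suc κ) (nbrs v l))
    supported zero    ()
    supported (suc κ) = kruskal-katona κ (nbrs v l)

  module _ (adj-irrefl : ∀ v → adj v v ≡ false) where

    nbrs-cl : ∀ j {v l} → v ∈ l → cl j (nbrs v l) ≤ cl (suc j) l
    nbrs-cl j {v} v∈l with ∈-∃++ v∈l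
    ... | xs , ys , refl = ≤-trans (≤-reflexive (trans (cl-↭ j (filter-↭ (T? ∘ adj v) moved)) (cong (cl j) loop)))
      (≤-trans (m≤n+m _ (cl (suc j) (xs ++ ys))) (≤-reflexive (sym (cl-↭ (suc j) moved))))
      where
      moved : xs ++ v ∷ ys ↭ v ∷ xs ++ ys
      moved = shift v xs ys
      loop : nbrs v (v ∷ xs ++ ys) ≡ nbrs v (xs ++ ys)
      loop rewrite adj-irrefl v = refl

    -- The colour class removed is the set of non-neighbours of a vertex whose
    -- neighbourhood contains the largest number of (κ + 1)-cliques.
    coloured-bound : ∀ R κ l → cl (2 + R) l ≡ 0 → cl (2 + κ) l ≤ ψ κ (suc R) (cl (suc κ) l)
    coloured-bound R κ l ω≤ with R ≤? κ
    ... | yes R≤κ = ≤-trans (≤-reflexive (cl-vanish-≥ l (s≤s (s≤s R≤κ)) ω≤)) z≤n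
    coloured-bound R       κ []      ω≤ | no _ = z≤n
    coloured-bound zero    κ (v ∷ l) ω≤ | no R≰κ = ⊥-elim (R≰κ z≤n)
    coloured-bound (suc R) κ (v₀ ∷ l₀) ω≤ | no R≰κ with argmax (λ u → cl (suc κ) (nbrs u (v₀ ∷ l₀))) v₀ l₀
    ... | v , v∈ , top = begin
      cl (2 + κ) l                                        ≡⟨ cl-↭ (2 + κ) (separate (adj v) l) ⟩
      cl (2 + κ) (W ++ N)                                 ≡⟨ cl-links₊ κ W N ⟩
      cl (2 + κ) N + Σy (links κ W N)                     ≤⟨ claim κ R (cl (suc κ) N) (cl (2 + κ) N) (links κ W N)
                                                               (coloured-bound R κ N (n≤0⇒n≡0 (≤-trans (nbrs-cl (2 + R) v∈) (≤-reflexive ω≤))))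
                                                               (fits W ⊆-refl (All-resp-↭ (separate (adj v) l) top)) ⟩
      ψ κ (2 + R) (cl (suc κ) N + Σx (links κ W N))       ≡⟨ cong (ψ κ (2 + R)) (sym (cl-links κ W N)) ⟩
      ψ κ (2 + R) (cl (suc κ) (W ++ N))                   ≡⟨ cong (ψ κ (2 + R)) (sym (cl-↭ (suc κ) (separate (adj v) l))) ⟩
      ψ κ (2 + R) (cl (suc κ) l)                          ∎
      where
      open ≤-Reasoning
      l = v₀ ∷ l₀
      N = nbrs v l
      W = filterᵇ (not ∘ adj v) l
      supported : ∀ κ u L → u ∷ L ⊆ W ++ N → Supports κ (suc R) (cl κ (nbrs u L)) (cl (suc κ) (nbrs u L))
      supported zero    u L _ ()
      supported (suc κ) u L s = coloured-bound R κ (nbrs u L) (n≤0⇒n≡0 (≤-trans (m≤n+m _ (cl (3 + R) L))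
        (≤-trans (cl-⊆ (3 + R) s) (≤-reflexive (trans (sym (cl-↭ (3 + R) (separate (adj v) l))) ω≤)))))
      -- The truncated links are contained in full neighbourhoods, to which the maximality of `v`
      -- applies.
      fits : ∀ W′ → W′ ++ N ⊆ W ++ N → All (λ u → cl (suc κ) (nbrs u l) ≤ cl (suc κ) N) (W′ ++ N) →
        Fits κ (suc R) (cl (suc κ) N) (links κ W′ N)
      fits []       _ _ = []
      fits (u ∷ W′) s (top-u ∷ top′) =
        (≤-trans (cl-⊆ (suc κ) (nbrs-⊆ u (⊆-weaken s))) (≤-trans (≤-reflexive (sym (cl-↭ (suc κ) (filter-↭ (T? ∘ adj u) (separate (adj v) l))))) top-u) ,
         supported κ u (W′ ++ N) s) ∷ fits W′ (⊆-weaken s) top′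
        where
        ⊆-weaken : ∀ {x xs ys} → x ∷ xs ⊆ ys → xs ⊆ ys
        ⊆-weaken = ⊆-trans (_ ∷ʳ ⊆-refl)

  Clique : List A → Set
  Clique = AllPairs (λ u v → T (adj u v))

  nbrs-all : ∀ {v K} → All (λ u → T (adj v u)) K → nbrs v K ≡ K
  nbrs-all {v} = filter-all (T? ∘ adj v)

  cl-clique : ∀ j {K} → Clique K → cl j K ≡ τ j (length K) 0
  cl-clique zero    _ = refl
  cl-clique (suc j) [] = refl
  cl-clique (suc j) {v ∷ K} (adjacent ∷ clique) = cong₂ _+_ (cl-clique (suc j) clique)
    (trans (cong (cl j) (nbrs-all adjacent)) (cl-clique j clique))

  record HasClique (j : ℕ) (l : List A) : Set where
    constructor hasClique
    field
      W K    : List A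
      splits : l ↭ W ++ K
      clique : Clique K
      size   : length K ≡ j

  clique-skip : ∀ {j l} v → HasClique j l → HasClique j (v ∷ l)
  clique-skip v (hasClique W K p c s) = hasClique (v ∷ W) K (prep v p) c s

  clique-extend : ∀ {j l} v → HasClique j (nbrs v l) → HasClique (suc j) (v ∷ l)
  clique-extend {l = l} v (hasClique W K p c s) = hasClique (X ++ W) (v ∷ K)
    (↭-trans (prep v (↭-trans (separate (adj v) l) (↭-trans (↭-++⁺ˡ X p) (Perm.↭-reflexive (sym (++-assoc X W K))))))
             (↭-sym (shift v (X ++ W) K)))
    (AllP.++⁻ʳ W (All-resp-↭ p (AllP.all-filter (T? ∘ adj v) l)) ∷ c) (cong suc s)
    where X = filterᵇ (not ∘ adj v) l

  find-clique : ∀ j l → cl j l ≢ 0 → HasClique j l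
  find-clique zero    l       _  = hasClique l [] (++-comm [] l) [] refl
  find-clique (suc j) []      ≢0 = ⊥-elim (≢0 refl)
  find-clique (suc j) (v ∷ l) ≢0 = nonzero-sum ≢0
    (λ ≢0′ → clique-skip v (find-clique (suc j) l ≢0′))
    (λ ≢0′ → clique-extend v (find-clique j (nbrs v l) ≢0′))
    where
    nonzero-sum : ∀ {a b} {X : Set} → a + b ≢ 0 → (a ≢ 0 → X) → (b ≢ 0 → X) → X
    nonzero-sum {zero}  b≢0 f g = g b≢0
    nonzero-sum {suc a} _   f g = f (λ ())

  -- A clique of the filtered list that is not inside `K` is a clique of `W ++ K` that is not inside
  -- `K`. With `p` the adjacency to a new vertex, this bounds its link by the cliques created
  -- before.
  cl-filter-≤ : ∀ j p W K → cl j (filterᵇ p (W ++ K)) + cl j K ≤ cl j (W ++ K) + cl j (filterᵇ p K)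
  cl-filter-≤ zero    p W K = ≤-refl
  cl-filter-≤ (suc j) p [] K = ≤-reflexive (+-comm (cl (suc j) (filterᵇ p K)) _)
  cl-filter-≤ (suc j) p (w ∷ W) K with p w
  ... | false = ≤-trans (cl-filter-≤ (suc j) p W K)
    (+-monoˡ-≤ _ (m≤m+n (cl (suc j) (W ++ K)) _))
  ... | true = lin 6 (λ F x k L y q → F :+ k :≤ L :+ q ∷ x :≤ y ∷ [] ⊢ F :+ x :+ k :≤ L :+ y :+ q) refl
    (cl (suc j) (filterᵇ p (W ++ K))) (cl j (nbrs w (filterᵇ p (W ++ K)))) (cl (suc j) K)
    (cl (suc j) (W ++ K)) (cl j (nbrs w (W ++ K))) (cl (suc j) (filterᵇ p K))
    (cl-filter-≤ (suc j) p W K) (cl-⊆ j (nbrs-⊆ w (filter-⊆ (T? ∘ p) (W ++ K))))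

-- Y is at most the value obtained when the X cliques are collected in one link, or
-- in one link of N and another of X - N cliques once X exceeds N.
Arranged : ℕ → ℕ → ℕ → ℕ → Set
Arranged κ n X Y = (X ≤ N → Y ≤ ψ κ 0 X) × (N ≤ X → Y ≤ ψ κ 0 N + ψ κ 0 (X ∸ N))
  where N = τ (suc κ) n 0

-- Away from the threshold `N`, superadditivity merges the new link with the earlier ones. If `N` is
-- crossed with `x ≤ N`, the window property fills one link. If `x ≥ N`, the new link is itself the
-- full one, and `cone` joins its excess to the earlier cliques, by virtue of the bound of `y`
-- through `X`.
arranged-step : ∀ κ n {X Y x y} → Arranged κ n X Y → y ≤ ψ κ 0 x → y ≤ τ (2 + κ) n 0 + X →
  X + x < τ (suc κ) (suc n) 0 → Arranged κ n (X + x) (Y + y)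
arranged-step κ n {X} {Y} {x} {y} (below , above) y≤ y≤X bound = within , beyond
  where
  open ≤-Reasoning
  f = ψ κ 0
  N = τ (suc κ) n 0
  super : ∀ a b → f a + f b ≤ f (a + b)
  super = superadditive κ (inj₁ refl)
  within : X + x ≤ N → Y + y ≤ f (X + x)
  within le = ≤-trans (+-mono-≤ (below (≤-trans (m≤m+n X x) le)) y≤) (super X x)
  beyond : N ≤ X + x → Y + y ≤ f N + f (X + x ∸ N)
  beyond le with ≤-total N X
  ... | inj₁ N≤X = begin
    Y + y                              ≤⟨ +-mono-≤ (above N≤X) y≤ ⟩
    f N + f (X ∸ N) + f x              ≡⟨ +-assoc (f N) _ _ ⟩
    f N + (f (X ∸ N) + f x)            ≤⟨ +-monoʳ-≤ (f N) (super (X ∸ N) x) ⟩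
    f N + f (X ∸ N + x)                ≡⟨ cong (λ t → f N + f t) (sym (+-∸-comm x N≤X)) ⟩
    f N + f (X + x ∸ N)                ∎
  ... | inj₂ X≤N with ≤-total x N
  ...   | inj₁ x≤N = ≤-trans (+-mono-≤ (below X≤N) y≤)
    (windowed κ (inj₁ refl) n X≤N x≤N (sym (m+[n∸m]≡n le)))
  ...   | inj₂ N≤x = begin
    Y + y                              ≤⟨ +-mono-≤ (below X≤N) (m≤n+m∸n y (f N)) ⟩
    f X + (f N + γ)                    ≡⟨ lin 3 (λ a b c → [] ⊢ a :+ (b :+ c) :≡ b :+ (a :+ c)) refl (f X) (f N) γ ⟩
    f N + (f X + γ)                    ≤⟨ +-monoʳ-≤ (f N) (cone κ γ≤X supported) ⟩
    f N + f (X + δ)                    ≡⟨ cong (λ t → f N + f t) (sym (+-∸-assoc X N≤x)) ⟩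
    f N + f (X + x ∸ N)                ∎
    where
    γ = y ∸ f N
    δ = x ∸ N
    fN≡ : f N ≡ τ (2 + κ) n 0
    fN≡ = ψ-boundary κ 0 n
    γ≤X : γ ≤ X
    γ≤X = ≤-trans (∸-monoˡ-≤ (f N) (≤-trans y≤X (≤-reflexive (cong (_+ X) (sym fN≡))))) (≤-reflexive (m+n∸m≡n (f N) X))
    xδ : N + δ ≡ x
    xδ = m+[n∸m]≡n N≤x
    δ≤ : δ ≤ block κ 0 n
    δ≤ = lin 5 (λ N δ x X E → N :+ δ :≡ x ∷ X :+ x :< N :+ E ∷ [] ⊢ δ :≤ E) refl N δ x X (τ κ n 0) xδ bound
    supported : Supports κ 0 δ γ
    supported = subst (λ t → Supports κ 0 δ (y ∸ t)) (sym fN≡)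
      (supports-link κ 0 n δ≤ (≤-trans y≤ (≤-reflexive (cong f (sym xδ)))))

module _ {A : Set} (adj : A → A → Bool) (adj-sym : ∀ u v → adj u v ≡ adj v u) where
  open Graphs adj adj-sym

  clique-bound : ∀ κ n ρ {W K} → Clique K → Σx (links (suc κ) W K) ≡ τ (suc κ) n 0 + ρ → ρ < τ κ n 0 →
    Σy (links (suc κ) W K) ≤ τ (2 + κ) n 0 + ψ κ 0 ρ
  clique-bound κ n ρ {W} {K} clique total≡ ρ< = ≤-trans
    (proj₂ (arranged W (≤-reflexive total≡)) (≤-trans (m≤m+n N ρ) (≤-reflexive (sym total≡))))
    (≤-reflexive (cong₂ (λ a b → a + ψ κ 0 b) (ψ-boundary κ 0 n) (trans (cong (_∸ N) total≡) (m+n∸m≡n N ρ))))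
    where
    N = τ (suc κ) n 0
    arranged : ∀ W → Σx (links (suc κ) W K) ≤ N + ρ →
      Arranged κ n (Σx (links (suc κ) W K)) (Σy (links (suc κ) W K))
    arranged [] _ = (λ _ → z≤n) , (λ _ → z≤n)
    arranged (u ∷ W) le = subst₂ (Arranged κ n) (+-comm X x) (+-comm (Σy (links (suc κ) W K)) y)
      (arranged-step κ n (arranged W (≤-trans (m≤n+m X x) le)) (kruskal-katona κ (nbrs u (W ++ K))) y≤
        (subst (_< τ (suc κ) (suc n) 0) (+-comm x X) le′))
      where
      X = Σx (links (suc κ) W K)
      x = cl (suc κ) (nbrs u (W ++ K))
      y = cl (2 + κ) (nbrs u (W ++ K))
      le′ : x + X < τ (suc κ) (suc n) 0
      le′ = ≤-<-trans le (+-monoʳ-< N ρ<)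
      clique′ : Clique (nbrs u K)
      clique′ = AllPairsP.filter⁺ (T? ∘ adj u) clique
      -- More than `n` neighbours in the clique `K` would put at least `τ (suc κ) (suc n) 0` cliques
      -- into this one link.
      few : length (nbrs u K) ≤ n
      few = ≤-pred (τ-cancel-< (suc κ) 0 (≤-<-trans (≤-trans (≤-reflexive (sym (cl-clique (suc κ) clique′)))
        (≤-trans (cl-⊆ (suc κ) (nbrs-⊆ u (⊆-++⁺ˡ W ⊆-refl))) (m≤m+n x X))) le′))
      y≤ : y ≤ τ (2 + κ) n 0 + X
      y≤ = lin 5 (λ y k a X t → y :+ k :≤ k :+ X :+ a ∷ a :≤ t ∷ [] ⊢ y :≤ t :+ X) refl
        y (cl (2 + κ) K) (cl (2 + κ) (nbrs u K)) X (τ (2 + κ) n 0)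
        (≤-trans (cl-filter-≤ (2 + κ) (adj u) W K) (≤-reflexive (cong (_+ cl (2 + κ) (nbrs u K)) (cl-links (suc κ) W K))))
        (≤-trans (≤-reflexive (cl-clique (2 + κ) clique′)) (τ-mono (2 + κ) 0 few))

-- Counting cliques through subsets

T-ext : ∀ {a b} → (T a → T b) → (T b → T a) → a ≡ b
T-ext {false} {false} f g = refl
T-ext {false} {true}  f g = ⊥-elim (g tt)
T-ext {true}  {false} f g = ⊥-elim (f tt)
T-ext {true}  {true}  f g = refl

memb-all : ∀ {n} → (Fin n → Bool) → Subset n → Bool
memb-all P []            = true
memb-all P (inside  ∷ S) = P zero ∧ memb-all (P ∘ suc) S
memb-all P (outside ∷ S) = memb-all (P ∘ suc) S

memb-all-elim : ∀ {n} (P : Fin n → Bool) S → T (memb-all P S) → ∀ u → T (memb u S) → T (P u)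
memb-all-elim P (inside  ∷ S) t zero    _  = proj₁ (Equivalence.to (T-∧ {P zero}) t)
memb-all-elim P (inside  ∷ S) t (suc u) u∈ = memb-all-elim (P ∘ suc) S (proj₂ (Equivalence.to (T-∧ {P zero}) t)) u u∈
memb-all-elim P (outside ∷ S) t (suc u) u∈ = memb-all-elim (P ∘ suc) S t u u∈

memb-all-intro : ∀ {n} (P : Fin n → Bool) S → (∀ u → T (memb u S) → T (P u)) → T (memb-all P S)
memb-all-intro P []            f = tt
memb-all-intro P (inside  ∷ S) f = Equivalence.from (T-∧ {P zero}) (f zero tt , memb-all-intro (P ∘ suc) S (f ∘ suc))
memb-all-intro P (outside ∷ S) f = memb-all-intro (P ∘ suc) S (f ∘ suc)

memb-all-∧ : ∀ {n} (P Q : Fin n → Bool) S → memb-all (λ u → P u ∧ Q u) S ≡ memb-all P S ∧ memb-all Q S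
memb-all-∧ P Q []            = refl
memb-all-∧ P Q (inside  ∷ S) = trans (cong ((P zero ∧ Q zero) ∧_) (memb-all-∧ (P ∘ suc) (Q ∘ suc) S))
  (interchange (P zero) (Q zero) _ _)
  where
  interchange : ∀ a b c d → (a ∧ b) ∧ (c ∧ d) ≡ (a ∧ c) ∧ (b ∧ d)
  interchange false b c d = refl
  interchange true false false d = refl
  interchange true false true d = refl
  interchange true true c d = refl
memb-all-∧ P Q (outside ∷ S) = memb-all-∧ (P ∘ suc) (Q ∘ suc) S

memb-all-true : ∀ {n} (S : Subset n) → memb-all (λ _ → true) S ≡ true
memb-all-true []            = refl
memb-all-true (inside  ∷ S) = memb-all-true S
memb-all-true (outside ∷ S) = memb-all-true S

IsClique : ∀ {n} → (Fin n → Fin n → Bool) → Subset n → Set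
IsClique a S = ∀ u v → T (memb u S) → T (memb v S) → u ≢ v → T (a u v)

private
  clause-elim : ∀ m n e b → T (not (m ∧ n ∧ not e) ∨ b) → T m → T n → ¬ T e → T b
  clause-elim true true false b t _ _ _ = t
  clause-elim true true true  b t _ _ ¬e = ⊥-elim (¬e tt)

  clause-intro : ∀ m n e b → (T m → T n → ¬ T e → T b) → T (not (m ∧ n ∧ not e) ∨ b)
  clause-intro false n     e     b f = tt
  clause-intro true  false e     b f = tt
  clause-intro true  true  true  b f = tt
  clause-intro true  true  false b f = f tt tt (λ ())

isClique-elim : ∀ {n} (a : Fin n → Fin n → Bool) S → T (isClique a S) → IsClique a S
isClique-elim {n} a S t u v u∈ v∈ u≢v = clause-elim (memb u S) (memb v S) (finEq u v) (a u v)
  (AllP.tabulate⁻ (AllP.all⁺ _ (allFin n) (AllP.tabulate⁻ (AllP.all⁺ _ (allFin n) t) u)) v)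
  u∈ v∈ (λ e → u≢v (toℕ-injective (≡ᵇ⇒≡ _ _ e)))

isClique-intro : ∀ {n} (a : Fin n → Fin n → Bool) S → IsClique a S → T (isClique a S)
isClique-intro {n} a S c = AllP.all⁻ _ (AllP.tabulate⁺ λ u → AllP.all⁻ _ (AllP.tabulate⁺ λ v →
  clause-intro (memb u S) (memb v S) (finEq u v) (a u v)
    (λ u∈ v∈ u≠v → c u v u∈ v∈ (λ { refl → u≠v (≡⇒≡ᵇ (toℕ u) (toℕ u) refl) }))))

suc≢ : ∀ {n} {u v : Fin n} → u ≢ v → suc u ≢ suc v
suc≢ u≢v refl = u≢v refl

isClique-outside : ∀ {n} (a : Fin (suc n) → Fin (suc n) → Bool) S →
  isClique a (outside ∷ S) ≡ isClique (λ u v → a (suc u) (suc v)) S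
isClique-outside a S = T-ext
  (λ t → isClique-intro _ S (λ u v u∈ v∈ u≢v → isClique-elim a (outside ∷ S) t (suc u) (suc v) u∈ v∈ (suc≢ u≢v)))
  (λ t → isClique-intro a (outside ∷ S) (λ { (suc u) (suc v) u∈ v∈ u≢v →
    isClique-elim _ S t u v u∈ v∈ (λ { refl → u≢v refl }) }))

isClique-inside : ∀ {n} (a : Fin (suc n) → Fin (suc n) → Bool) → (∀ u v → a u v ≡ a v u) → ∀ S →
  isClique a (inside ∷ S) ≡ isClique (λ u v → a (suc u) (suc v)) S ∧ memb-all (a zero ∘ suc) S
isClique-inside a a-sym S = T-ext
  (λ t → Equivalence.from (T-∧ {isClique _ S})
    ( isClique-intro _ S (λ u v u∈ v∈ u≢v → isClique-elim a (inside ∷ S) t (suc u) (suc v) u∈ v∈ (suc≢ u≢v))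
    , memb-all-intro (a zero ∘ suc) S (λ u u∈ → isClique-elim a (inside ∷ S) t zero (suc u) tt u∈ (λ ()))))
  (λ t → let t₁ , t₂ = Equivalence.to (T-∧ {isClique _ S}) t in
    isClique-intro a (inside ∷ S) (λ
      { zero    zero    _  _  u≢v → ⊥-elim (u≢v refl)
      ; zero    (suc v) _  v∈ _   → memb-all-elim (a zero ∘ suc) S t₂ v v∈
      ; (suc u) zero    u∈ _  _   → subst T (a-sym zero (suc u)) (memb-all-elim (a zero ∘ suc) S t₂ u u∈)
      ; (suc u) (suc v) u∈ v∈ u≢v → isClique-elim _ S t₁ u v u∈ v∈ (λ { refl → u≢v refl }) }))

number : {A : Set} → (A → Bool) → List A → ℕ
number p l = length (filterᵇ p l)

number-cong : {A : Set} {p q : A → Bool} → (∀ x → p x ≡ q x) → ∀ l → number p l ≡ number q l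
number-cong e [] = refl
number-cong {p = p} {q} e (x ∷ l) with p x | q x | e x
... | true  | true  | refl = cong suc (number-cong e l)
... | false | false | refl = number-cong e l

number-none : {A : Set} (l : List A) → number (λ _ → false) l ≡ 0
number-none []      = refl
number-none (x ∷ l) = number-none l

number-map : {A B : Set} (p : B → Bool) (f : A → B) (l : List A) → number p (map f l) ≡ number (p ∘ f) l
number-map p f [] = refl
number-map p f (x ∷ l) with p (f x)
... | true  = cong suc (number-map p f l)
... | false = number-map p f l

number-++ : {A : Set} (p : A → Bool) (l l′ : List A) → number p (l ++ l′) ≡ number p l + number p l′
number-++ p l l′ = trans (cong length (filter-++ (T? ∘ p) l l′)) (length-++ (filterᵇ p l))

filterᵇ-map : {A B : Set} (p : B → Bool) (f : A → B) (l : List A) → filterᵇ p (map f l) ≡ map f (filterᵇ (p ∘ f) l)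
filterᵇ-map p f [] = refl
filterᵇ-map p f (x ∷ l) with p (f x)
... | true  = cong (f x ∷_) (filterᵇ-map p f l)
... | false = filterᵇ-map p f l

filterᵇ-∧ : {A : Set} (p q : A → Bool) (l : List A) → filterᵇ q (filterᵇ p l) ≡ filterᵇ (λ x → p x ∧ q x) l
filterᵇ-∧ p q [] = refl
filterᵇ-∧ p q (x ∷ l) with p x
... | false = filterᵇ-∧ p q l
... | true with q x
...   | true  = cong (x ∷_) (filterᵇ-∧ p q l)
...   | false = filterᵇ-∧ p q l

filterᵇ-accept : {A : Set} (p : A → Bool) {x : A} {l : List A} → p x ≡ true → filterᵇ p (x ∷ l) ≡ x ∷ filterᵇ p l
filterᵇ-accept p e rewrite e = refl

filterᵇ-reject : {A : Set} (p : A → Bool) {x : A} {l : List A} → p x ≡ false → filterᵇ p (x ∷ l) ≡ filterᵇ p l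
filterᵇ-reject p e rewrite e = refl

filterᵇ-true : {A : Set} (l : List A) → filterᵇ (λ _ → true) l ≡ l
filterᵇ-true []      = refl
filterᵇ-true (x ∷ l) = cong (x ∷_) (filterᵇ-true l)

cl-map : {A B : Set} (adj : B → B → Bool) (s : ∀ u v → adj u v ≡ adj v u) (f : A → B) (j : ℕ) (l : List A) →
  Graphs.cl adj s j (map f l) ≡ Graphs.cl (λ u v → adj (f u) (f v)) (λ u v → s (f u) (f v)) j l
cl-map adj s f zero    l = refl
cl-map adj s f (suc j) [] = refl
cl-map adj s f (suc j) (v ∷ l) = cong₂ _+_ (cl-map adj s f (suc j) l)
  (trans (cong (Graphs.cl adj s j) (filterᵇ-map (adj (f v)) f l)) (cl-map adj s f j _))

selected : ∀ {n} → (Fin n → Fin n → Bool) → (Fin n → Bool) → ℕ → Subset n → Bool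
selected a P j S = isClique a S ∧ (memb-all P S ∧ (∣ S ∣ ≡ᵇ j))

-- The predicate `P` is there for the induction: cliques through `zero` are cliques of the later
-- vertices that satisfy `P` and are adjacent to `zero`.
cl-select : ∀ n (a : Fin n → Fin n → Bool) (a-sym : ∀ u v → a u v ≡ a v u) (P : Fin n → Bool) j →
  number (selected a P j) (subsets n) ≡ Graphs.cl a a-sym j (filterᵇ P (allFin n))
cl-select zero    a a-sym P zero    = refl
cl-select zero    a a-sym P (suc j) = refl
cl-select (suc n) a a-sym P j = begin
  number (selected a P j) (map (inside ∷_) (subsets n) ++ map (outside ∷_) (subsets n))
    ≡⟨ number-++ (selected a P j) (map (inside ∷_) (subsets n)) _ ⟩
  number (selected a P j) (map (inside ∷_) (subsets n)) + number (selected a P j) (map (outside ∷_) (subsets n))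
    ≡⟨ cong₂ _+_ (number-map (selected a P j) (inside ∷_) (subsets n)) (number-map (selected a P j) (outside ∷_) (subsets n)) ⟩
  number (λ S → selected a P j (inside ∷ S)) (subsets n) + number (λ S → selected a P j (outside ∷ S)) (subsets n)
    ≡⟨ cong (number (λ S → selected a P j (inside ∷ S)) (subsets n) +_)
         (trans (number-cong (λ S → cong (_∧ (memb-all P′ S ∧ (∣ S ∣ ≡ᵇ j))) (isClique-outside a S)) (subsets n)) (cl-select n a′ a′-sym P′ j)) ⟩
  number (λ S → selected a P j (inside ∷ S)) (subsets n) + cl′ j (filterᵇ P′ (allFin n))
    ≡⟨ by-first j ⟩
  Graphs.cl a a-sym j (filterᵇ P (zero ∷ map suc (allFin n)))
    ≡⟨ cong (λ l → Graphs.cl a a-sym j (filterᵇ P (zero ∷ l))) (map-tabulate (λ i → i) suc) ⟩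
  Graphs.cl a a-sym j (filterᵇ P (allFin (suc n))) ∎
  where
  open ≡-Reasoning
  a′ : Fin n → Fin n → Bool
  a′ u v = a (suc u) (suc v)
  a′-sym : ∀ u v → a′ u v ≡ a′ v u
  a′-sym u v = a-sym (suc u) (suc v)
  P′ = P ∘ suc
  cl′ = Graphs.cl a′ a′-sym
  shifted : ∀ j → Graphs.cl a a-sym j (filterᵇ P (map suc (allFin n))) ≡ cl′ j (filterᵇ P′ (allFin n))
  shifted j = trans (cong (Graphs.cl a a-sym j) (filterᵇ-map P suc (allFin n))) (cl-map a a-sym suc j _)
  never : ∀ S → selected a P 0 (inside ∷ S) ≡ false
  never S with isClique a (inside ∷ S) | memb-all P (inside ∷ S)
  ... | false | _     = refl
  ... | true  | false = refl
  ... | true  | true  = refl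
  excluded : P zero ≡ false → ∀ j S → selected a P j (inside ∷ S) ≡ false
  excluded e j S rewrite e with isClique a (inside ∷ S)
  ... | false = refl
  ... | true  = refl
  included : P zero ≡ true → ∀ j S → selected a P (suc j) (inside ∷ S) ≡ selected a′ (λ u → P′ u ∧ a zero (suc u)) j S
  included e j S rewrite e | isClique-inside a a-sym S | memb-all-∧ P′ (a zero ∘ suc) S =
    rearrange (isClique a′ S) (memb-all (a zero ∘ suc) S) (memb-all P′ S) (∣ S ∣ ≡ᵇ j)
    where
    rearrange : ∀ x y z w → (x ∧ y) ∧ (z ∧ w) ≡ x ∧ ((z ∧ y) ∧ w)
    rearrange false y z w = refl
    rearrange true false false w = refl
    rearrange true false true  w = refl
    rearrange true true  z     w = cong (_∧ w) (∧-comm true z)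
  neighbours : ∀ j → number (selected a′ (λ u → P′ u ∧ a zero (suc u)) j) (subsets n) ≡
    Graphs.cl a a-sym j (filterᵇ (a zero) (filterᵇ P (map suc (allFin n))))
  neighbours j = begin
    number (selected a′ (λ u → P′ u ∧ a zero (suc u)) j) (subsets n)
      ≡⟨ cl-select n a′ a′-sym (λ u → P′ u ∧ a zero (suc u)) j ⟩
    cl′ j (filterᵇ (λ u → P′ u ∧ a zero (suc u)) (allFin n))
      ≡⟨ sym (cl-map a a-sym suc j _) ⟩
    Graphs.cl a a-sym j (map suc (filterᵇ (λ u → P′ u ∧ a zero (suc u)) (allFin n)))
      ≡⟨ cong (Graphs.cl a a-sym j) (sym (filterᵇ-map (λ u → P u ∧ a zero u) suc (allFin n))) ⟩
    Graphs.cl a a-sym j (filterᵇ (λ u → P u ∧ a zero u) (map suc (allFin n)))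
      ≡⟨ cong (Graphs.cl a a-sym j) (sym (filterᵇ-∧ P (a zero) (map suc (allFin n)))) ⟩
    Graphs.cl a a-sym j (filterᵇ (a zero) (filterᵇ P (map suc (allFin n)))) ∎
  by-first : ∀ j → number (λ S → selected a P j (inside ∷ S)) (subsets n) + cl′ j (filterᵇ P′ (allFin n)) ≡
    Graphs.cl a a-sym j (filterᵇ P (zero ∷ map suc (allFin n)))
  by-first zero = cong (_+ 1) (trans (number-cong never (subsets n)) (number-none (subsets n)))
  by-first (suc j) = by-value (P zero) refl
    where
    L = map suc (allFin n)
    by-value : ∀ b → P zero ≡ b → number (λ S → selected a P (suc j) (inside ∷ S)) (subsets n) + cl′ (suc j) (filterᵇ P′ (allFin n)) ≡
      Graphs.cl a a-sym (suc j) (filterᵇ P (zero ∷ L))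
    by-value false e = trans
      (cong₂ _+_ (trans (number-cong (excluded e (suc j)) (subsets n)) (number-none (subsets n))) (sym (shifted (suc j))))
      (cong (Graphs.cl a a-sym (suc j)) (sym (filterᵇ-reject P e)))
    by-value true e = trans
      (cong₂ _+_ (trans (number-cong (included e j) (subsets n)) (neighbours j)) (sym (shifted (suc j))))
      (trans (+-comm _ (Graphs.cl a a-sym (suc j) (filterᵇ P L))) (cong (Graphs.cl a a-sym (suc j)) (sym (filterᵇ-accept P e))))

cliqueCount-cl : ∀ n (a : Fin n → Fin n → Bool) (a-sym : ∀ u v → a u v ≡ a v u) j →
  cliqueCount n a j ≡ Graphs.cl a a-sym j (allFin n)
cliqueCount-cl n a a-sym j = trans
  (number-cong (λ S → cong (λ t → isClique a S ∧ (t ∧ (∣ S ∣ ≡ᵇ j))) (sym (memb-all-true S))) (subsets n))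
  (trans (cl-select n a a-sym (λ _ → true) j) (cong (Graphs.cl a a-sym j) (filterᵇ-true (allFin n))))

-- Turán numbers as elementary symmetric polynomials of the class sizes

symm : ℕ → (ℕ → ℕ) → ℕ → ℕ
symm r       f zero    = 1
symm zero    f (suc j) = 0
symm (suc r) f (suc j) = symm r f (suc j) + f r * symm r f j

symm-cong : ∀ r {f g} j → (∀ c → c < r → f c ≡ g c) → symm r f j ≡ symm r g j
symm-cong r       zero    e = refl
symm-cong zero    (suc j) e = refl
symm-cong (suc r) (suc j) e = cong₂ _+_ (symm-cong r (suc j) (λ c c<r → e c (m<n⇒m<1+n c<r)))
  (cong₂ _*_ (e r ≤-refl) (symm-cong r j (λ c c<r → e c (m<n⇒m<1+n c<r))))

-- An elementary symmetric polynomial is affine in each variable, with the slope obtained by setting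
-- that variable to zero, as `h` does.
symm-insert : ∀ r {f g h} v j → v < r → g v ≡ suc (f v) → h v ≡ 0 →
  (∀ c → c ≢ v → g c ≡ f c) → (∀ c → c ≢ v → h c ≡ f c) →
  symm r g (suc j) ≡ symm r f (suc j) + symm r h j
symm-insert (suc r) {f} {g} {h} v j v<r gv hv g≡ h≡ with m≤n⇒m<n∨m≡n v<r
... | inj₂ refl = begin
  symm r g (suc j) + g r * symm r g j               ≡⟨ cong₂ (λ x y → x + y) (same g g≡ (suc j)) (cong₂ _*_ gv (same g g≡ j)) ⟩
  symm r f (suc j) + (symm r f j + f r * symm r f j) ≡⟨ lin 3 (λ x y z → [] ⊢ x :+ (y :+ z) :≡ x :+ z :+ y) refl (symm r f (suc j)) (symm r f j) (f r * symm r f j) ⟩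
  symm r f (suc j) + f r * symm r f j + symm r f j   ≡⟨ cong (symm (suc r) f (suc j) +_) (sym (last j)) ⟩
  symm (suc r) f (suc j) + symm (suc r) h j          ∎
  where
  open ≡-Reasoning
  same : ∀ k → (∀ c → c ≢ r → k c ≡ f c) → ∀ j → symm r k j ≡ symm r f j
  same k k≡ j = symm-cong r j (λ c c<r → k≡ c (<⇒≢ c<r))
  last : ∀ j → symm (suc r) h j ≡ symm r f j
  last zero    = refl
  last (suc j) = trans (cong (symm r h (suc j) +_) (cong (_* symm r h j) hv)) (trans (+-identityʳ _) (same h h≡ (suc j)))
... | inj₁ (s≤s v<r′) = begin
  symm r g (suc j) + g r * symm r g j
    ≡⟨ cong₂ _+_ (symm-insert r v j v<r′ gv hv g≡ h≡) (cong (_* symm r g j) (g≡ r (≢-sym (<⇒≢ v<r′)))) ⟩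
  symm r f (suc j) + symm r h j + f r * symm r g j
    ≡⟨ lower j ⟩
  symm r f (suc j) + f r * symm r f j + symm (suc r) h j ∎
  where
  open ≡-Reasoning
  lower : ∀ j → symm r f (suc j) + symm r h j + f r * symm r g j ≡ symm r f (suc j) + f r * symm r f j + symm (suc r) h j
  lower zero = regroup (symm r f 1) (f r)
    where
    regroup : ∀ a b → a + 1 + b * 1 ≡ a + b * 1 + 1
    regroup = solve-∀
  lower (suc j) = trans (cong (λ t → symm r f (2 + j) + symm r h (suc j) + f r * t) (symm-insert r v j v<r′ gv hv g≡ h≡))
    (trans (regroup (symm r f (2 + j)) (symm r h (suc j)) (f r) (symm r f (suc j)) (symm r h j))
           (cong (λ t → symm r f (2 + j) + f r * symm r f (suc j) + (symm r h (suc j) + t * symm r h j)) (sym (h≡ r (≢-sym (<⇒≢ v<r′))))))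
    where
    regroup : ∀ a b c d e → a + b + c * (d + e) ≡ a + c * d + (b + c * e)
    regroup = solve-∀

differ : ℕ → ℕ → Bool
differ u v = not (u ≡ᵇ v)

≡ᵇ-sym : ∀ u v → (u ≡ᵇ v) ≡ (v ≡ᵇ u)
≡ᵇ-sym u v = T-ext (λ t → ≡⇒≡ᵇ v u (sym (≡ᵇ⇒≡ u v t))) (λ t → ≡⇒≡ᵇ u v (sym (≡ᵇ⇒≡ v u t)))

differ-sym : ∀ u v → differ u v ≡ differ v u
differ-sym u v = cong not (≡ᵇ-sym u v)

differ-≢ : ∀ {u v} → u ≢ v → differ u v ≡ true
differ-≢ {u} {v} u≢v with u ≡ᵇ v in e
... | false = refl
... | true  = ⊥-elim (u≢v (≡ᵇ⇒≡ u v (subst T (sym e) tt)))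

differ-refl : ∀ u → differ u u ≡ false
differ-refl u with u ≡ᵇ u in e
... | true  = refl
... | false = ⊥-elim (subst T e (≡⇒≡ᵇ u u refl))

occurrences : ℕ → List ℕ → ℕ
occurrences c = total (λ v → exactly c v 1)

module Colours = Graphs differ differ-sym

occurrences-same : ∀ v l → occurrences v (Colours.nbrs v l) ≡ 0
occurrences-same v [] = refl
occurrences-same v (w ∷ l) with v ≟ w
... | yes refl = trans (cong (occurrences v) (filterᵇ-reject (differ v) (differ-refl v))) (occurrences-same v l)
... | no v≢w = trans (cong (occurrences v) (filterᵇ-accept (differ v) (differ-≢ v≢w)))
  (cong₂ _+_ (exactly-≢ 1 v≢w) (occurrences-same v l))

occurrences-other : ∀ {c v} → c ≢ v → ∀ l → occurrences c (Colours.nbrs v l) ≡ occurrences c l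
occurrences-other c≢v [] = refl
occurrences-other {c} {v} c≢v (w ∷ l) with v ≟ w
... | yes refl = trans (cong (occurrences c) (filterᵇ-reject (differ v) (differ-refl v)))
  (trans (occurrences-other c≢v l) (cong (_+ occurrences c l) (sym (exactly-≢ 1 c≢v))))
... | no v≢w = trans (cong (occurrences c) (filterᵇ-accept (differ v) (differ-≢ v≢w)))
  (cong (exactly c w 1 +_) (occurrences-other c≢v l))

-- The neighbours of a vertex are those outside its class, so passing to its link sets one class
-- size to zero, and `symm-insert` matches the recursion of `cl`.
colours-symm : ∀ r j {l} → All (_< r) l → Colours.cl j l ≡ symm r (λ c → occurrences c l) j
colours-symm r zero    _ = refl
colours-symm r (suc j) [] = sym (vanish r j)
  where
  vanish : ∀ r j → symm r (λ _ → 0) (suc j) ≡ 0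
  vanish zero    j = refl
  vanish (suc r) j = trans (+-identityʳ _) (vanish r j)
colours-symm r (suc j) {v ∷ l} (v<r ∷ bounded) = trans
  (cong₂ _+_ (colours-symm r (suc j) bounded) (colours-symm r j (AllP.filter⁺ (T? ∘ differ v) bounded)))
  (sym (symm-insert r v j v<r (cong (_+ occurrences v l) (exactly-≡ v 1)) (occurrences-same v l)
    (λ c c≢v → cong (_+ occurrences c l) (exactly-≢ 1 c≢v)) (λ c c≢v → occurrences-other c≢v l)))

-- The last class, of `q` vertices, is split off by `τ-class`. The case `s = r`, with all classes of
-- size `q + 1`, is included because the recursion lowers `r` but not `s`.
symm-balanced : ∀ r q {s} j → s ≤ r → symm r (λ c → q + before c s 1) j ≡ τ j (s + q * r) r
symm-balanced r       q zero    s≤r = refl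
symm-balanced zero    q (suc j) z≤n = sym (cong (λ n → τ (suc j) n 0) (*-zeroʳ q))
symm-balanced (suc R) q {s} (suc j) s≤r with m≤n⇒m<n∨m≡n s≤r
... | inj₁ (s≤s s≤R) = step q s≤R
  where
  step : ∀ q {s} → s ≤ R → symm (suc R) (λ c → q + before c s 1) (suc j) ≡ τ (suc j) (s + q * suc R) (suc R)
  step q {s} s≤R = trans (cong₂ _+_ (symm-balanced R q (suc j) s≤R)
    (cong₂ _*_ (trans (cong (q +_) (before-≥ 1 s≤R)) (+-identityʳ q)) (symm-balanced R q j s≤R))) (sym (τ-class j R q s≤R))
... | inj₂ refl = trans (cong₂ _+_ (trans (symm-cong R (suc j) full) (symm-balanced R (suc q) (suc j) z≤n))
    (cong₂ _*_ (trans (cong (q +_) (before-< {R} {suc R} 1 ≤-refl)) (+-comm q 1)) (trans (symm-cong R j full) (symm-balanced R (suc q) j z≤n))))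
  (sym (τ-class j R (suc q) z≤n))
  where
  full : ∀ c → c < R → q + before c (suc R) 1 ≡ suc q + before c 0 1
  full c c<R = trans (cong (q +_) (before-< {c} {suc R} 1 (m<n⇒m<1+n c<R)))
    (trans (+-comm q 1) (sym (trans (cong (suc q +_) (before-≥ {c} {0} 1 z≤n)) (+-identityʳ _))))

colouring : ℕ → ℕ → List ℕ
colouring R zero    = []
colouring R (suc b) = b % suc R ∷ colouring R b

colouring-bounded : ∀ R b → All (_< suc R) (colouring R b)
colouring-bounded R zero    = []
colouring-bounded R (suc b) = m%n<n b (suc R) ∷ colouring-bounded R b

colouring-balanced : ∀ R q s → s ≤ suc R → ∀ c → c < suc R →
  occurrences c (colouring R (s + q * suc R)) ≡ q + before c s 1
colouring-balanced R zero    zero    _ c c<r = sym (before-≥ {c} {0} 1 z≤n)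
colouring-balanced R (suc q) zero    _ c c<r = trans (colouring-balanced R q (suc R) ≤-refl c c<r)
  (trans (cong (q +_) (before-< {c} {suc R} 1 c<r)) (trans (+-comm q 1) (sym (trans (cong (suc q +_) (before-≥ {c} {0} 1 z≤n)) (+-identityʳ _)))))
colouring-balanced R q (suc s) (s≤s s≤R) c c<r = begin
  exactly c ((s + q * suc R) % suc R) 1 + occurrences c (colouring R (s + q * suc R))
    ≡⟨ cong₂ (λ u v → exactly c u 1 + v) (rem-rem R q s≤R) (colouring-balanced R q s (m≤n⇒m≤1+n s≤R) c c<r) ⟩
  exactly c s 1 + (q + before c s 1)
    ≡⟨ lin 3 (λ x y z → [] ⊢ x :+ (y :+ z) :≡ y :+ (z :+ x)) refl (exactly c s 1) q (before c s 1) ⟩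
  q + (before c s 1 + exactly c s 1)
    ≡⟨ cong (q +_) (before-suc c s 1) ⟩
  q + before c (suc s) 1 ∎
  where open ≡-Reasoning

colouring-τ : ∀ R b j → Colours.cl j (colouring R b) ≡ τ j b (suc R)
colouring-τ R b j with divide R b
... | divided q s s≤R = trans (colours-symm (suc R) j (colouring-bounded R (s + q * suc R)))
  (trans (symm-cong (suc R) j (colouring-balanced R q s (m≤n⇒m≤1+n s≤R))) (symm-balanced (suc R) q j (m≤n⇒m≤1+n s≤R)))

tabulate-toℕ : ∀ (f : ℕ → ℕ) n → tabulate {n = n} (f ∘ toℕ) ≡ applyUpTo f n
tabulate-toℕ f zero    = refl
tabulate-toℕ f (suc n) = cong (f 0 ∷_) (tabulate-toℕ (f ∘ suc) n)

applyUpTo-↭ : ∀ R b → applyUpTo (_% suc R) b ↭ colouring R b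
applyUpTo-↭ R zero    = ↭-refl
applyUpTo-↭ R (suc b) = ↭-trans (↭-reflexive (sym (applyUpTo-∷ʳ (_% suc R) b)))
  (↭-trans (↭-sym (∷↭∷ʳ (b % suc R) (applyUpTo (_% suc R) b))) (prep (b % suc R) (applyUpTo-↭ R b)))

turanC-τ : ∀ b j R → turanC b j (suc R) ≡ τ j b (suc R)
turanC-τ b j R = begin
  cliqueCount b (turanAdj b (suc R)) j
    ≡⟨ cliqueCount-cl b (turanAdj b (suc R)) adj-sym j ⟩
  Graphs.cl (turanAdj b (suc R)) adj-sym j (allFin b)
    ≡⟨ sym (cl-map differ differ-sym (λ u → toℕ u % suc R) j (allFin b)) ⟩
  Colours.cl j (map (λ u → toℕ u % suc R) (allFin b))
    ≡⟨ cong (Colours.cl j) (trans (map-tabulate (λ i → i) (λ u → toℕ u % suc R)) (tabulate-toℕ (_% suc R) b)) ⟩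
  Colours.cl j (applyUpTo (_% suc R) b)
    ≡⟨ Colours.cl-↭ j (applyUpTo-↭ R b) ⟩
  Colours.cl j (colouring R b)
    ≡⟨ colouring-τ R b j ⟩
  τ j b (suc R) ∎
  where
  open ≡-Reasoning
  adj-sym : ∀ (u v : Fin b) → turanAdj b (suc R) u v ≡ turanAdj b (suc R) v u
  adj-sym u v = differ-sym (toℕ u % suc R) (toℕ v % suc R)

τ-binomial : ∀ k n → τ k n 0 ≡ n C k
τ-binomial zero    n       = sym (trans (nCk≡nC[n∸k] {0} {n} z≤n) (nCn≡1 n))
τ-binomial (suc k) zero    = sym (k>n⇒nCk≡0 {0} {suc k} (s≤s z≤n))
τ-binomial (suc k) (suc n) = trans (+-comm (τ (suc k) n 0) (τ k n 0))
  (trans (cong₂ _+_ (τ-binomial k n) (τ-binomial (suc k) n)) (nCk+nC[k+1]≡[n+1]C[k+1] n k))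

-- Representations

sumTo-shift : ∀ n (f : ℕ → ℕ) → sumTo (suc n) f ≡ f 0 + sumTo n (f ∘ suc)
sumTo-shift zero    f = sym (+-identityʳ (f 0))
sumTo-shift (suc n) f = trans (cong (_+ f (suc n)) (sumTo-shift n f)) (+-assoc (f 0) _ _)

∸-suc : ∀ r i → r ∸ suc i ≡ pred r ∸ i
∸-suc zero    i = sym (0∸n≡0 i)
∸-suc (suc r) i = refl

Descending : ℕ → ℕ → (ℕ → ℕ) → Set
Descending r s b = ∀ i → i < s → b (suc i) < others (r ∸ i) (b i)

descending-tail : ∀ {r s b} → Descending r (suc s) b → Descending (pred r) s (b ∘ suc)
descending-tail {r} {s} {b} d i i<s = subst (λ t → b (2 + i) < others t (b (suc i))) (∸-suc r i) (d (suc i) (s≤s i<s))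

value-of : ℕ → ℕ → ℕ → (ℕ → ℕ) → ℕ
value-of k r s b = sumTo (suc s) (λ i → τ (k ∸ i) (b i) (r ∸ i))

value-of-tail : ∀ k r s b → value-of (suc k) r (suc s) b ≡ τ (suc k) (b 0) r + value-of k (pred r) s (b ∘ suc)
value-of-tail k r s b = trans (sumTo-shift (suc s) _)
  (cong (τ (suc k) (b 0) r +_) (sumTo-cong (suc s) (λ i → cong (τ (k ∸ i) (b (suc i))) (∸-suc r i))))

lifted-of : ℕ → ℕ → ℕ → (ℕ → ℕ) → ℕ
lifted-of k r s b = sumTo (suc s) (λ i → τ (suc (k ∸ i)) (b i) (r ∸ i))

lifted-of-tail : ∀ k r s b → lifted-of (suc k) r (suc s) b ≡ τ (2 + k) (b 0) r + lifted-of k (pred r) s (b ∘ suc)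
lifted-of-tail k r s b = trans (sumTo-shift (suc s) _)
  (cong (τ (2 + k) (b 0) r +_) (sumTo-cong (suc s) (λ i → cong (τ (suc (k ∸ i)) (b (suc i))) (∸-suc r i))))

value-of-≤ : ∀ k r s b → s < k → Descending r s b → value-of k r s b ≤ τ k (suc (b 0)) r
value-of-≤ (suc k) r zero    b _ _ = τ-suc-≤ (suc k) r (b 0)
value-of-≤ (suc k) r (suc s) b (s≤s s<k) d = ≤-trans (≤-reflexive (value-of-tail k r s b))
  (+-monoʳ-≤ (τ (suc k) (b 0) r) (≤-trans (value-of-≤ k (pred r) s (b ∘ suc) s<k (descending-tail {r} {s} {b} d))
    (τ-mono k (pred r) (d 0 (s≤s z≤n)))))

-- The descent condition keeps every tail of the representation within the block of the term before
-- it, so `ψ-block` can be applied term by term.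
ψ-value-of : ∀ κ r s b → s < suc κ → Descending r s b → ψ κ r (value-of (suc κ) r s b) ≡ lifted-of (suc κ) r s b
ψ-value-of κ       r zero    b _ _ = ψ-boundary κ r (b 0)
ψ-value-of zero    r (suc s) b (s≤s ()) _
ψ-value-of (suc κ) r (suc s) b (s≤s s<k) d = begin
  ψ (suc κ) r (value-of (2 + κ) r (suc s) b)                                     ≡⟨ cong (ψ (suc κ) r) (value-of-tail (suc κ) r s b) ⟩
  ψ (suc κ) r (τ (2 + κ) (b 0) r + value-of (suc κ) (pred r) s (b ∘ suc))        ≡⟨ ψ-block κ r (b 0) tail≤ ⟩
  τ (3 + κ) (b 0) r + ψ κ (pred r) (value-of (suc κ) (pred r) s (b ∘ suc))       ≡⟨ cong (τ (3 + κ) (b 0) r +_) (ψ-value-of κ (pred r) s (b ∘ suc) s<k d′) ⟩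
  τ (3 + κ) (b 0) r + lifted-of (suc κ) (pred r) s (b ∘ suc)                     ≡⟨ sym (lifted-of-tail (suc κ) r s b) ⟩
  lifted-of (2 + κ) r (suc s) b                                                  ∎
  where
  open ≡-Reasoning
  d′ = descending-tail {r} {s} {b} d
  tail≤ : value-of (suc κ) (pred r) s (b ∘ suc) ≤ block (suc κ) r (b 0)
  tail≤ = ≤-trans (value-of-≤ (suc κ) (pred r) s (b ∘ suc) s<k d′) (τ-mono (suc κ) (pred r) (d 0 (s≤s z≤n)))

canonical-< : ∀ k s (b : ℕ → ℕ) → s < k → (∀ i → i < s → b (suc i) < b i) → k ∸ s ≤ b s →
  sumTo (suc s) (λ i → b i C (k ∸ i)) < suc (b 0) C k
canonical-< (suc k) zero b _ _ low = subst₂ _<_ (τ-binomial (suc k) (b 0)) (τ-binomial (suc k) (suc (b 0)))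
  (m<m+n (τ (suc k) (b 0) 0) (τ-pos {k} {b 0} {0} (inj₁ refl) (<⇒≤ low)))
canonical-< (suc k) (suc s) b (s≤s s<k) d low = begin-strict
  sumTo (2 + s) (λ i → b i C (suc k ∸ i))                         ≡⟨ sumTo-shift (suc s) (λ i → b i C (suc k ∸ i)) ⟩
  b 0 C suc k + sumTo (suc s) (λ i → b (suc i) C (k ∸ i))         <⟨ +-monoʳ-< (b 0 C suc k) (canonical-< k s (b ∘ suc) s<k (λ i i<s → d (suc i) (s≤s i<s)) low) ⟩
  b 0 C suc k + suc (b 1) C k                                     ≡⟨ cong₂ _+_ (sym (τ-binomial (suc k) (b 0))) (sym (τ-binomial k (suc (b 1)))) ⟩
  τ (suc k) (b 0) 0 + τ k (suc (b 1)) 0                           ≤⟨ +-monoʳ-≤ (τ (suc k) (b 0) 0) (τ-mono k 0 (d 0 (s≤s z≤n))) ⟩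
  τ (suc k) (suc (b 0)) 0                                         ≡⟨ τ-binomial (suc k) (suc (b 0)) ⟩
  suc (b 0) C suc k                                               ∎
  where open ≤-Reasoning

aSumLG-ψ : ∀ κ s (a : ℕ → ℕ) → s < 2 + κ → (∀ i → 1 ≤ i → i < s → a (suc i) < a i) →
  ψ κ 0 (aSum (2 + κ) s a) ≡ aSumLG (2 + κ) s a
aSumLG-ψ κ zero    a _ _ = ψ-zero κ 0
aSumLG-ψ κ (suc s) a (s≤s s<k) d = trans
  (cong (ψ κ 0) (sumTo-cong (suc s) (λ i → binomial (suc κ ∸ i) i)))
  (trans (ψ-value-of κ 0 s (a ∘ suc) s<k (λ i i<s → subst (λ t → a (2 + i) < others t (a (suc i))) (sym (0∸n≡0 i)) (d (suc i) (s≤s z≤n) (s≤s i<s))))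
    (sumTo-cong (suc s) (λ i → sym (binomial (suc (suc κ ∸ i)) i))))
  where
  binomial : ∀ j i → a (suc i) C j ≡ τ j (a (suc i)) (0 ∸ i)
  binomial j i = trans (sym (τ-binomial j (a (suc i)))) (cong (τ j (a (suc i))) (sym (0∸n≡0 i)))

sumTo-cong-< : ∀ n {f g : ℕ → ℕ} → (∀ i → i < n → f i ≡ g i) → sumTo n f ≡ sumTo n g
sumTo-cong-< zero    e = refl
sumTo-cong-< (suc n) e = cong₂ _+_ (sumTo-cong-< n (λ i i<n → e i (m<n⇒m<1+n i<n))) (e n ≤-refl)

smValue-ψ : ∀ {R κ m} → suc κ ≤ suc R → (t : TuranRep (suc R) (suc κ) m) → smValue t ≡ ψ κ (suc R) m
smValue-ψ {R} {κ} {m} k≤r t = begin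
  smValue t                                           ≡⟨ sumTo-cong-< (suc s) (λ i i≤s → turán (suc (suc κ ∸ i)) i i≤s) ⟩
  lifted-of (suc κ) (suc R) s b                       ≡⟨ sym (ψ-value-of κ (suc R) s b pos decr) ⟩
  ψ κ (suc R) (value-of (suc κ) (suc R) s b)          ≡⟨ cong (ψ κ (suc R)) (trans (sym (sumTo-cong-< (suc s) (λ i i≤s → turán (suc κ ∸ i) i i≤s))) value) ⟩
  ψ κ (suc R) m                                       ∎
  where
  open ≡-Reasoning
  open TuranRep t
  turán : ∀ j i → i < suc s → turanC (b i) j (suc R ∸ i) ≡ τ j (b i) (suc R ∸ i)
  turán j i i≤s with suc R ∸ i in eq
  -- With zero parts `turanC` has an edgeless graph and `τ` a complete one; `i ≤ s < k ≤ r` excludes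
  -- this case.
  ... | zero  = ⊥-elim (<⇒≱ (<-≤-trans (≤-trans i≤s pos) k≤r) (m∸n≡0⇒m≤n eq))
  ... | suc r = turanC-τ (b i) j r

-- The bounds for a graph and the theorem

module _ (G : Graph) where
  open Graph G renaming (sym to adj-sym; n to size)
  open Graphs adj adj-sym

  vertices : List (Fin size)
  vertices = allFin size

  c≡cl : ∀ j → c G j ≡ cl j vertices
  c≡cl = cliqueCount-cl size adj adj-sym

  single-bound : ∀ κ nk → c G (suc κ) ≡ nk C suc κ → c G (2 + κ) ≤ nk C (2 + κ)
  single-bound κ nk e = begin
    c G (2 + κ)                    ≡⟨ c≡cl (2 + κ) ⟩
    cl (2 + κ) vertices                   ≤⟨ kruskal-katona κ vertices ⟩
    ψ κ 0 (cl (suc κ) vertices)           ≡⟨ cong (ψ κ 0) (trans (sym (c≡cl (suc κ))) (trans e (sym (τ-binomial (suc κ) nk)))) ⟩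
    ψ κ 0 (τ (suc κ) nk 0)         ≡⟨ ψ-boundary κ 0 nk ⟩
    τ (2 + κ) nk 0                 ≡⟨ τ-binomial (2 + κ) nk ⟩
    nk C (2 + κ)                   ∎
    where open ≤-Reasoning

  large-bound : ∀ κ nk n1 s (a : ℕ → ℕ) → s < 2 + κ → (∀ i → 1 ≤ i → i < s → a (suc i) < a i) →
    aSum (2 + κ) s a < n1 C κ → c G (2 + κ) ≡ nk C (2 + κ) + n1 C suc κ + aSum (2 + κ) s a → HasClique nk vertices →
    c G (3 + κ) ≤ nk C (3 + κ) + n1 C (2 + κ) + aSumLG (2 + κ) s a
  large-bound κ nk n1 s a s<k d ρ< e (hasClique W K splits clique refl) = begin
    c G (3 + κ)                                                ≡⟨ trans (c≡cl (3 + κ)) (cl-↭ (3 + κ) splits) ⟩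
    cl (3 + κ) (W ++ K)                                        ≡⟨ cl-links₊ (suc κ) W K ⟩
    cl (3 + κ) K + Σy (links (suc κ) W K)                      ≤⟨ +-monoʳ-≤ (cl (3 + κ) K) (clique-bound adj adj-sym κ n1 ρ {W} {K} clique Σx≡ (subst (ρ <_) (sym (τ-binomial κ n1)) ρ<)) ⟩
    cl (3 + κ) K + (τ (2 + κ) n1 0 + ψ κ 0 ρ)                  ≡⟨ sym (+-assoc (cl (3 + κ) K) _ _) ⟩
    cl (3 + κ) K + τ (2 + κ) n1 0 + ψ κ 0 ρ                    ≡⟨ cong₂ _+_ (cong₂ _+_ (trans (cl-clique (3 + κ) clique) (τ-binomial (3 + κ) nk)) (τ-binomial (2 + κ) n1)) (aSumLG-ψ κ s a s<k d) ⟩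
    nk C (3 + κ) + n1 C (2 + κ) + aSumLG (2 + κ) s a           ∎
    where
    open ≤-Reasoning
    ρ = aSum (2 + κ) s a
    Σx≡ : Σx (links (suc κ) W K) ≡ τ (suc κ) n1 0 + ρ
    Σx≡ = +-cancelˡ-≡ (cl (2 + κ) K) _ _ (trans (sym (cl-links (suc κ) W K)) (trans (sym (cl-↭ (2 + κ) splits))
      (trans (sym (c≡cl (2 + κ))) (trans e (trans (+-assoc (nk C (2 + κ)) _ _)
        (cong₂ (λ x y → x + (y + ρ)) (sym (trans (cl-clique (2 + κ) clique) (τ-binomial (2 + κ) nk))) (sym (τ-binomial (suc κ) n1))))))))

canonical-leading : ∀ {k m} (cr : CanonRep k m) {n} → n C k ≤ m → n ≤ CanonRep.nn cr 0
canonical-leading {k} {m} cr {n} nCk≤m = ≤-pred (τ-cancel-< k 0 (begin-strict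
  τ k n 0                  ≡⟨ τ-binomial k n ⟩
  n C k                    ≤⟨ nCk≤m ⟩
  m                        ≡⟨ sym value ⟩
  _                        <⟨ canonical-< k s nn pos decr low ⟩
  suc (nn 0) C k           ≡⟨ sym (τ-binomial k (suc (nn 0))) ⟩
  τ k (suc (nn 0)) 0       ∎))
  where
  open ≤-Reasoning
  open CanonRep cr

theorem2p18 : (k m : ℕ) → 1 ≤ k → 1 ≤ m → (G : Graph) → c G k ≡ m →
    (L : ℕ) → IsLG k m L →
    (SMUndefined k m → c G (suc k) ≤ L) ×
    ((S : ℕ) → IsSM k m S → c G (suc k) ≤ L ⊔ S)
theorem2p18 (suc κ) m 1≤k 1≤m G ck≡m .(nk C (2 + κ)) (single nk _ m≡) =
  (λ _ → bound) , (λ S _ → ≤-trans bound (m≤m⊔n _ S))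
  where
  bound : c G (2 + κ) ≤ nk C (2 + κ)
  bound = single-bound G κ nk (trans ck≡m m≡)
theorem2p18 (suc zero) m _ _ G _ _ (general _ _ _ _ (s≤s ()) _ _ _ _ _ _)
theorem2p18 (suc (suc κ)) m 1≤k 1≤m G ck≡m .(nk C (3 + κ) + n1 C (2 + κ) + aSumLG (2 + κ) s a)
  (general nk n1 s a 2≤k _ _ d low ρ< m≡) with Graphs.cl (Graph.adj G) (Graph.sym G) nk (vertices G) ≟ 0
... | no ≢0 = (λ _ → bound) , (λ S _ → ≤-trans bound (m≤m⊔n _ S))
  where
  s<k : ∀ s → (1 ≤ s → 2 + κ ∸ s ≤ a s × s < 2 + κ) → s < 2 + κ
  s<k zero    _   = s≤s z≤n
  s<k (suc s) low = proj₂ (low (s≤s z≤n))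
  bound : c G (3 + κ) ≤ nk C (3 + κ) + n1 C (2 + κ) + aSumLG (2 + κ) s a
  bound = large-bound G κ nk n1 s a (s<k s low) d ρ< (trans ck≡m m≡)
    (Graphs.find-clique (Graph.adj G) (Graph.sym G) nk (vertices G) ≢0)
... | yes ≡0 = undefined , defined
  where
  open Graphs (Graph.adj G) (Graph.sym G)
  k = 2 + κ
  -- A clique on `nk` vertices is excluded, with `nk` from the second representation. The canonical
  -- leading term is at least `nk`, since `nk C k ≤ m`.
  no-clique : (cr : CanonRep k m) → cl (CanonRep.nn cr 0) (vertices G) ≡ 0
  no-clique cr = cl-vanish-≥ {nk} (vertices G) (canonical-leading cr {nk} (≤-trans (m≤m+n (nk C k) _)
    (≤-trans (m≤m+n (nk C k + n1 C suc κ) (aSum k s a)) (≤-reflexive (sym m≡))))) ≡0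
  L = nk C suc k + n1 C k + aSumLG k s a
  undefined : SMUndefined k m → c G (suc k) ≤ L
  undefined (cr , leading≡k) = ⊥-elim (<⇒≱ 1≤m (≤-reflexive (trans (sym ck≡m) (trans (c≡cl G k)
    (trans (cong (λ j → cl j (vertices G)) (sym leading≡k)) (no-clique cr))))))
  defined : (S : ℕ) → IsSM k m S → c G (suc k) ≤ L ⊔ S
  defined S (cr , k<n , t , refl) = ≤-trans (by-leading (CanonRep.nn cr 0) k<n (no-clique cr) t) (m≤n⊔m L (smValue t))
    where
    by-leading : ∀ n → k < n → cl n (vertices G) ≡ 0 → (t : TuranRep (n ∸ 1) k m) → c G (suc k) ≤ smValue t
    by-leading (suc (suc R)) (s≤s k≤r) none t = begin
      c G (suc k)                               ≡⟨ c≡cl G (suc k) ⟩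
      cl (suc k) (vertices G)                          ≤⟨ coloured-bound (Graph.irrefl G) R (suc κ) (vertices G) none ⟩
      ψ (suc κ) (suc R) (cl k (vertices G))            ≡⟨ cong (ψ (suc κ) (suc R)) (trans (sym (c≡cl G k)) ck≡m) ⟩
      ψ (suc κ) (suc R) m                       ≡⟨ sym (smValue-ψ k≤r t) ⟩
      smValue t                                 ∎
      where open ≤-Reasoning
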